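{- Let $k\geq 3$ and let $f_{k,j}$ be defined as in the context. Then for every $n\in\mathbb{N}$, $$f_{k,n}(\tau)=\frac{n\,g_{2,2k-1,n}(\tau)}{2^{n-1}}-\sum_{\ell=2}^{n-1}\binom{n-1}{\ell-1}f_{k,\ell}(\tau)\frac{(n-\ell)\,g_{2,2k-1,n-\ell}(\tau)}{2^{n-\ell-2}}$$ and $$f_{k,n}(\tau)=\sum_{\ell=2}^{n}\frac{\ell\, g_{2,2k-1,\ell}(\tau)}{2^{\ell-1}}\frac{(n-1)!}{(\ell-1)!}\mathrm{Tr}_{n-\ell}(\psi,f_k;\tau),$$ where $\psi(\lambda)=(-1)^{\sum_{m}\ell_m}\phi(\lambda)$.
   Context: $\tau\in\mathbb{H}$, $q=e^{2\pi i\tau}$, $\zeta=e^{2\pi iz}$, $(a)_n=\prod_{m=0}^{n-1}(1-aq^m)$. For $k\ge3$, $FG_k(\zeta,q)=\sum_{n_{k-1}\geq\dots\geq n_1\geq 1}\frac{q^{n_1^2+\dots+n_{k-1}^2}}{(q)_{n_{k-1}-n_{k-2}}\cdots(q)_{n_2-n_1}(\zeta q)_{n_1}(\zeta^{ -1}q)_{n_1}}$ (generating function of Garvan's $k$-rank), and $\theta_{a,b}(\tau)=\sum_{n\in\mathbb{Z}}(-1)^nq^{(bn^2+an)/2}$. The functions $f_{k,j}$ ($j\in\mathbb{N}$) are defined by the identity (as power series in $z$ near $0$) $$FG_k(\zeta,q)+\frac{\theta_{1,2k-1}(\tau)}{(q)_\infty}=\frac{\sin(\pi z)}{\pi z(q)_\infty}\exp\left(2\sum_{j\ge1}f_{k,j}(\tau)\frac{(2\pi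 iz)^j}{j!}\right).$$ For integers $a,b$: $g_{a,b,0}:=1$, $g_{a,b,\ell}:=0$ for odd $\ell$, and for even $\ell\ge2$ $$g_{a,b,\ell}(\tau)=(1-2^{\ell-1})\frac{B_\ell}{2\ell}+\sum_{\substack{m,n\ge1\\ an-1\geq bm\geq b}}(an-bm)^{\ell-1}q^{mn}-\sum_{\substack{m,n\ge1\\ m-1\geq abn\geq ab}}(m-abn)^{\ell-1}q^{mn},$$ $B_\ell$ the Bernoulli numbers. For $\lambda=(1^{\ell_1},\dots,n^{\ell_n})\vdash n$, $f_\lambda=\prod_m f_{k,m}^{\ell_m}$, $\phi(\lambda)=\prod_m\frac{2^{\ell_m}}{\ell_m!\,m!^{\ell_m}}$, and $\mathrm{Tr}_n(\psi,f_k;\tau)=\sum_{\lambda\vdash n}\psi(\lambda)f_\lambda(\tau)$ ($\mathrm{Tr}_0=1$). -}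

module Defs where

-- Everything is done with FORMAL power series with rational coefficients.
--   QS : q-series            a : QS,  a N = coefficient of q^N
--   BS : series in w and q   A : BS,  A i N = coefficient of w^i q^N
-- where w = 2πiz, so ζ = e^{2πiz} = e^w and (2πiz)^j/j! = w^j/j!.

open import Data.Bool using (Bool; true; false; if_then_else_; _∧_)
open import Data.Nat as ℕ using (ℕ; zero; suc; _≡ᵇ_; _!)
open import Data.Nat.Combinatorics using (_C_)
open import Data.Integer as ℤ using (ℤ; +_; -[1+_])
open import Data.Rational as ℚ using (ℚ; 0ℚ; 1ℚ)
open import Data.List using (List; []; _∷_; foldr; map; concatMap; _++_)
open import Data.Product using (_×_; _,_)
open import Relation.Binary.PropositionalEquality using (_≡_)

range : ℕ → ℕ → List ℕ
range lo zero = if lo ≡ᵇ 0 then 0 ∷ [] else []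
range lo (suc hi) = range lo hi ++ (if lo ℕ.≤ᵇ suc hi then suc hi ∷ [] else [])

sumℚ : List ℚ → ℚ
sumℚ = foldr ℚ._+_ 0ℚ

prodℚ : List ℚ → ℚ
prodℚ = foldr ℚ._*_ 1ℚ

fromℕ : ℕ → ℚ
fromℕ n = (+ n) ℚ./ 1

fromℤ : ℤ → ℚ
fromℤ z = z ℚ./ 1

-- reciprocal of a natural number (only ever applied to nonzero numbers:
-- factorials, powers of 2, ℓ+1, ...; the value at 0 is irrelevant)
recip : ℕ → ℚ
recip zero = 0ℚ
recip (suc n) = (+ 1) ℚ./ suc n

twoPowNeg : ℤ → ℚ
twoPowNeg (+ e) = recip (2 ℕ.^ e)
twoPowNeg -[1+ e ] = fromℕ (2 ℕ.^ suc e)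

isEven : ℕ → Bool
isEven zero = true
isEven (suc zero) = false
isEven (suc (suc n)) = isEven n

indic : Bool → ℚ → ℚ
indic b x = if b then x else 0ℚ

nthD : List ℚ → ℕ → ℚ
nthD [] _ = 0ℚ
nthD (x ∷ xs) zero = x
nthD (x ∷ xs) (suc n) = nthD xs n

QS : Set
QS = ℕ → ℚ

zeroS oneS : QS
zeroS _ = 0ℚ
oneS N = indic (N ≡ᵇ 0) 1ℚ

mono : ℕ → QS
mono e N = indic (N ≡ᵇ e) 1ℚ

_+S_ _-S_ _*S_ : QS → QS → QS
(a +S b) N = a N ℚ.+ b N
(a -S b) N = a N ℚ.- b N
(a *S b) N = sumℚ (map (λ i → a i ℚ.* b (N ℕ.∸ i)) (range 0 N))

scaleS : ℚ → QS → QS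
scaleS c a N = c ℚ.* a N

powS : QS → ℕ → QS
powS a zero = oneS
powS a (suc r) = a *S powS a r

sumS : List QS → QS
sumS = foldr _+S_ zeroS

prodS : List QS → QS
prodS = foldr _*S_ oneS

_≈S_ : QS → QS → Set
a ≈S b = ∀ N → a N ≡ b N

BS : Set
BS = ℕ → QS

zeroB oneB : BS
zeroB _ = zeroS
oneB i = if i ≡ᵇ 0 then oneS else zeroS

constB : QS → BS
constB a i = if i ≡ᵇ 0 then a else zeroS

_+B_ _*B_ : BS → BS → BS
(A +B B) i = A i +S B i
(A *B B) i = sumS (map (λ j → A j *S B (i ℕ.∸ j)) (range 0 i))

powB : BS → ℕ → BS
powB A zero = oneB
powB A (suc r) = A *B powB A r

sumB : List BS → BS
sumB = foldr _+B_ zeroB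

prodB : List BS → BS
prodB = foldr _*B_ oneB

-- exp(Y) for Y with no w^0 term: coefficient of w^i is
-- sum_{r=0}^{i} (Y^r)_i / r!  (higher powers of Y have w-order > i)
expB : BS → BS
expB Y i = sumS (map (λ r → scaleS (recip (r !)) (powB Y r i)) (range 0 i))

-- 1/(1 - e^{σ w} q^m) = sum_{r≥0} e^{σ r w} q^{m r}   (m ≥ 1)
-- coefficient of w^i q^N : sum over r with m r = N of (σ r)^i / i!
geomB : ℤ → ℕ → BS
geomB σ m i N =
  sumℚ (map (λ r → indic ((m ℕ.* r) ≡ᵇ N)
                         (fromℤ ((σ ℤ.* (+ r)) ℤ.^ i) ℚ.* recip (i !)))
            (range 0 N))

-- 1/(e^{σ w} q)_n = prod_{m=1}^{n} 1/(1 - e^{σ w} q^m)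
-- σ = 1 : 1/(ζq)_n,  σ = -1 : 1/(ζ^{-1}q)_n,  σ = 0 : 1/(q)_n
invPochB : ℤ → ℕ → BS
invPochB σ n = prodB (map (geomB σ) (range 1 n))

invPoch : ℕ → QS
invPoch n = invPochB (+ 0) n 0

-- 1/(q)_∞ : the coefficient of q^N only involves the factors with m ≤ N
invPochInf : QS
invPochInf N = invPoch N N

-- Garvan's k-rank generating function FG_k(ζ,q), ζ = e^w.
-- FG_k = sum_{n_1≥1} q^{n_1^2} H_{k-2}(n_1) / ((ζq)_{n_1} (ζ^{-1}q)_{n_1}),
-- H_0(p) = 1,  H_{r+1}(p) = sum_{n ≥ p} q^{n^2} H_r(n) / (q)_{n-p}.
-- To compute the coefficient of q^N, all summation indices may be
-- truncated at T = N (a term with an index n > N is O(q^{n^2}) = o(q^N)).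

Hsum : ℕ → ℕ → ℕ → QS
Hsum T zero p = oneS
Hsum T (suc r) p =
  sumS (map (λ n → mono (n ℕ.* n) *S (invPoch (n ℕ.∸ p) *S Hsum T r n))
            (range p T))

FG : ℕ → BS
FG k i N =
  sumB (map (λ n₁ → constB (mono (n₁ ℕ.* n₁) *S Hsum N (k ℕ.∸ 2) n₁)
                     *B (invPochB (+ 1) n₁ *B invPochB (ℤ.- (+ 1)) n₁))
            (range 1 N)) i N

-- θ_{a,b}(τ) = sum_{n∈ℤ} (-1)^n q^{(b n^2 + a n)/2}
-- (used for a = 1, b = 2k-1, where the exponent is a nonnegative integer
-- and every n with exponent N satisfies |n| ≤ N)

sgn : ℕ → ℚ
sgn m = if isEven m then 1ℚ else ℚ.- 1ℚ

theta : ℕ → ℕ → QS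
theta a b N =
  sumℚ (map (λ m → indic (((b ℕ.* m ℕ.* m ℕ.+ a ℕ.* m) ℕ./ 2) ≡ᵇ N) (sgn m))
            (range 0 N))
  ℚ.+
  sumℚ (map (λ m → indic (((b ℕ.* m ℕ.* m ℕ.∸ a ℕ.* m) ℕ./ 2) ≡ᵇ N) (sgn m))
            (range 1 N))

-- sin(πz)/(πz) = sinh(w/2)/(w/2) = sum_m w^{2m} / (2^{2m} (2m+1)!)

sincB : BS
sincB i = if isEven i then constB (scaleS (recip (2 ℕ.^ i ℕ.* suc i !)) oneS) 0
                      else zeroS

-- Bernoulli numbers: B_0 = 1, sum_{j=0}^{m} C(m+1,j) B_j = 0 (m ≥ 1)

bernList : ℕ → List ℚ
bernList zero = 1ℚ ∷ []
bernList (suc m) =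
  bernList m ++
  (ℚ.- (recip (suc (suc m)) ℚ.*
        sumℚ (map (λ j → fromℕ (suc (suc m) C j) ℚ.* nthD (bernList m) j)
                  (range 0 m)))) ∷ []

bernoulli : ℕ → ℚ
bernoulli n = nthD (bernList n) n

gSeries : ℤ → ℤ → ℕ → QS
gSeries a b zero = oneS
gSeries a b (suc ℓ') =
  if isEven (suc ℓ') then series else zeroS
  where
  ℓ = suc ℓ'
  const : ℚ
  const = (1ℚ ℚ.- fromℕ (2 ℕ.^ ℓ')) ℚ.* bernoulli ℓ ℚ.* recip (2 ℕ.* ℓ)
  term : ℕ → ℕ → ℕ → ℚ
  term N m n =
    indic ((m ℕ.* n) ≡ᵇ N)
      (indic (((b ℤ.* + m) ℤ.≤ᵇ (a ℤ.* + n ℤ.- + 1)) ∧ (b ℤ.≤ᵇ (b ℤ.* + m)))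
             (fromℤ ((a ℤ.* + n ℤ.- b ℤ.* + m) ℤ.^ ℓ'))
       ℚ.-
       indic (((a ℤ.* b ℤ.* + n) ℤ.≤ᵇ (+ m ℤ.- + 1)) ∧ ((a ℤ.* b) ℤ.≤ᵇ (a ℤ.* b ℤ.* + n)))
             (fromℤ ((+ m ℤ.- a ℤ.* b ℤ.* + n) ℤ.^ ℓ')))
  series : QS
  series N = indic (N ≡ᵇ 0) const ℚ.+
    sumℚ (concatMap (λ m → map (λ n → term N m n) (range 1 N)) (range 1 N))

-- partitions of n, as lists of (part m, multiplicity ℓ_m) for m = n,...,1

partsAux : ℕ → ℕ → List (List (ℕ × ℕ))
partsAux zero zero = [] ∷ []
partsAux zero (suc r) = []
partsAux (suc m) r =
  concatMap (λ c → if (suc m ℕ.* c) ℕ.≤ᵇ r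
                     then map ((suc m , c) ∷_) (partsAux m (r ℕ.∸ suc m ℕ.* c))
                     else [])
            (range 0 r)

partitions : ℕ → List (List (ℕ × ℕ))
partitions n = partsAux n n

phi : List (ℕ × ℕ) → ℚ
phi λ' = prodℚ (map (λ { (m , l) → fromℕ (2 ℕ.^ l) ℚ.* recip (l ! ℕ.* (m !) ℕ.^ l) }) λ')

psi : List (ℕ × ℕ) → ℚ
psi λ' = sgn (foldr ℕ._+_ 0 (map (λ { (m , l) → l }) λ')) ℚ.* phi λ'

fLam : (ℕ → QS) → List (ℕ × ℕ) → QS
fLam f λ' = prodS (map (λ { (m , l) → powS (f m) l }) λ')

Tr : ℕ → (ℕ → QS) → QS
Tr n f = sumS (map (λ λ' → scaleS (psi λ') (fLam f λ')) (partitions n))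

expArg : (ℕ → QS) → BS
expArg f zero = zeroS
expArg f (suc j) = scaleS (fromℕ 2 ℚ.* recip (suc j !)) (f (suc j))

IsFk : ℕ → (ℕ → QS) → Set
IsFk k f = ∀ i N →
  (FG k +B constB (theta 1 (2 ℕ.* k ℕ.∸ 1) *S invPochInf)) i N
  ≡ (sincB *B (constB invPochInf *B expB (expArg f))) i N

gk : ℕ → ℕ → QS
gk k ℓ = gSeries (+ 2) (+ (2 ℕ.* k ℕ.∸ 1)) ℓ

rhs1 : ℕ → (ℕ → QS) → ℕ → QS
rhs1 k f n =
  scaleS (fromℕ n ℚ.* twoPowNeg (+ n ℤ.- + 1)) (gk k n)
  -S sumS (map (λ ℓ → scaleS (fromℕ ((n ℕ.∸ 1) C (ℓ ℕ.∸ 1)) ℚ.* fromℕ (n ℕ.∸ ℓ)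
                               ℚ.* twoPowNeg (+ n ℤ.- + ℓ ℤ.- + 2))
                              (f ℓ *S gk k (n ℕ.∸ ℓ)))
               (range 2 (n ℕ.∸ 1)))

rhs2 : ℕ → (ℕ → QS) → ℕ → QS
rhs2 k f n =
  sumS (map (λ ℓ → scaleS (fromℕ ℓ ℚ.* twoPowNeg (+ ℓ ℤ.- + 1)
                            ℚ.* (fromℕ ((n ℕ.∸ 1) !) ℚ.* recip ((ℓ ℕ.∸ 1) !)))
                           (gk k ℓ *S Tr (n ℕ.∸ ℓ) f))
            (range 2 n))

{-# OPTIONS --safe #-}
module Submission where

-- By Bailey's lemma (a = 1, ρ₁, ρ₂ → ∞), iterated k - 1 times from the unit Bailey pair and from the
-- pair with β_n = 1/((ζq)_n (ζ⁻¹q)_n), the numerator of the generating function is an Appell–Lerch sum: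
--   (q)_∞ FG_k + θ_{1,2k-1}
--     = 1 + Σ_{r≥1} (-1)^r q^{((2k-1)r² + r)/2} (1 + q^r)(1 - ζ)(1 - ζ⁻¹) / ((1 - ζq^r)(1 - ζ⁻¹q^r)).
-- Here (1 - ζ)(1 - ζ⁻¹) = -4 sinh²(w/2), and expanding each summand as a geometric series gives
--   2 sinh(w/2) (1 + q^r) / ((1 - ζq^r)(1 - ζ⁻¹q^r)) = Σ_{s≥0} 2 sinh((2s+1)w/2) q^{rs}.
-- Sorting the resulting lattice points by the parity of r matches them with those defining g_{2,2k-1},
-- whose points with even m cancel; the constant terms come from w / (2 sinh(w/2)) = Σ B_n(1/2) wⁿ/n!.
-- Hence exp(2 Σ f_j w^j/j!) = 1 + Σ_{n≥1} (n g_n / 2^{n-2}) wⁿ/n!. Applying w d/dw gives the first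
-- recursion, and multiplying by the inverse exp(-2 Σ f_j w^j/j!) = Σ Tr_n wⁿ gives the second.

open import Defs
open import Algebra.Bundles using (CommutativeRing)
open import Data.Bool using (Bool; if_then_else_; true; false; not; _∧_)
open import Data.Bool.Properties using (T-≡; ∧-identityʳ)
open import Data.Integer as ℤ using (ℤ; +_; -[1+_])
import Data.Integer.Properties as ℤₚ
open import Data.List using (List; []; _∷_; _++_; map; foldr; concatMap; length)
open import Data.List.Properties using (map-++; length-++)
open import Data.Maybe using (Maybe; just; nothing)
open import Data.Nat as ℕ using (ℕ; zero; suc; _∸_; _≡ᵇ_; z≤n; s≤s; _!; _≤_)
open import Data.Nat.Combinatorics using (_C_; nCk≡n!/k![n-k]!; k![n∸k]!∣n!)
open import Data.Nat.Divisibility using (_∣_)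
open import Data.Nat.DivMod using (m/n*n≡m; m*n/n≡m; /-congʳ)
import Data.Nat.Properties as ℕₚ
open import Data.Nat.Tactic.RingSolver using (solve-∀)
open import Data.Product using (_×_; _,_)
open import Data.Rational as ℚ using (ℚ; 0ℚ; 1ℚ; fromℚᵘ)
import Data.Rational.Properties as ℚₚ
open import Data.Rational.Unnormalised as ℚᵘ using (mkℚᵘ; *≡*)
import Data.Rational.Unnormalised.Properties as ℚᵘₚ
import Data.Sign as Sign
open import Data.Sum using (inj₁; inj₂)
open import Data.Unit using (⊤; tt)
open import Function.Bundles using (Equivalence)
open import Level using (_⊔_)
open import Relation.Binary.PropositionalEquality as ≡ using (_≡_; _≢_)
open import Relation.Nullary using (yes; no; contradiction)

-- Convolution sums and power series over a commutative ring

module IntegerSolver {c ℓ} (R : CommutativeRing c ℓ) where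
  open CommutativeRing R
  open import Algebra.Properties.Ring ring
  open import Algebra.Properties.AbelianGroup +-abelianGroup using (⁻¹-∙-comm)
  open import Algebra.Properties.Semiring.Mult.TCOptimised semiring using (1+×; ×-homo-+; ×1-homo-*) renaming (_×_ to _×ᴿ_)
  open import Algebra.Solver.Ring.AlmostCommutativeRing
  open import Relation.Binary.Reasoning.Setoid setoid

  ⟦_⟧ℤ : ℤ → Carrier
  ⟦ + n ⟧ℤ = n ×ᴿ 1#
  ⟦ -[1+ n ] ⟧ℤ = - (suc n ×ᴿ 1#)

  private
    suc× : ∀ n → suc n ×ᴿ 1# ≈ 1# + n ×ᴿ 1#
    suc× n = 1+× n 1#

    cancel+ : ∀ a x y → (a + x) - (a + y) ≈ x - y
    cancel+ a x y = begin
      (a + x) + - (a + y)      ≈⟨ +-cong (+-comm a x) (sym (⁻¹-∙-comm a y)) ⟩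
      (x + a) + (- a + - y)    ≈⟨ +-assoc x a _ ⟩
      x + (a + (- a + - y))    ≈⟨ +-congˡ (sym (+-assoc a (- a) (- y))) ⟩
      x + ((a + - a) + - y)    ≈⟨ +-congˡ (+-congʳ (-‿inverseʳ a)) ⟩
      x + (0# + - y)           ≈⟨ +-congˡ (+-identityˡ _) ⟩
      x - y ∎

    ⊖-homo : ∀ m n → ⟦ m ℤ.⊖ n ⟧ℤ ≈ m ×ᴿ 1# - n ×ᴿ 1#
    ⊖-homo zero zero = sym (-‿inverseʳ 0#)
    ⊖-homo zero (suc n) = sym (+-identityˡ _)
    ⊖-homo (suc m) zero = sym (trans (+-congˡ ε⁻¹≈ε) (+-identityʳ _))
      where open import Algebra.Properties.Group +-group using (ε⁻¹≈ε)
    ⊖-homo (suc m) (suc n) = begin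
      ⟦ suc m ℤ.⊖ suc n ⟧ℤ              ≡⟨ ≡.cong ⟦_⟧ℤ (ℤₚ.[1+m]⊖[1+n]≡m⊖n m n) ⟩
      ⟦ m ℤ.⊖ n ⟧ℤ                      ≈⟨ ⊖-homo m n ⟩
      m ×ᴿ 1# - n ×ᴿ 1#                    ≈⟨ sym (cancel+ 1# _ _) ⟩
      (1# + m ×ᴿ 1#) - (1# + n ×ᴿ 1#)      ≈⟨ sym (+-cong (suc× m) (-‿cong (suc× n))) ⟩
      suc m ×ᴿ 1# - suc n ×ᴿ 1# ∎

    +-homo : ∀ i j → ⟦ i ℤ.+ j ⟧ℤ ≈ ⟦ i ⟧ℤ + ⟦ j ⟧ℤ
    +-homo (+ m) (+ n) = ×-homo-+ 1# m n
    +-homo (+ m) -[1+ n ] = ⊖-homo m (suc n)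
    +-homo -[1+ m ] (+ n) = trans (⊖-homo n (suc m)) (+-comm _ _)
    +-homo -[1+ m ] -[1+ n ] = begin
      - (suc (suc (m ℕ.+ n)) ×ᴿ 1#)       ≡⟨ ≡.cong (λ z → - (suc z ×ᴿ 1#)) (≡.sym (ℕₚ.+-suc m n)) ⟩
      - ((suc m ℕ.+ suc n) ×ᴿ 1#)         ≈⟨ -‿cong (×-homo-+ 1# (suc m) (suc n)) ⟩
      - (suc m ×ᴿ 1# + suc n ×ᴿ 1#)        ≈⟨ sym (⁻¹-∙-comm _ _) ⟩
      - (suc m ×ᴿ 1#) + - (suc n ×ᴿ 1#) ∎

    neg-homo : ∀ i → ⟦ ℤ.- i ⟧ℤ ≈ - ⟦ i ⟧ℤ
    neg-homo (+ zero) = sym ε⁻¹≈ε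
      where open import Algebra.Properties.Group +-group using (ε⁻¹≈ε)
    neg-homo (+ suc n) = refl
    neg-homo -[1+ n ] = sym (-‿involutive _)

    ◃-homo⁻ : ∀ n → ⟦ Sign.- ℤ.◃ n ⟧ℤ ≈ - (n ×ᴿ 1#)
    ◃-homo⁻ n = trans (reflexive (≡.cong ⟦_⟧ℤ (ℤₚ.-◃n≡-n n))) (neg-homo (+ n))

    ◃-homo⁺ : ∀ n → ⟦ Sign.+ ℤ.◃ n ⟧ℤ ≈ n ×ᴿ 1#
    ◃-homo⁺ n = reflexive (≡.cong ⟦_⟧ℤ (ℤₚ.+◃n≡+n n))

    *-homo : ∀ i j → ⟦ i ℤ.* j ⟧ℤ ≈ ⟦ i ⟧ℤ * ⟦ j ⟧ℤ
    *-homo (+ m) (+ n) = trans (◃-homo⁺ (m ℕ.* n)) (×1-homo-* m n)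
    *-homo (+ m) -[1+ n ] = begin
      ⟦ Sign.- ℤ.◃ (m ℕ.* suc n) ⟧ℤ    ≈⟨ ◃-homo⁻ (m ℕ.* suc n) ⟩
      - ((m ℕ.* suc n) ×ᴿ 1#)             ≈⟨ -‿cong (×1-homo-* m (suc n)) ⟩
      - (m ×ᴿ 1# * suc n ×ᴿ 1#)            ≈⟨ -‿distribʳ-* _ _ ⟩
      m ×ᴿ 1# * - (suc n ×ᴿ 1#) ∎
    *-homo -[1+ m ] (+ n) = begin
      ⟦ Sign.- ℤ.◃ (suc m ℕ.* n) ⟧ℤ    ≈⟨ ◃-homo⁻ (suc m ℕ.* n) ⟩
      - ((suc m ℕ.* n) ×ᴿ 1#)             ≈⟨ -‿cong (×1-homo-* (suc m) n) ⟩
      - (suc m ×ᴿ 1# * n ×ᴿ 1#)            ≈⟨ -‿distribˡ-* _ _ ⟩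
      - (suc m ×ᴿ 1#) * n ×ᴿ 1# ∎
    *-homo -[1+ m ] -[1+ n ] = begin
      ⟦ Sign.+ ℤ.◃ (suc m ℕ.* suc n) ⟧ℤ  ≈⟨ ◃-homo⁺ (suc m ℕ.* suc n) ⟩
      (suc m ℕ.* suc n) ×ᴿ 1#             ≈⟨ ×1-homo-* (suc m) (suc n) ⟩
      suc m ×ᴿ 1# * suc n ×ᴿ 1#            ≈⟨ sym (-‿involutive _) ⟩
      - - (suc m ×ᴿ 1# * suc n ×ᴿ 1#)      ≈⟨ -‿cong (-‿distribˡ-* _ _) ⟩
      - (- (suc m ×ᴿ 1#) * suc n ×ᴿ 1#)    ≈⟨ -‿distribʳ-* _ _ ⟩
      - (suc m ×ᴿ 1#) * - (suc n ×ᴿ 1#) ∎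

    R′ : AlmostCommutativeRing c ℓ
    R′ = fromCommutativeRing R

    morphism : ℤ.+-*-rawRing -Raw-AlmostCommutative⟶ R′
    morphism = record
      { ⟦_⟧ = ⟦_⟧ℤ ; +-homo = +-homo ; *-homo = *-homo
      ; -‿homo = neg-homo ; 0-homo = refl ; 1-homo = refl }

    dec : ∀ i j → Maybe (⟦ i ⟧ℤ ≈ ⟦ j ⟧ℤ)
    dec i j with i ℤ.≟ j
    ... | yes i≡j = just (reflexive (≡.cong ⟦_⟧ℤ i≡j))
    ... | no _ = nothing

  open import Algebra.Solver.Ring ℤ.+-*-rawRing R′ morphism dec public
    using (solve; _:=_; _:+_; _:*_; _:-_; :-_; con)

module Convolution {c ℓ} (R : CommutativeRing c ℓ) where
  open CommutativeRing R
  open IntegerSolver R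
  open import Relation.Binary.Reasoning.Setoid setoid

  conv : ℕ → (ℕ → ℕ → Carrier) → Carrier
  conv zero F = F 0 0
  conv (suc n) F = F 0 (suc n) + conv n (λ i j → F (suc i) j)

  conv-cong : ∀ n {F G} → (∀ i j → i ℕ.+ j ≡ n → F i j ≈ G i j) → conv n F ≈ conv n G
  conv-cong zero h = h 0 0 ≡.refl
  conv-cong (suc n) h = +-cong (h 0 (suc n) ≡.refl)
    (conv-cong n (λ i j e → h (suc i) j (≡.cong suc e)))

  conv-cong′ : ∀ n {F G} → (∀ i j → F i j ≈ G i j) → conv n F ≈ conv n G
  conv-cong′ n h = conv-cong n (λ i j _ → h i j)

  conv-0 : ∀ n → conv n (λ _ _ → 0#) ≈ 0#
  conv-0 zero = refl
  conv-0 (suc n) = trans (+-identityˡ _) (conv-0 n)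

  conv-≈0 : ∀ n {F} → (∀ i j → i ℕ.+ j ≡ n → F i j ≈ 0#) → conv n F ≈ 0#
  conv-≈0 n h = trans (conv-cong n h) (conv-0 n)

  conv-+ : ∀ n F G → conv n (λ i j → F i j + G i j) ≈ conv n F + conv n G
  conv-+ zero F G = refl
  conv-+ (suc n) F G = begin
    _ ≈⟨ +-congˡ (conv-+ n _ _) ⟩
    _ ≈⟨ solve 4 (λ a b x y → (a :+ b) :+ (x :+ y) := (a :+ x) :+ (b :+ y)) refl _ _ _ _ ⟩
    _ ∎

  conv-*ˡ : ∀ n a F → conv n (λ i j → a * F i j) ≈ a * conv n F
  conv-*ˡ zero a F = refl
  conv-*ˡ (suc n) a F = trans (+-congˡ (conv-*ˡ n a _)) (sym (distribˡ a _ _))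

  conv-*ʳ : ∀ n a F → conv n (λ i j → F i j * a) ≈ conv n F * a
  conv-*ʳ zero a F = refl
  conv-*ʳ (suc n) a F = trans (+-congˡ (conv-*ʳ n a _)) (sym (distribʳ a _ _))

  conv-last : ∀ n F → conv (suc n) F ≈ conv n (λ i j → F i (suc j)) + F (suc n) 0
  conv-last zero F = refl
  conv-last (suc n) F = trans (+-congˡ (conv-last n (λ i j → F (suc i) j))) (sym (+-assoc _ _ _))

  conv-comm : ∀ n F → conv n F ≈ conv n (λ i j → F j i)
  conv-comm zero F = refl
  conv-comm (suc n) F = begin
    F 0 (suc n) + conv n (λ i j → F (suc i) j)  ≈⟨ +-congˡ (conv-comm n (λ i j → F (suc i) j)) ⟩
    F 0 (suc n) + conv n (λ i j → F (suc j) i)  ≈⟨ +-comm _ _ ⟩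
    conv n (λ i j → F (suc j) i) + F 0 (suc n)  ≈⟨ sym (conv-last n (λ i j → F j i)) ⟩
    conv (suc n) (λ i j → F j i) ∎

  conv-assoc : ∀ n (F : ℕ → ℕ → ℕ → Carrier) →
    conv n (λ m l → conv m (λ i j → F i j l)) ≈ conv n (λ i m → conv m (λ j l → F i j l))
  conv-assoc zero F = refl
  conv-assoc (suc n) F = begin
    F 0 0 (suc n) + conv n (λ m l → F 0 (suc m) l + conv m (λ i j → F (suc i) j l))
      ≈⟨ +-congˡ (conv-+ n _ _) ⟩
    F 0 0 (suc n) + (conv n (λ m l → F 0 (suc m) l) + conv n (λ m l → conv m (λ i j → F (suc i) j l)))
      ≈⟨ sym (+-assoc _ _ _) ⟩
    conv (suc n) (λ j l → F 0 j l) + conv n (λ m l → conv m (λ i j → F (suc i) j l))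
      ≈⟨ +-congˡ (conv-assoc n _) ⟩
    conv (suc n) (λ j l → F 0 j l) + conv n (λ i m → conv m (λ j l → F (suc i) j l)) ∎

  conv-index : ∀ n (f : ℕ → Carrier) F → conv n (λ i j → f (i ℕ.+ j) * F i j) ≈ f n * conv n F
  conv-index n f F = trans
    (conv-cong n (λ i j e → *-congʳ (reflexive (≡.cong f e))))
    (conv-*ˡ n (f n) F)

≡ᵇ-refl : ∀ n → (n ≡ᵇ n) ≡ true
≡ᵇ-refl zero = ≡.refl
≡ᵇ-refl (suc n) = ≡ᵇ-refl n

≡ᵇ-<ˡ : ∀ {m n} → m ℕ.< n → (m ≡ᵇ n) ≡ false
≡ᵇ-<ˡ {zero} {suc n} _ = ≡.refl
≡ᵇ-<ˡ {suc m} {suc n} (s≤s h) = ≡ᵇ-<ˡ h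

≤ᵇ-true : ∀ {m n} → m ℕ.≤ n → (m ℕ.≤ᵇ n) ≡ true
≤ᵇ-true h = Equivalence.to T-≡ (ℕₚ.≤⇒≤ᵇ h)

≤ᵇ-false : ∀ {m n} → n ℕ.< m → (m ℕ.≤ᵇ n) ≡ false
≤ᵇ-false {m} {n} h with m ℕ.≤ᵇ n in eq
... | false = ≡.refl
... | true = contradiction (ℕₚ.≤ᵇ⇒≤ m n (Equivalence.from T-≡ eq)) (ℕₚ.<⇒≱ h)

range-empty : ∀ lo hi → hi ℕ.< lo → range lo hi ≡ []
range-empty (suc lo) zero _ = ≡.refl
range-empty (suc lo) (suc hi) h rewrite range-empty (suc lo) hi (ℕₚ.<-trans (ℕₚ.n<1+n hi) h)
  | ≤ᵇ-false h = ≡.refl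

range-singleton : ∀ lo → range lo lo ≡ lo ∷ []
range-singleton zero = ≡.refl
range-singleton (suc lo) rewrite range-empty (suc lo) lo (ℕₚ.n<1+n lo) | ≤ᵇ-true (ℕₚ.≤-refl {suc lo}) = ≡.refl

range-snoc : ∀ lo d → range lo (suc (lo ℕ.+ d)) ≡ range lo (lo ℕ.+ d) ++ suc (lo ℕ.+ d) ∷ []
range-snoc lo d rewrite ≤ᵇ-true (ℕₚ.m≤n⇒m≤1+n (ℕₚ.m≤m+n lo d)) = ≡.refl

module RangeSum {c ℓ} (R : CommutativeRing c ℓ) where
  open CommutativeRing R
  open Convolution R

  sumList : List Carrier → Carrier
  sumList = foldr _+_ 0#

  sumList-++ : ∀ xs ys → sumList (xs ++ ys) ≈ sumList xs + sumList ys
  sumList-++ [] ys = sym (+-identityˡ _)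
  sumList-++ (x ∷ xs) ys = trans (+-congˡ (sumList-++ xs ys)) (sym (+-assoc _ _ _))

  ∑ : ℕ → (ℕ → Carrier) → Carrier
  ∑ n f = conv n (λ i _ → f i)

  ∑-snoc : ∀ n f → ∑ (suc n) f ≈ ∑ n f + f (suc n)
  ∑-snoc n f = conv-last n (λ i _ → f i)

  ∑-extend : ∀ d l f → d ℕ.≤ l → (∀ j → d ℕ.< j → f j ≈ 0#) → ∑ l f ≈ ∑ d f
  ∑-extend zero zero f _ h = refl
  ∑-extend zero (suc l) f _ h = trans (+-congˡ (conv-≈0 l (λ i j _ → h (suc i) (s≤s z≤n)))) (+-identityʳ _)
  ∑-extend (suc d) (suc l) f (s≤s le) h = +-congˡ (∑-extend d l (λ j → f (suc j)) le (λ j lt → h (suc j) (s≤s lt)))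

  ∑-conv : ∀ m n (F : ℕ → ℕ → ℕ → Carrier) →
    ∑ m (λ r → conv n (F r)) ≈ conv n (λ i j → ∑ m (λ r → F r i j))
  ∑-conv zero n F = refl
  ∑-conv (suc m) n F = trans (+-congˡ (∑-conv m n (λ r → F (suc r))))
    (sym (conv-+ n (F 0) (λ i j → ∑ m (λ r → F (suc r) i j))))

  sum-range : ∀ lo d (f : ℕ → Carrier) → sumList (map f (range lo (lo ℕ.+ d))) ≈ ∑ d (λ j → f (lo ℕ.+ j))
  sum-range lo zero f rewrite ℕₚ.+-identityʳ lo | range-singleton lo = +-identityʳ _
  sum-range lo (suc d) f rewrite ℕₚ.+-suc lo d | range-snoc lo d
    | map-++ f (range lo (lo ℕ.+ d)) (suc (lo ℕ.+ d) ∷ []) =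
    trans (sumList-++ (map f (range lo (lo ℕ.+ d))) _)
      (trans (+-cong (sum-range lo d f) (trans (+-identityʳ _)
        (reflexive (≡.cong f (≡.sym (ℕₚ.+-suc lo d))))))
        (sym (∑-snoc d (λ j → f (lo ℕ.+ j)))))

  sum-range₀ : ∀ n (f : ℕ → Carrier) → sumList (map f (range 0 n)) ≈ ∑ n f
  sum-range₀ = sum-range 0

-- Power series over R, two of them being identified when their coefficients agree at every index
-- satisfying P: with P = (_≤ N) this is the ring of series truncated after degree N.
module PowerSeries {c ℓ} (R : CommutativeRing c ℓ)
  (P : ℕ → Set) (down : ∀ {i n} → i ℕ.≤ n → P n → P i) where
  private module R = CommutativeRing R
  open R using (0#; 1#)
  open Convolution R
  open RangeSum R
  open IntegerSolver R
  open import Algebra.Properties.Ring R.ring using (-0#≈0#)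
  open import Relation.Binary.Reasoning.Setoid R.setoid

  PS : Set c
  PS = ℕ → R.Carrier

  infix 4 _≋_
  _≋_ : PS → PS → Set ℓ
  a ≋ b = ∀ n → P n → a n R.≈ b n

  infixl 6 _⊞_
  infixl 7 _⊠_
  _⊞_ _⊠_ : PS → PS → PS
  (a ⊞ b) n = a n R.+ b n
  (a ⊠ b) n = foldr R._+_ 0# (map (λ i → a i R.* b (n ∸ i)) (range 0 n))

  monomial : ℕ → PS
  monomial e n = if n ≡ᵇ e then 1# else 0#

  const : R.Carrier → PS
  const a n = if n ≡ᵇ 0 then a else 0#

  ⊠-conv : ∀ a b n → (a ⊠ b) n R.≈ conv n (λ i j → a i R.* b j)
  ⊠-conv a b n = R.trans (sum-range₀ n _) (conv-cong n (λ i j e → R.*-congˡ (R.reflexive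
    (≡.cong b (≡.trans (≡.cong (_∸ i) (≡.sym e)) (ℕₚ.m+n∸m≡n i j))))))

  ⊠-cong-≤ : ∀ {a b c d} n → (∀ i → i ℕ.≤ n → a i R.≈ c i) → (∀ i → i ℕ.≤ n → b i R.≈ d i) →
    (a ⊠ b) n R.≈ (c ⊠ d) n
  ⊠-cong-≤ {a} {b} {c} {d} n h k = R.trans (⊠-conv a b n) (R.trans
    (conv-cong n (λ i j e → R.*-cong (h i (≡.subst (i ℕ.≤_) e (ℕₚ.m≤m+n i j)))
      (k j (≡.subst (j ℕ.≤_) e (ℕₚ.m≤n+m j i))))) (R.sym (⊠-conv c d n)))

  ⊠-comm : ∀ a b n → (a ⊠ b) n R.≈ (b ⊠ a) n
  ⊠-comm a b n = begin
    (a ⊠ b) n                        ≈⟨ ⊠-conv a b n ⟩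
    conv n (λ i j → a i R.* b j)    ≈⟨ conv-comm n (λ i j → a i R.* b j) ⟩
    conv n (λ i j → a j R.* b i)    ≈⟨ conv-cong′ n (λ i j → R.*-comm _ _) ⟩
    conv n (λ i j → b i R.* a j)    ≈⟨ R.sym (⊠-conv b a n) ⟩
    (b ⊠ a) n ∎

  ⊠-assoc : ∀ a b d n → ((a ⊠ b) ⊠ d) n R.≈ (a ⊠ (b ⊠ d)) n
  ⊠-assoc a b d n = begin
    ((a ⊠ b) ⊠ d) n
      ≈⟨ ⊠-conv (a ⊠ b) d n ⟩
    conv n (λ m l → (a ⊠ b) m R.* d l)
      ≈⟨ conv-cong′ n (λ m l → R.trans (R.*-congʳ (⊠-conv a b m)) (R.sym (conv-*ʳ m (d l) (λ i j → a i R.* b j)))) ⟩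
    conv n (λ m l → conv m (λ i j → a i R.* b j R.* d l))
      ≈⟨ conv-assoc n (λ i j l → a i R.* b j R.* d l) ⟩
    conv n (λ i m → conv m (λ j l → a i R.* b j R.* d l))
      ≈⟨ conv-cong′ n (λ i m → R.trans (conv-cong′ m (λ j l → R.*-assoc _ _ _)) (conv-*ˡ m (a i) (λ j l → b j R.* d l))) ⟩
    conv n (λ i m → a i R.* conv m (λ j l → b j R.* d l))
      ≈⟨ conv-cong′ n (λ i m → R.*-congˡ (R.sym (⊠-conv b d m))) ⟩
    conv n (λ i m → a i R.* (b ⊠ d) m)
      ≈⟨ R.sym (⊠-conv a (b ⊠ d) n) ⟩
    (a ⊠ (b ⊠ d)) n ∎

  const-⊠ : ∀ u a n → (const u ⊠ a) n R.≈ u R.* a n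
  const-⊠ u a zero = R.+-identityʳ _
  const-⊠ u a (suc n) = begin
    (const u ⊠ a) (suc n)   ≈⟨ ⊠-conv (const u) a (suc n) ⟩
    u R.* a (suc n) R.+ conv n (λ i j → 0# R.* a j)
      ≈⟨ R.+-congˡ (conv-≈0 n (λ i j _ → R.zeroˡ _)) ⟩
    u R.* a (suc n) R.+ 0#  ≈⟨ R.+-identityʳ _ ⟩
    u R.* a (suc n) ∎

  ⊠-identityˡ : ∀ a n → (const 1# ⊠ a) n R.≈ a n
  ⊠-identityˡ a n = R.trans (const-⊠ 1# a n) (R.*-identityˡ _)

  ⊠-distribˡ : ∀ a b d n → (a ⊠ (b ⊞ d)) n R.≈ ((a ⊠ b) ⊞ (a ⊠ d)) n
  ⊠-distribˡ a b d n = begin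
    (a ⊠ (b ⊞ d)) n ≈⟨ ⊠-conv a (b ⊞ d) n ⟩
    conv n (λ i j → a i R.* (b j R.+ d j)) ≈⟨ conv-cong′ n (λ i j → R.distribˡ _ _ _) ⟩
    conv n (λ i j → a i R.* b j R.+ a i R.* d j)
      ≈⟨ conv-+ n (λ i j → a i R.* b j) (λ i j → a i R.* d j) ⟩
    conv n (λ i j → a i R.* b j) R.+ conv n (λ i j → a i R.* d j)
      ≈⟨ R.+-cong (R.sym (⊠-conv a b n)) (R.sym (⊠-conv a d n)) ⟩
    (a ⊠ b) n R.+ (a ⊠ d) n ∎

  ring : CommutativeRing c ℓ
  ring = record
    { Carrier = PS
    ; _≈_ = _≋_
    ; _+_ = _⊞_
    ; _*_ = _⊠_
    ; -_ = λ a n → R.- a n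
    ; 0# = λ _ → 0#
    ; 1# = const 1#
    ; isCommutativeRing = record
      { isRing = record
        { +-isAbelianGroup = record
          { isGroup = record
            { isMonoid = record
              { isSemigroup = record
                { isMagma = record
                  { isEquivalence = record
                    { refl = λ _ _ → R.refl
                    ; sym = λ h n x → R.sym (h n x)
                    ; trans = λ h k n x → R.trans (h n x) (k n x) }
                  ; ∙-cong = λ h k n x → R.+-cong (h n x) (k n x) }
                ; assoc = λ _ _ _ _ _ → R.+-assoc _ _ _ }
              ; identity = (λ _ _ _ → R.+-identityˡ _) , (λ _ _ _ → R.+-identityʳ _) }
            ; inverse = (λ _ _ _ → R.-‿inverseˡ _) , (λ _ _ _ → R.-‿inverseʳ _)
            ; ⁻¹-cong = λ h n x → R.-‿cong (h n x) }
          ; comm = λ _ _ _ _ → R.+-comm _ _ }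
        ; *-cong = λ h k n x → ⊠-cong-≤ n (λ i i≤n → h i (down i≤n x)) (λ i i≤n → k i (down i≤n x))
        ; *-assoc = λ a b d n _ → ⊠-assoc a b d n
        ; *-identity = (λ a n _ → ⊠-identityˡ a n)
                     , (λ a n _ → R.trans (⊠-comm a (const 1#) n) (⊠-identityˡ a n))
        ; distrib = (λ a b d n _ → ⊠-distribˡ a b d n)
                  , (λ a b d n _ → R.trans (⊠-comm (b ⊞ d) a n) (R.trans (⊠-distribˡ a b d n)
                      (R.+-cong (⊠-comm a b n) (⊠-comm a d n)))) }
      ; *-comm = λ a b n _ → ⊠-comm a b n } }

  const-cong : ∀ {u v} → u R.≈ v → const u ≋ const v
  const-cong e zero _ = e
  const-cong e (suc n) _ = R.refl

  const-* : ∀ u v → const (u R.* v) ≋ const u ⊠ const v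
  const-* u v zero _ = R.sym (const-⊠ u (const v) 0)
  const-* u v (suc n) _ = R.sym (R.trans (const-⊠ u (const v) (suc n)) (R.zeroʳ _))

  const-+ : ∀ u v → const (u R.+ v) ≋ const u ⊞ const v
  const-+ u v zero _ = R.refl
  const-+ u v (suc n) _ = R.sym (R.+-identityˡ _)

  const-neg : ∀ u → const (R.- u) ≋ (λ n → R.- const u n)
  const-neg u zero _ = R.refl
  const-neg u (suc n) _ = R.sym -0#≈0#

  ⊠-coeff₀ : ∀ a b → (a ⊠ b) 0 R.≈ a 0 R.* b 0
  ⊠-coeff₀ a b = R.+-identityʳ _

  monomial-suc : ∀ e a n → (monomial (suc e) ⊠ a) (suc n) R.≈ (monomial e ⊠ a) n
  monomial-suc e a n = begin
    (monomial (suc e) ⊠ a) (suc n)                    ≈⟨ ⊠-conv (monomial (suc e)) a (suc n) ⟩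
    0# R.* a (suc n) R.+ conv n (λ i j → monomial e i R.* a j)
      ≈⟨ R.trans (R.+-congʳ (R.zeroˡ _)) (R.+-identityˡ _) ⟩
    conv n (λ i j → monomial e i R.* a j)              ≈⟨ R.sym (⊠-conv (monomial e) a n) ⟩
    (monomial e ⊠ a) n ∎

  monomial-⊠ : ∀ e a n → (monomial e ⊠ a) (e ℕ.+ n) R.≈ a n
  monomial-⊠ zero a n = ⊠-identityˡ a n
  monomial-⊠ (suc e) a n = R.trans (monomial-suc e a (e ℕ.+ n)) (monomial-⊠ e a n)

  monomial-⊠-< : ∀ e a n → n ℕ.< e → (monomial e ⊠ a) n R.≈ 0#
  monomial-⊠-< (suc e) a zero _ = R.trans (⊠-coeff₀ (monomial (suc e)) a) (R.zeroˡ _)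
  monomial-⊠-< (suc e) a (suc n) (s≤s h) = R.trans (monomial-suc e a n) (monomial-⊠-< e a n h)

  monomial-* : ∀ e f n → monomial (e ℕ.+ f) n R.≈ (monomial e ⊠ monomial f) n
  monomial-* zero f n = R.sym (⊠-identityˡ (monomial f) n)
  monomial-* (suc e) f zero = R.sym (monomial-⊠-< (suc e) (monomial f) 0 (s≤s z≤n))
  monomial-* (suc e) f (suc n) = R.trans (monomial-* e f n) (R.sym (monomial-suc e (monomial f) n))

  monomial-< : ∀ e n → n ℕ.< e → monomial e n R.≈ 0#
  monomial-< e n h rewrite ≡ᵇ-<ˡ h = R.refl

  ⊠-zero-divisor : ∀ (a b : PS) (u : R.Carrier) → u R.* a 0 R.≈ 1# →
    ∀ n → (∀ m → m ℕ.≤ n → (a ⊠ b) m R.≈ 0#) → ∀ m → m ℕ.≤ n → b m R.≈ 0#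
  ⊠-zero-divisor a b u ua n h m m≤n = strong m m ℕₚ.≤-refl m≤n
    where
    unit : ∀ x → a 0 R.* x R.≈ 0# → x R.≈ 0#
    unit x e = begin
      x                  ≈⟨ R.sym (R.trans (R.*-congʳ ua) (R.*-identityˡ x)) ⟩
      u R.* a 0 R.* x    ≈⟨ R.trans (R.*-assoc _ _ _) (R.trans (R.*-congˡ e) (R.zeroʳ _)) ⟩
      0# ∎
    strong : ∀ k m → m ℕ.≤ k → m ℕ.≤ n → b m R.≈ 0#
    strong k zero _ _ = unit (b 0) (R.trans (R.sym (⊠-coeff₀ a b)) (h 0 z≤n))
    strong (suc k) (suc m) (s≤s m≤k) m<n = unit (b (suc m)) (begin
      a 0 R.* b (suc m)
        ≈⟨ R.sym (R.trans (R.+-congˡ (conv-≈0 m (λ i j e → R.trans (R.*-congˡ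
             (strong k j (ℕₚ.≤-trans (j≤ i j e) m≤k) (ℕₚ.≤-trans (j≤ i j e) (ℕₚ.≤-trans (ℕₚ.n≤1+n m) m<n)))) (R.zeroʳ _)))) (R.+-identityʳ _)) ⟩
      a 0 R.* b (suc m) R.+ conv m (λ i j → a (suc i) R.* b j)
        ≈⟨ R.sym (⊠-conv a b (suc m)) ⟩
      (a ⊠ b) (suc m) ≈⟨ h (suc m) m<n ⟩
      0# ∎)
      where
      j≤ : ∀ i j → i ℕ.+ j ≡ m → j ℕ.≤ m
      j≤ i j e = ≡.subst (j ℕ.≤_) e (ℕₚ.m≤n+m j i)

  private module S = CommutativeRing ring
  private module IS = IntegerSolver ring

  ⊠-cancelˡ : ∀ (a : PS) (u : R.Carrier) → u R.* a 0 R.≈ 1# → ∀ {b d} → a ⊠ b ≋ a ⊠ d → b ≋ d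
  ⊠-cancelˡ a u ua {b} {d} h n pn = difference (⊠-zero-divisor a (b ⊞ S.- d) u ua n diff n ℕₚ.≤-refl)
    where
    difference : ∀ {x y} → x R.+ R.- y R.≈ 0# → x R.≈ y
    difference {x} {y} e = begin
      x                      ≈⟨ solve 2 (λ x y → x := (x :- y) :+ y) R.refl x y ⟩
      x R.+ R.- y R.+ y      ≈⟨ R.trans (R.+-congʳ e) (R.+-identityˡ _) ⟩
      y ∎
    diff : ∀ m → m ℕ.≤ n → (a ⊠ (b ⊞ S.- d)) m R.≈ 0#
    diff m m≤n = S.trans {i = a ⊠ (b ⊞ S.- d)} {j = (a ⊠ b) ⊞ S.- (a ⊠ d)}
      (IS.solve 3 (λ a b d → a IS.:* (b IS.:- d)
         IS.:= a IS.:* b IS.:- a IS.:* d) S.refl a b d)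
      (λ i pi → R.trans (R.+-congʳ (h i pi)) (R.-‿inverseʳ _)) m (down m≤n pn)

-- Bailey pairs

-- Q m plays the role of q^m, and p n that of 1/(q)_n.
record PochhammerData {c ℓ} (R : CommutativeRing c ℓ) : Set (c ⊔ ℓ) where
  open CommutativeRing R
  field
    Q : ℕ → Carrier
    Q-0 : Q 0 ≈ 1#
    Q-+ : ∀ a b → Q (a ℕ.+ b) ≈ Q a * Q b
    1-Q-cancel : ∀ n x y → (1# - Q (suc n)) * x ≈ (1# - Q (suc n)) * y → x ≈ y
    p : ℕ → Carrier
    p-0 : p 0 ≈ 1#
    p-suc : ∀ n → (1# - Q (suc n)) * p (suc n) ≈ p n

module Bailey {c ℓ} (R : CommutativeRing c ℓ) (𝒫 : PochhammerData R) where
  open CommutativeRing R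
  open PochhammerData 𝒫
  open IntegerSolver R
  open Convolution R
  open import Relation.Binary.Reasoning.Setoid setoid

  Q≡ : ∀ {m} a b → m ≡ a ℕ.+ b → Q m ≈ Q a * Q b
  Q≡ a b ≡.refl = Q-+ a b

  p≡ : ∀ {m n} → m ≡ n → p m ≈ p n
  p≡ e = reflexive (≡.cong p e)

  1-Q0 : ∀ x → (1# - Q 0) * x ≈ 0#
  1-Q0 x = trans (*-congʳ (+-congˡ (-‿cong Q-0))) (solve 1 (λ x → (con (+ 1) :- con (+ 1)) :* x := con (+ 0)) refl x)

  durfee : ℕ → ℕ → Carrier
  durfee M s = conv M (λ j l → Q (j ℕ.* (j ℕ.+ s)) * (p l * (p j * p (s ℕ.+ j))))

  durfee-suc : ∀ M s → (1# - Q (suc M)) * durfee (suc M) s ≈ durfee M (suc s)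
  durfee-suc M s = begin
    (1# - Q (suc M)) * durfee (suc M) s
      ≈⟨ sym (conv-index (suc M) (λ m → 1# - Q m) F) ⟩
    conv (suc M) (λ j l → (1# - Q (j ℕ.+ l)) * (Q (j ℕ.* (j ℕ.+ s)) * (p l * (p j * p (s ℕ.+ j)))))
      ≈⟨ conv-cong′ (suc M) (λ j l → trans (*-congʳ (+-congˡ (-‿cong (Q-+ j l))))
           (solve 6 (λ u v e a b d → (con (+ 1) :- u :* v) :* (e :* (a :* (b :* d)))
               := (con (+ 1) :- v) :* a :* (u :* e :* (b :* d)) :+ (con (+ 1) :- u) :* b :* (e :* (a :* d)))
             refl (Q j) (Q l) (Q (j ℕ.* (j ℕ.+ s))) (p l) (p j) (p (s ℕ.+ j)))) ⟩
    conv (suc M) (λ j l → F₁ j l + F₂ j l)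
      ≈⟨ conv-+ (suc M) F₁ F₂ ⟩
    conv (suc M) F₁ + conv (suc M) F₂
      ≈⟨ +-cong (trans (conv-last M F₁) (trans (+-congˡ F₁0) (+-identityʳ _)))
                (trans (+-congʳ F₂0) (+-identityˡ _)) ⟩
    conv M (λ j l → F₁ j (suc l)) + conv M (λ j l → F₂ (suc j) l)
      ≈⟨ sym (conv-+ M _ _) ⟩
    conv M (λ j l → F₁ j (suc l) + F₂ (suc j) l)
      ≈⟨ conv-cong′ M step ⟩
    durfee M (suc s) ∎
    where
    F F₁ F₂ : ℕ → ℕ → Carrier
    F j l = Q (j ℕ.* (j ℕ.+ s)) * (p l * (p j * p (s ℕ.+ j)))
    F₁ j l = (1# - Q l) * p l * (Q j * Q (j ℕ.* (j ℕ.+ s)) * (p j * p (s ℕ.+ j)))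
    F₂ j l = (1# - Q j) * p j * (Q (j ℕ.* (j ℕ.+ s)) * (p l * p (s ℕ.+ j)))
    F₁0 : F₁ (suc M) 0 ≈ 0#
    F₁0 = trans (*-assoc _ _ _) (1-Q0 _)
    F₂0 : F₂ 0 (suc M) ≈ 0#
    F₂0 = trans (*-assoc _ _ _) (1-Q0 _)
    step : ∀ j l → F₁ j (suc l) + F₂ (suc j) l
         ≈ Q (j ℕ.* (j ℕ.+ suc s)) * (p l * (p j * p (suc s ℕ.+ j)))
    step j l = begin
      F₁ j (suc l) + F₂ (suc j) l
        ≈⟨ +-cong (*-cong (p-suc l) (*-congˡ (*-congˡ (sym (p-suc (s ℕ.+ j))))))
                  (*-cong (p-suc j) (*-cong
                    (trans (Q≡ (j ℕ.* (j ℕ.+ s)) (j ℕ.+ suc (s ℕ.+ j)) (eq₁ j s)) (*-congˡ (Q-+ j _)))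
                    (*-congˡ (p≡ (ℕₚ.+-suc s j))))) ⟩
      p l * (Q j * e * (p j * ((1# - v) * p′))) + p j * (e * (Q j * v) * (p l * p′))
        ≈⟨ solve 6 (λ pl u e pj v p′ →
             pl :* (u :* e :* (pj :* ((con (+ 1) :- v) :* p′))) :+ pj :* (e :* (u :* v) :* (pl :* p′))
             := (u :* e) :* (pl :* (pj :* p′))) refl (p l) (Q j) e (p j) v p′ ⟩
      Q j * e * (p l * (p j * p′))
        ≈⟨ *-congʳ (sym (Q≡ j _ (eq₂ j s))) ⟩
      Q (j ℕ.* (j ℕ.+ suc s)) * (p l * (p j * p′)) ∎
      where
      e = Q (j ℕ.* (j ℕ.+ s))
      v = Q (suc (s ℕ.+ j))
      p′ = p (suc (s ℕ.+ j))
      eq₁ : ∀ j s → suc j ℕ.* (suc j ℕ.+ s) ≡ j ℕ.* (j ℕ.+ s) ℕ.+ (j ℕ.+ suc (s ℕ.+ j))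
      eq₁ = solve-∀
      eq₂ : ∀ j s → j ℕ.* (j ℕ.+ suc s) ≡ j ℕ.+ j ℕ.* (j ℕ.+ s)
      eq₂ = solve-∀

  durfee-formula : ∀ M s → durfee M s ≈ p M * p (M ℕ.+ s)
  durfee-formula zero s = begin
    Q 0 * (p 0 * (p 0 * p (s ℕ.+ 0))) ≈⟨ *-cong Q-0 (*-congˡ (*-cong p-0 (p≡ (ℕₚ.+-identityʳ s)))) ⟩
    1# * (p 0 * (1# * p s)) ≈⟨ solve 2 (λ a b → con (+ 1) :* (a :* (con (+ 1) :* b)) := a :* b) refl _ _ ⟩
    p 0 * p s ∎
  durfee-formula (suc M) s = 1-Q-cancel M _ _ (begin
    (1# - Q (suc M)) * durfee (suc M) s ≈⟨ durfee-suc M s ⟩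
    durfee M (suc s)                    ≈⟨ durfee-formula M (suc s) ⟩
    p M * p (M ℕ.+ suc s)               ≈⟨ *-cong (sym (p-suc M)) (p≡ (ℕₚ.+-suc M s)) ⟩
    (1# - Q (suc M)) * p (suc M) * p (suc M ℕ.+ s) ≈⟨ *-assoc _ _ _ ⟩
    (1# - Q (suc M)) * (p (suc M) * p (suc M ℕ.+ s)) ∎)

  infixl 6 _⊕_
  _⊕_ : ℕ → ℕ → ℕ
  r ⊕ s = r ℕ.+ r ℕ.+ s

  IsBaileyPair : (ℕ → Carrier) → (ℕ → Carrier) → Set ℓ
  IsBaileyPair α β = ∀ n → β n ≈ conv n (λ r s → α r * (p s * p (r ⊕ s)))

  raise : (ℕ → Carrier) → (ℕ → Carrier)
  raise β L = conv L (λ n l → Q (n ℕ.* n) * (β n * p l))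

  bailey-lemma : ∀ {α β} → IsBaileyPair α β → IsBaileyPair (λ r → Q (r ℕ.* r) * α r) (raise β)
  bailey-lemma {α} {β} bp L = begin
    conv L (λ n l → Q (n ℕ.* n) * (β n * p l))
      ≈⟨ conv-cong′ L (λ n l → expand n l) ⟩
    conv L (λ n l → conv n (λ r j → F r j l))
      ≈⟨ conv-assoc L F ⟩
    conv L (λ r m → conv m (λ j l → F r j l))
      ≈⟨ conv-cong′ L collect ⟩
    conv L (λ r s → Q (r ℕ.* r) * α r * (p s * p (r ⊕ s))) ∎
    where
    F : ℕ → ℕ → ℕ → Carrier
    F r j l = Q ((r ℕ.+ j) ℕ.* (r ℕ.+ j)) * (α r * (p j * p (r ⊕ j))) * p l
    expand : ∀ n l → Q (n ℕ.* n) * (β n * p l) ≈ conv n (λ r j → F r j l)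
    expand n l = begin
      Q (n ℕ.* n) * (β n * p l)  ≈⟨ sym (*-assoc _ _ _) ⟩
      Q (n ℕ.* n) * β n * p l    ≈⟨ *-congʳ (*-congˡ (bp n)) ⟩
      Q (n ℕ.* n) * conv n _ * p l ≈⟨ *-congʳ (sym (conv-index n (λ m → Q (m ℕ.* m)) _)) ⟩
      conv n _ * p l             ≈⟨ sym (conv-*ʳ n (p l) _) ⟩
      conv n (λ r j → F r j l) ∎
    eq : ∀ r j → (r ℕ.+ j) ℕ.* (r ℕ.+ j) ≡ r ℕ.* r ℕ.+ j ℕ.* (j ℕ.+ (r ℕ.+ r))
    eq = solve-∀
    collect : ∀ r m → conv m (λ j l → F r j l) ≈ Q (r ℕ.* r) * α r * (p m * p (r ⊕ m))
    collect r m = begin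
      conv m (λ j l → F r j l)
        ≈⟨ conv-cong′ m (λ j l → trans (*-congʳ (*-congʳ (Q≡ _ _ (eq r j))))
             (solve 6 (λ a e α pj x pl → a :* e :* (α :* (pj :* x)) :* pl := a :* α :* (e :* (pl :* (pj :* x))))
               refl _ _ _ _ _ _)) ⟩
      conv m (λ j l → Q (r ℕ.* r) * α r * (Q (j ℕ.* (j ℕ.+ (r ℕ.+ r))) * (p l * (p j * p (r ⊕ j)))))
        ≈⟨ conv-*ˡ m _ _ ⟩
      Q (r ℕ.* r) * α r * durfee m (r ℕ.+ r)
        ≈⟨ *-congˡ (trans (durfee-formula m (r ℕ.+ r)) (*-congˡ (p≡ (ℕₚ.+-comm m _)))) ⟩
      Q (r ℕ.* r) * α r * (p m * p (r ⊕ m)) ∎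

  -- sq r = (-1)^r q^{r(r-1)/2}
  sq : ℕ → Carrier
  sq zero = 1#
  sq (suc r) = - (Q r * sq r)

  α⁰ : ℕ → Carrier
  α⁰ zero = 1#
  α⁰ (suc r) = sq (suc r) * (1# + Q (suc r))

  δ : ℕ → Carrier
  δ zero = 1#
  δ (suc _) = 0#

  -- The sum defining the unit pair telescopes; this is its tail from r + 1 on.
  unit-tail : ∀ m r →
    (1# - Q (suc (r ℕ.+ m))) * conv m (λ a b → α⁰ (suc (r ℕ.+ a)) * (p b * p (suc (r ℕ.+ a) ⊕ b)))
    ≈ sq (suc r) * (p m * p (suc (r ⊕ m)))
  unit-tail zero r = begin
    (1# - Q (suc (r ℕ.+ 0))) * (α⁰ (suc (r ℕ.+ 0)) * (p 0 * p (suc (r ℕ.+ 0) ⊕ 0)))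
      ≡⟨ ≡.cong (λ z → (1# - Q (suc z)) * (α⁰ (suc z) * (p 0 * p (suc z ⊕ 0)))) (ℕₚ.+-identityʳ r) ⟩
    (1# - u) * (sq (suc r) * (1# + u) * (p 0 * p (suc r ⊕ 0)))
      ≈⟨ *-congˡ (*-congˡ (*-congˡ (p≡ (eq r)))) ⟩
    (1# - u) * (sq (suc r) * (1# + u) * (p 0 * p (suc (suc (r ⊕ 0)))))
      ≈⟨ solve 4 (λ u s a b → (con (+ 1) :- u) :* (s :* (con (+ 1) :+ u) :* (a :* b))
           := s :* (a :* ((con (+ 1) :- u :* u) :* b))) refl u _ _ _ ⟩
    sq (suc r) * (p 0 * ((1# - u * u) * p (suc (suc (r ⊕ 0)))))
      ≈⟨ *-congˡ (*-congˡ (trans (*-congʳ (+-congˡ (-‿cong (sym (Q≡ (suc r) (suc r) (eq′ r)))))) (p-suc _))) ⟩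
    sq (suc r) * (p 0 * p (suc (r ⊕ 0))) ∎
    where
    u = Q (suc r)
    eq : ∀ r → suc r ℕ.+ suc r ℕ.+ 0 ≡ suc (suc (r ℕ.+ r ℕ.+ 0))
    eq = solve-∀
    eq′ : ∀ r → suc (suc (r ℕ.+ r ℕ.+ 0)) ≡ suc r ℕ.+ suc r
    eq′ = solve-∀
  unit-tail (suc m) r = begin
    (1# - Q (suc (r ℕ.+ suc m))) * (G 0 (suc m) + conv m (λ a b → G (suc a) b))
      ≈⟨ distribˡ _ _ _ ⟩
    (1# - Q (suc (r ℕ.+ suc m))) * G 0 (suc m) + (1# - Q (suc (r ℕ.+ suc m))) * conv m (λ a b → G (suc a) b)
      ≈⟨ +-cong headTerm tailTerm ⟩
    (1# - u * v) * (s * (1# + u) * (p (suc m) * P)) + - (u * s) * ((1# - v) * p (suc m) * P)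
      ≈⟨ solve 5 (λ u v s a b →
           (con (+ 1) :- u :* v) :* (s :* (con (+ 1) :+ u) :* (a :* b)) :+ :- (u :* s) :* ((con (+ 1) :- v) :* a :* b)
           := s :* (a :* ((con (+ 1) :- (u :* u) :* v) :* b))) refl u v s (p (suc m)) P ⟩
    s * (p (suc m) * ((1# - u * u * v) * P))
      ≈⟨ *-congˡ (*-congˡ (trans (*-congʳ (+-congˡ (-‿cong (sym Q3)))) (p-suc _))) ⟩
    s * (p (suc m) * p (suc (r ⊕ suc m))) ∎
    where
    G : ℕ → ℕ → Carrier
    G a b = α⁰ (suc (r ℕ.+ a)) * (p b * p (suc (r ℕ.+ a) ⊕ b))
    u = Q (suc r)
    v = Q (suc m)
    s = sq (suc r)
    P = p (suc (suc (r ⊕ suc m)))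
    Q3 : Q (suc (suc (r ⊕ suc m))) ≈ u * u * v
    Q3 = trans (Q≡ (suc r ℕ.+ suc r) (suc m) (eq r m)) (*-congʳ (Q-+ (suc r) (suc r)))
      where eq : ∀ r m → suc (suc (r ℕ.+ r ℕ.+ suc m)) ≡ (suc r ℕ.+ suc r) ℕ.+ suc m
            eq = solve-∀
    Q2 : Q (suc (r ℕ.+ suc m)) ≈ u * v
    Q2 = Q-+ (suc r) (suc m)
    headTerm : (1# - Q (suc (r ℕ.+ suc m))) * G 0 (suc m) ≈ (1# - u * v) * (s * (1# + u) * (p (suc m) * P))
    headTerm = *-cong (+-congˡ (-‿cong Q2)) (trans
      (reflexive (≡.cong (λ z → α⁰ (suc z) * (p (suc m) * p (suc z ⊕ suc m))) (ℕₚ.+-identityʳ r)))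
      (*-congˡ (*-congˡ (p≡ (eq r m)))))
      where eq : ∀ r m → suc r ℕ.+ suc r ℕ.+ suc m ≡ suc (suc (r ℕ.+ r ℕ.+ suc m))
            eq = solve-∀
    tailTerm : (1# - Q (suc (r ℕ.+ suc m))) * conv m (λ a b → G (suc a) b) ≈ - (u * s) * ((1# - v) * p (suc m) * P)
    tailTerm = begin
      (1# - Q (suc (r ℕ.+ suc m))) * conv m (λ a b → G (suc a) b)
        ≈⟨ *-cong (reflexive (≡.cong (λ z → 1# - Q (suc z)) (ℕₚ.+-suc r m)))
             (conv-cong′ m (λ a b → reflexive
               (≡.cong (λ z → α⁰ (suc z) * (p b * p (suc z ⊕ b))) (ℕₚ.+-suc r a)))) ⟩
      _ ≈⟨ unit-tail m (suc r) ⟩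
      sq (suc (suc r)) * (p m * p (suc (suc r ⊕ m)))
        ≈⟨ *-congˡ (*-cong (sym (p-suc m)) (p≡ (eq r m))) ⟩
      - (u * s) * ((1# - v) * p (suc m) * P) ∎
      where eq : ∀ r m → suc (suc r ℕ.+ suc r ℕ.+ m) ≡ suc (suc (r ℕ.+ r ℕ.+ suc m))
            eq = solve-∀

  unit-pair : IsBaileyPair α⁰ δ
  unit-pair zero = sym (trans (*-cong refl (*-cong p-0 p-0))
    (solve 0 (con (+ 1) :* (con (+ 1) :* con (+ 1)) := con (+ 1)) refl))
  unit-pair (suc m) = 1-Q-cancel m _ _ (sym (begin
    (1# - v) * (1# * (p (suc m) * p (suc m)) + conv m _)
      ≈⟨ distribˡ _ _ _ ⟩
    (1# - v) * (1# * (p (suc m) * p (suc m))) + (1# - v) * conv m _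
      ≈⟨ +-congˡ (unit-tail m 0) ⟩
    (1# - v) * (1# * (p (suc m) * p (suc m))) + - (Q 0 * 1#) * (p m * p (suc m))
      ≈⟨ +-congˡ (*-cong (-‿cong (*-congʳ Q-0)) (*-congʳ (sym (p-suc m)))) ⟩
    (1# - v) * (1# * (p (suc m) * p (suc m))) + - (1# * 1#) * ((1# - v) * p (suc m) * p (suc m))
      ≈⟨ solve 2 (λ v a → (con (+ 1) :- v) :* (con (+ 1) :* (a :* a))
             :+ :- (con (+ 1) :* con (+ 1)) :* ((con (+ 1) :- v) :* a :* a)
           := (con (+ 1) :- v) :* con (+ 0)) refl v (p (suc m)) ⟩
    (1# - v) * 0# ∎))
    where v = Q (suc m)

  module Rank (t : Carrier) (d : ℕ → Carrier)
    (d-inverse : ∀ r → (1# - t * Q (suc r) + Q (suc r) * Q (suc r)) * d (suc r) ≈ 1#) where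

    α : ℕ → Carrier
    α zero = 1#
    α (suc r) = α⁰ (suc r) * (Q (suc r) * ((1# + 1# - t) * d (suc r)))

    β : ℕ → Carrier
    β zero = 1#
    β (suc n) = β n * d (suc n)

    D : ℕ → Carrier
    D r = 1# - t * Q r + Q r * Q r

    Dα : ∀ r → D r * α r ≈ Q r * ((1# + 1# - t) * α⁰ r)
    Dα zero = begin
      (1# - t * Q 0 + Q 0 * Q 0) * 1#
        ≈⟨ *-congʳ (+-cong (+-congˡ (-‿cong (*-congˡ Q-0))) (*-cong Q-0 Q-0)) ⟩
      (1# - t * 1# + 1# * 1#) * 1#
        ≈⟨ solve 1 (λ t → let i = con (+ 1) in (i :- t :* i :+ i :* i) :* i := i :* ((i :+ i :- t) :* i)) refl t ⟩
      1# * ((1# + 1# - t) * 1#)  ≈⟨ *-congʳ (sym Q-0) ⟩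
      Q 0 * ((1# + 1# - t) * 1#) ∎
    Dα (suc r) = begin
      D (suc r) * (α⁰ (suc r) * (Q (suc r) * ((1# + 1# - t) * d (suc r))))
        ≈⟨ solve 5 (λ D a u e d → D :* (a :* (u :* (e :* d))) := u :* (e :* a) :* (D :* d)) refl _ _ _ _ _ ⟩
      Q (suc r) * ((1# + 1# - t) * α⁰ (suc r)) * (D (suc r) * d (suc r))
        ≈⟨ *-congˡ (d-inverse r) ⟩
      Q (suc r) * ((1# + 1# - t) * α⁰ (suc r)) * 1# ≈⟨ *-identityʳ _ ⟩
      Q (suc r) * ((1# + 1# - t) * α⁰ (suc r)) ∎

    S : ℕ → Carrier
    S n = conv n (λ r s → α r * (p s * p (r ⊕ s)))

    D-S : ∀ n → D (suc n) * S (suc n) ≈ S n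
    D-S n = begin
      D (suc n) * S (suc n)
        ≈⟨ sym (conv-index (suc n) D (λ r s → α r * (p s * p (r ⊕ s)))) ⟩
      conv (suc n) (λ r s → D (r ℕ.+ s) * (α r * (p s * p (r ⊕ s))))
        ≈⟨ conv-cong′ (suc n) split ⟩
      conv (suc n) (λ r s → Q (r ℕ.+ s) * F₁ r s + F₂ r s)
        ≈⟨ conv-+ (suc n) (λ r s → Q (r ℕ.+ s) * F₁ r s) F₂ ⟩
      conv (suc n) (λ r s → Q (r ℕ.+ s) * F₁ r s) + conv (suc n) F₂
        ≈⟨ +-cong sum₁ sum₂ ⟩
      0# + S n
        ≈⟨ +-identityˡ _ ⟩
      S n ∎
      where
      F₁ F₂ : ℕ → ℕ → Carrier
      F₁ r s = (1# + 1# - t) * (α⁰ r * (p s * p (r ⊕ s)))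
      F₂ r s = α r * ((1# - Q s) * p s * ((1# - Q (r ⊕ s)) * p (r ⊕ s)))
      split : ∀ r s → D (r ℕ.+ s) * (α r * (p s * p (r ⊕ s))) ≈ Q (r ℕ.+ s) * F₁ r s + F₂ r s
      split r s = begin
        D (r ℕ.+ s) * (α r * (a * b))
          ≈⟨ *-congʳ (+-cong (+-congˡ (-‿cong (*-congˡ (Q-+ r s)))) (*-cong (Q-+ r s) (Q-+ r s))) ⟩
        (1# - t * (u * v) + u * v * (u * v)) * (α r * (a * b))
          ≈⟨ solve 6 (λ t u v α a b → let i = con (+ 1) in
               (i :- t :* (u :* v) :+ u :* v :* (u :* v)) :* (α :* (a :* b))
               := v :* (((i :- t :* u :+ u :* u) :* α) :* (a :* b))
                  :+ α :* ((i :- v) :* a :* ((i :- u :* u :* v) :* b))) refl t u v (α r) a b ⟩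
        v * (D r * α r * (a * b)) + α r * ((1# - v) * a * ((1# - u * u * v) * b))
          ≈⟨ +-cong (*-congˡ (*-congʳ (Dα r)))
               (*-congˡ (*-congˡ (*-congʳ (+-congˡ (-‿cong
                 (sym (trans (Q-+ (r ℕ.+ r) s) (*-congʳ (Q-+ r r))))))))) ⟩
        v * (u * ((1# + 1# - t) * α⁰ r) * (a * b)) + F₂ r s
          ≈⟨ +-congʳ (solve 6 (λ v u e α a b → v :* (u :* (e :* α) :* (a :* b)) := (u :* v) :* (e :* (α :* (a :* b)))) refl _ _ _ _ _ _) ⟩
        u * v * F₁ r s + F₂ r s ≈⟨ +-congʳ (*-congʳ (sym (Q-+ r s))) ⟩
        Q (r ℕ.+ s) * F₁ r s + F₂ r s ∎
        where
        u = Q r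
        v = Q s
        a = p s
        b = p (r ⊕ s)
      sum₁ : conv (suc n) (λ r s → Q (r ℕ.+ s) * F₁ r s) ≈ 0#
      sum₁ = begin
        _ ≈⟨ conv-index (suc n) Q F₁ ⟩
        Q (suc n) * conv (suc n) F₁ ≈⟨ *-congˡ (trans (conv-*ˡ (suc n) _ (λ r s → α⁰ r * (p s * p (r ⊕ s)))) (*-congˡ (sym (unit-pair (suc n))))) ⟩
        Q (suc n) * ((1# + 1# - t) * 0#) ≈⟨ trans (*-congˡ (zeroʳ _)) (zeroʳ _) ⟩
        0# ∎
      sum₂ : conv (suc n) F₂ ≈ S n
      sum₂ = begin
        conv (suc n) F₂ ≈⟨ conv-last n F₂ ⟩
        conv n (λ r s → F₂ r (suc s)) + F₂ (suc n) 0
          ≈⟨ +-cong (conv-cong′ n (λ r s → *-congˡ (*-cong (p-suc s)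
                (trans (reflexive (≡.cong (λ z → (1# - Q z) * p z) (ℕₚ.+-suc (r ℕ.+ r) s))) (p-suc _)))))
               (trans (*-congˡ (trans (*-assoc _ _ _) (1-Q0 _))) (zeroʳ _)) ⟩
        S n + 0# ≈⟨ +-identityʳ _ ⟩
        S n ∎

    rank-pair : IsBaileyPair α β
    rank-pair zero = unit-pair 0
    rank-pair (suc n) = begin
      β n * d (suc n)                       ≈⟨ *-congʳ (trans (rank-pair n) (sym (D-S n))) ⟩
      D (suc n) * S (suc n) * d (suc n)     ≈⟨ solve 3 (λ a b c → a :* b :* c := (a :* c) :* b) refl _ _ _ ⟩
      D (suc n) * d (suc n) * S (suc n)     ≈⟨ *-congʳ (d-inverse n) ⟩
      1# * S (suc n)                        ≈⟨ *-identityˡ _ ⟩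
      S (suc n) ∎

  module Truncated (N : ℕ) (Q-vanish : ∀ n → N ℕ.< n → Q n ≈ 0#)
    (p∞ : Carrier) (p-stable : ∀ n → N ℕ.≤ n → p n ≈ p∞)
    (p∞-cancel : ∀ x y → p∞ * x ≈ p∞ * y → x ≈ y)
    where
    open RangeSum R

    n≤n² : ∀ n → n ℕ.≤ n ℕ.* n
    n≤n² zero = z≤n
    n≤n² (suc n) = ℕₚ.m≤m*n (suc n) (suc n)

    Q²-vanish : ∀ r n → N ℕ.< n → Q (suc r ℕ.* (n ℕ.* n)) ≈ 0#
    Q²-vanish r n lt = Q-vanish _ (ℕₚ.<-≤-trans lt (ℕₚ.≤-trans (n≤n² n) (ℕₚ.m≤n*m (n ℕ.* n) (suc r))))

    Q-sq-vanish : ∀ n → N ℕ.< n → Q (n ℕ.* n) ≈ 0#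
    Q-sq-vanish n lt = Q-vanish _ (ℕₚ.<-≤-trans lt (n≤n² n))

    raiseⁿ : ℕ → (ℕ → Carrier) → (ℕ → Carrier)
    raiseⁿ zero β = β
    raiseⁿ (suc r) β = raiseⁿ r (raise β)

    IsBaileyPair-cong : ∀ {α α′ β} → (∀ n → α n ≈ α′ n) → IsBaileyPair α β → IsBaileyPair α′ β
    IsBaileyPair-cong h bp n = trans (bp n) (conv-cong′ n (λ r s → *-congʳ (h r)))

    bailey-chain : ∀ r {α β} → IsBaileyPair α β → IsBaileyPair (λ n → Q (r ℕ.* (n ℕ.* n)) * α n) (raiseⁿ r β)
    bailey-chain zero bp = IsBaileyPair-cong (λ n → sym (trans (*-congʳ Q-0) (*-identityˡ _))) bp
    bailey-chain (suc r) {α} bp = IsBaileyPair-cong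
      (λ n → trans (sym (*-assoc _ _ _))
        (*-congʳ (trans (*-comm _ _) (sym (Q-+ (n ℕ.* n) (r ℕ.* (n ℕ.* n)))))))
      (bailey-chain r (bailey-lemma bp))

    -- The nested sum over n ≤ n₂ ≤ … ≤ n_{r+1} ≤ n + l, with the weight p of the last gap included.
    nested : ℕ → ℕ → ℕ → Carrier
    nested zero n l = p l
    nested (suc r) n l = conv l (λ j l′ → Q ((n ℕ.+ j) ℕ.* (n ℕ.+ j)) * (p j * nested r (n ℕ.+ j) l′))

    raiseⁿ-nested : ∀ r β L → conv L (λ n l → Q (n ℕ.* n) * (β n * nested r n l)) ≈ raiseⁿ (suc r) β L
    raiseⁿ-nested zero β L = refl
    raiseⁿ-nested (suc r) β L = begin
      conv L (λ n l → Q (n ℕ.* n) * (β n * nested (suc r) n l))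
        ≈⟨ conv-cong′ L (λ n l → trans (sym (*-assoc _ _ _)) (sym (conv-*ˡ l _ _))) ⟩
      conv L (λ n l → conv l (λ j l′ → F n j l′))
        ≈⟨ sym (conv-assoc L F) ⟩
      conv L (λ m l′ → conv m (λ n j → F n j l′))
        ≈⟨ conv-cong′ L collect ⟩
      conv L (λ m l′ → Q (m ℕ.* m) * (raise β m * nested r m l′))
        ≈⟨ raiseⁿ-nested r (raise β) L ⟩
      raiseⁿ (suc r) (raise β) L ∎
      where
      F : ℕ → ℕ → ℕ → Carrier
      F n j l′ = Q (n ℕ.* n) * β n * (Q ((n ℕ.+ j) ℕ.* (n ℕ.+ j)) * (p j * nested r (n ℕ.+ j) l′))
      collect : ∀ m l′ → conv m (λ n j → F n j l′) ≈ Q (m ℕ.* m) * (raise β m * nested r m l′)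
      collect m l′ = begin
        conv m (λ n j → F n j l′)
          ≈⟨ conv-cong′ m (λ n j → solve 5 (λ a b q p k → a :* b :* (q :* (p :* k)) := q :* k :* (a :* (b :* p))) refl
               (Q (n ℕ.* n)) (β n) (Q ((n ℕ.+ j) ℕ.* (n ℕ.+ j))) (p j) (nested r (n ℕ.+ j) l′)) ⟩
        conv m (λ n j → Q ((n ℕ.+ j) ℕ.* (n ℕ.+ j)) * nested r (n ℕ.+ j) l′ * (Q (n ℕ.* n) * (β n * p j)))
          ≈⟨ conv-index m (λ z → Q (z ℕ.* z) * nested r z l′) (λ n j → Q (n ℕ.* n) * (β n * p j)) ⟩
        Q (m ℕ.* m) * nested r m l′ * raise β m
          ≈⟨ solve 3 (λ a b c → a :* b :* c := a :* (c :* b)) refl _ _ _ ⟩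
        Q (m ℕ.* m) * (raise β m * nested r m l′) ∎

    truncNested : ℕ → ℕ → Carrier
    truncNested zero n = 1#
    truncNested (suc r) n = sumList (map (λ m → Q (m ℕ.* m) * (p (m ∸ n) * truncNested r m)) (range n N))

    truncNested-suc : ∀ r n → n ℕ.≤ N → truncNested (suc r) n
      ≈ ∑ (N ∸ n) (λ j → Q ((n ℕ.+ j) ℕ.* (n ℕ.+ j)) * (p j * truncNested r (n ℕ.+ j)))
    truncNested-suc r n n≤N = begin
      sumList (map f (range n N)) ≡⟨ ≡.cong (λ z → sumList (map f (range n z))) (≡.sym (ℕₚ.m+[n∸m]≡n n≤N)) ⟩
      sumList (map f (range n (n ℕ.+ (N ∸ n)))) ≈⟨ sum-range n (N ∸ n) f ⟩
      ∑ (N ∸ n) (λ j → f (n ℕ.+ j)) ≈⟨ conv-cong′ (N ∸ n) (λ j _ → *-congˡ (*-congʳ (p≡ (ℕₚ.m+n∸m≡n n j)))) ⟩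
      _ ∎
      where
      f : ℕ → Carrier
      f m = Q (m ℕ.* m) * (p (m ∸ n) * truncNested r m)

    nested-truncated : ∀ r n l → n ℕ.+ l ≡ N ℕ.+ N → n ℕ.≤ N → nested r n l ≈ p∞ * truncNested r n
    nested-truncated zero n l e n≤N = trans (p-stable l N≤l) (sym (*-identityʳ _))
      where
      N≤l : N ℕ.≤ l
      N≤l = ℕₚ.+-cancelˡ-≤ N N l (ℕₚ.≤-trans (ℕₚ.≤-reflexive (≡.sym e)) (ℕₚ.+-monoˡ-≤ l n≤N))
    nested-truncated (suc r) n l e n≤N = begin
      conv l (λ j l′ → Q ((n ℕ.+ j) ℕ.* (n ℕ.+ j)) * (p j * nested r (n ℕ.+ j) l′))
        ≈⟨ conv-cong l term ⟩
      conv l (λ j _ → p∞ * G j)                ≈⟨ conv-*ˡ l p∞ (λ j _ → G j) ⟩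
      p∞ * ∑ l G                               ≈⟨ *-congˡ (∑-extend (N ∸ n) l G d≤l G-vanish) ⟩
      p∞ * ∑ (N ∸ n) G                         ≈⟨ *-congˡ (sym (truncNested-suc r n n≤N)) ⟩
      p∞ * truncNested (suc r) n ∎
      where
      G : ℕ → Carrier
      G j = Q ((n ℕ.+ j) ℕ.* (n ℕ.+ j)) * (p j * truncNested r (n ℕ.+ j))
      d≤l : N ∸ n ℕ.≤ l
      d≤l = ℕₚ.m≤n+o⇒m∸n≤o N n (ℕₚ.≤-trans (ℕₚ.m≤m+n N N) (ℕₚ.≤-reflexive (≡.sym e)))
      G-vanish : ∀ j → N ∸ n ℕ.< j → G j ≈ 0#
      G-vanish j lt = trans (*-congʳ (Q-sq-vanish _ (≡.subst (ℕ._< n ℕ.+ j) (ℕₚ.m+[n∸m]≡n n≤N) (ℕₚ.+-monoʳ-< n lt)))) (zeroˡ _)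
      term : ∀ j l′ → j ℕ.+ l′ ≡ l →
        Q ((n ℕ.+ j) ℕ.* (n ℕ.+ j)) * (p j * nested r (n ℕ.+ j) l′) ≈ p∞ * G j
      term j l′ e′ with n ℕ.+ j ℕ.≤? N
      ... | yes le = trans (*-congˡ (*-congˡ (nested-truncated r (n ℕ.+ j) l′
              (≡.trans (ℕₚ.+-assoc n j l′) (≡.trans (≡.cong (n ℕ.+_) e′) e)) le)))
              (solve 4 (λ q a i h → q :* (a :* (i :* h)) := i :* (q :* (a :* h))) refl _ _ _ _)
      ... | no ¬le = trans (*-congʳ Q≈0) (trans (zeroˡ _)
              (sym (trans (*-congˡ (trans (*-congʳ Q≈0) (zeroˡ _))) (zeroʳ _))))
        where Q≈0 = Q-sq-vanish _ (ℕₚ.≰⇒> ¬le)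

    -- Letting L → ∞ in the Bailey chain; modulo q^(N+1), L = 2N is already large enough.
    bailey-limit : ∀ r {α β} → IsBaileyPair α β →
      ∑ N (λ n → Q (n ℕ.* n) * (β n * truncNested r n)) ≈ p∞ * ∑ N (λ s → Q (suc r ℕ.* (s ℕ.* s)) * α s)
    bailey-limit r {α} {β} bp = p∞-cancel _ _ (begin
      p∞ * ∑ N f                  ≈⟨ *-congˡ (sym (∑-extend N (N ℕ.+ N) f (ℕₚ.m≤m+n N N) f-vanish)) ⟩
      p∞ * ∑ (N ℕ.+ N) f          ≈⟨ sym (conv-*ˡ (N ℕ.+ N) p∞ (λ n _ → f n)) ⟩
      conv (N ℕ.+ N) (λ n _ → p∞ * f n)  ≈⟨ sym (conv-cong (N ℕ.+ N) lhs) ⟩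
      conv (N ℕ.+ N) (λ n l → Q (n ℕ.* n) * (β n * nested r n l))  ≈⟨ raiseⁿ-nested r β (N ℕ.+ N) ⟩
      raiseⁿ (suc r) β (N ℕ.+ N)  ≈⟨ bailey-chain (suc r) bp (N ℕ.+ N) ⟩
      conv (N ℕ.+ N) (λ s l → g s * (p l * p (s ⊕ l)))  ≈⟨ conv-cong (N ℕ.+ N) rhs ⟩
      conv (N ℕ.+ N) (λ s _ → p∞ * p∞ * g s)  ≈⟨ conv-*ˡ (N ℕ.+ N) (p∞ * p∞) (λ s _ → g s) ⟩
      p∞ * p∞ * ∑ (N ℕ.+ N) g     ≈⟨ *-congˡ (∑-extend N (N ℕ.+ N) g (ℕₚ.m≤m+n N N) g-vanish) ⟩
      p∞ * p∞ * ∑ N g             ≈⟨ *-assoc _ _ _ ⟩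
      p∞ * (p∞ * ∑ N g) ∎)
      where
      f g : ℕ → Carrier
      f n = Q (n ℕ.* n) * (β n * truncNested r n)
      g s = Q (suc r ℕ.* (s ℕ.* s)) * α s
      f-vanish : ∀ n → N ℕ.< n → f n ≈ 0#
      f-vanish n lt = trans (*-congʳ (Q-sq-vanish n lt)) (zeroˡ _)
      g-vanish : ∀ n → N ℕ.< n → g n ≈ 0#
      g-vanish n lt = trans (*-congʳ (Q²-vanish r n lt)) (zeroˡ _)
      lhs : ∀ n l → n ℕ.+ l ≡ N ℕ.+ N → Q (n ℕ.* n) * (β n * nested r n l) ≈ p∞ * f n
      lhs n l e with n ℕ.≤? N
      ... | yes le = trans (*-congˡ (*-congˡ (nested-truncated r n l e le)))
              (solve 4 (λ q a i h → q :* (a :* (i :* h)) := i :* (q :* (a :* h))) refl _ _ _ _)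
      ... | no ¬le = trans (*-congʳ (Q-sq-vanish n (ℕₚ.≰⇒> ¬le))) (trans (zeroˡ _)
              (sym (trans (*-congˡ (f-vanish n (ℕₚ.≰⇒> ¬le))) (zeroʳ _))))
      rhs : ∀ s l → s ℕ.+ l ≡ N ℕ.+ N → g s * (p l * p (s ⊕ l)) ≈ p∞ * p∞ * g s
      rhs s l e with s ℕ.≤? N
      ... | yes le = trans (*-congˡ (*-cong (p-stable l N≤l) (p-stable (s ⊕ l) (ℕₚ.≤-trans N≤l (ℕₚ.m≤n+m l (s ℕ.+ s))))))
                       (*-comm _ _)
        where
        N≤l : N ℕ.≤ l
        N≤l = ℕₚ.+-cancelˡ-≤ N N l (ℕₚ.≤-trans (ℕₚ.≤-reflexive (≡.sym e)) (ℕₚ.+-monoˡ-≤ l le))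
      ... | no ¬le = trans (*-congʳ g≈0) (trans (zeroˡ _) (sym (trans (*-congˡ g≈0) (zeroʳ _))))
        where g≈0 = g-vanish s (ℕₚ.≰⇒> ¬le)

    module _ (t : Carrier) (d : ℕ → Carrier)
      (d-inverse : ∀ r → (1# - t * Q (suc r) + Q (suc r) * Q (suc r)) * d (suc r) ≈ 1#) where
      open Rank t d d-inverse

      garvan-rank : ∀ r →
        sumList (map (λ n → Q (n ℕ.* n) * truncNested r n * β n) (range 1 N))
          + p∞ * ∑ N (λ s → Q (suc r ℕ.* (s ℕ.* s)) * α⁰ s)
        ≈ p∞ * ∑ N (λ s → Q (suc r ℕ.* (s ℕ.* s)) * α s)
      garvan-rank r = begin
        sumList (map (λ n → Q (n ℕ.* n) * truncNested r n * β n) (range 1 N)) + p∞ * ∑ N (λ s → Q (suc r ℕ.* (s ℕ.* s)) * α⁰ s)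
          ≈⟨ +-congˡ (sym (bailey-limit r unit-pair)) ⟩
        sumList (map (λ n → Q (n ℕ.* n) * truncNested r n * β n) (range 1 N)) + ∑ N (λ n → Q (n ℕ.* n) * (δ n * truncNested r n))
          ≈⟨ split N ⟩
        ∑ N (λ n → Q (n ℕ.* n) * (β n * truncNested r n))
          ≈⟨ bailey-limit r rank-pair ⟩
        p∞ * ∑ N (λ s → Q (suc r ℕ.* (s ℕ.* s)) * α s) ∎
        where
        split : ∀ M → sumList (map (λ n → Q (n ℕ.* n) * truncNested r n * β n) (range 1 M))
            + ∑ M (λ n → Q (n ℕ.* n) * (δ n * truncNested r n))
          ≈ ∑ M (λ n → Q (n ℕ.* n) * (β n * truncNested r n))
        split zero = +-identityˡ _
        split (suc M) = begin
          _ ≈⟨ +-cong (sum-range 1 M (λ n → Q (n ℕ.* n) * truncNested r n * β n))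
                 (trans (+-congˡ (conv-≈0 M (λ i j _ → trans (*-congˡ (zeroˡ _)) (zeroʳ _)))) (+-identityʳ _)) ⟩
          ∑ M (λ j → Q (suc j ℕ.* suc j) * truncNested r (suc j) * β (suc j)) + Q 0 * (1# * truncNested r 0)
            ≈⟨ +-comm _ _ ⟩
          Q 0 * (1# * truncNested r 0) + ∑ M (λ j → Q (suc j ℕ.* suc j) * truncNested r (suc j) * β (suc j))
            ≈⟨ +-congˡ (conv-cong′ M (λ j _ → trans (*-assoc _ _ _) (*-congˡ (*-comm _ _)))) ⟩
          _ ∎

      module _ (sh : ℕ → Carrier) (t-sh-0 : t * sh 0 ≈ sh 1 - sh 0)
        (t-sh-suc : ∀ s → t * sh (suc s) ≈ sh (suc (suc s)) + sh s)
        (2-t : 1# + 1# - t ≈ - (sh 0 * sh 0)) where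

        module _ (r : ℕ) where
          private
            u = Q (suc r)
            U : ℕ → Carrier
            U s = Q (suc r ℕ.* s)
            U-suc : ∀ s → U (suc s) ≈ u * U s
            U-suc s = Q≡ (suc r) (suc r ℕ.* s) (ℕₚ.*-suc (suc r) s)

          sh-partial : ∀ M → D (suc r) * ∑ M (λ s → U s * sh s) + U (suc M) * sh (suc M)
            ≈ sh 0 * (1# + u) + U (suc (suc M)) * sh M
          sh-partial zero = begin
            D (suc r) * (U 0 * sh 0) + U 1 * sh 1
              ≈⟨ +-cong (*-congˡ (*-congʳ U0)) (*-congʳ U1) ⟩
            D (suc r) * (1# * sh 0) + u * sh 1
              ≈⟨ solve 4 (λ t u a b → let i = con (+ 1) in
                   (i :- t :* u :+ u :* u) :* (i :* a) :+ u :* b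
                   := a :* (i :+ u :* u) :+ u :* (b :- t :* a)) refl t u (sh 0) (sh 1) ⟩
            sh 0 * (1# + u * u) + u * (sh 1 - t * sh 0)
              ≈⟨ +-congˡ (*-congˡ (+-congˡ (-‿cong t-sh-0))) ⟩
            sh 0 * (1# + u * u) + u * (sh 1 - (sh 1 - sh 0))
              ≈⟨ solve 3 (λ u a b → let i = con (+ 1) in
                   a :* (i :+ u :* u) :+ u :* (b :- (b :- a)) := a :* (i :+ u) :+ (u :* u) :* a) refl u (sh 0) (sh 1) ⟩
            sh 0 * (1# + u) + u * u * sh 0 ≈⟨ +-congˡ (*-congʳ (sym (trans (U-suc 1) (*-congˡ U1)))) ⟩
            sh 0 * (1# + u) + U 2 * sh 0 ∎
            where
            U0 : U 0 ≈ 1#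
            U0 = trans (reflexive (≡.cong Q (ℕₚ.*-zeroʳ (suc r)))) Q-0
            U1 : U 1 ≈ u
            U1 = reflexive (≡.cong Q (ℕₚ.*-identityʳ (suc r)))
          sh-partial (suc M) = begin
            D (suc r) * ∑ (suc M) (λ s → U s * sh s) + U (suc (suc M)) * sh (suc (suc M))
              ≈⟨ +-cong (*-congˡ (∑-snoc M (λ s → U s * sh s))) (*-cong (U-suc (suc M)) refl) ⟩
            D (suc r) * (Σ + V * b) + u * V * e
              ≈⟨ solve 6 (λ t u Σ V b e → let i = con (+ 1) in
                   (i :- t :* u :+ u :* u) :* (Σ :+ V :* b) :+ u :* V :* e
                   := ((i :- t :* u :+ u :* u) :* Σ :+ V :* b) :+ (u :* (u :* V) :* b :+ u :* V :* (e :- t :* b)))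
                   refl t u Σ V b e ⟩
            (D (suc r) * Σ + V * b) + (u * (u * V) * b + u * V * (e - t * b))
              ≈⟨ +-cong (sh-partial M) (+-congˡ (*-congˡ (+-congˡ (-‿cong (t-sh-suc M))))) ⟩
            (sh 0 * (1# + u) + U (suc (suc M)) * a) + (u * (u * V) * b + u * V * (e - (e + a)))
              ≈⟨ +-congʳ (+-congˡ (*-congʳ (U-suc (suc M)))) ⟩
            (sh 0 * (1# + u) + u * V * a) + (u * (u * V) * b + u * V * (e - (e + a)))
              ≈⟨ solve 6 (λ h uV uuV a b e → (h :+ uV :* a) :+ (uuV :* b :+ uV :* (e :- (e :+ a))) := h :+ uuV :* b)
                   refl (sh 0 * (1# + u)) (u * V) (u * (u * V)) a b e ⟩
            sh 0 * (1# + u) + u * (u * V) * b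
              ≈⟨ +-congˡ (*-congʳ (sym (trans (U-suc (suc (suc M))) (*-congˡ (U-suc (suc M)))))) ⟩
            sh 0 * (1# + u) + U (suc (suc (suc M))) * b ∎
            where
            Σ = ∑ M (λ s → U s * sh s)
            V = U (suc M)
            a = sh M
            b = sh (suc M)
            e = sh (suc (suc M))

          sh-geometric : sh 0 * (1# + u) * d (suc r) ≈ ∑ N (λ s → U s * sh s)
          sh-geometric = begin
            sh 0 * (1# + u) * d (suc r)
              ≈⟨ *-congʳ (sym (trans (+-congˡ (trans (*-congʳ (U-vanish 1)) (zeroˡ _))) (+-identityʳ _))) ⟩
            (sh 0 * (1# + u) + U (suc (suc N)) * sh N) * d (suc r)
              ≈⟨ *-congʳ (sym (sh-partial N)) ⟩
            (D (suc r) * X + U (suc N) * sh (suc N)) * d (suc r)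
              ≈⟨ *-congʳ (trans (+-congˡ (trans (*-congʳ (U-vanish 0)) (zeroˡ _))) (+-identityʳ _)) ⟩
            D (suc r) * X * d (suc r)
              ≈⟨ solve 3 (λ a b c → a :* b :* c := (a :* c) :* b) refl _ _ _ ⟩
            D (suc r) * d (suc r) * X
              ≈⟨ trans (*-congʳ (d-inverse r)) (*-identityˡ _) ⟩
            X ∎
            where
            X = ∑ N (λ s → U s * sh s)
            U-vanish : ∀ i → U (suc (i ℕ.+ N)) ≈ 0#
            U-vanish i = Q-vanish _ (ℕₚ.<-≤-trans (s≤s (ℕₚ.m≤n+m N i)) (ℕₚ.m≤n*m _ (suc r)))

        rankSum : ℕ → Carrier
        rankSum k = ∑ N (λ r → Q (suc k ℕ.* (suc r ℕ.* suc r)) * (sq (suc r) * Q (suc r))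
                               * ∑ N (λ s → Q (suc r ℕ.* s) * sh s))

        α-sum : ∀ k → ∑ N (λ s → Q (suc k ℕ.* (s ℕ.* s)) * α s) ≈ 1# + sh 0 * - rankSum k
        α-sum k = begin
          ∑ N f                              ≈⟨ sym (∑-extend N (suc N) f (ℕₚ.n≤1+n N) f-vanish) ⟩
          f 0 + ∑ N (λ r → f (suc r))        ≈⟨ +-cong f0 (conv-cong′ N (λ r _ → term r)) ⟩
          1# + ∑ N (λ r → - sh 0 * G r)      ≈⟨ +-congˡ (conv-*ˡ N (- sh 0) (λ r _ → G r)) ⟩
          1# + - sh 0 * rankSum k
            ≈⟨ +-congˡ (solve 2 (λ a b → :- a :* b := a :* :- b) refl _ _) ⟩
          1# + sh 0 * - rankSum k ∎
          where
          f G : ℕ → Carrier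
          f s = Q (suc k ℕ.* (s ℕ.* s)) * α s
          G r = Q (suc k ℕ.* (suc r ℕ.* suc r)) * (sq (suc r) * Q (suc r)) * ∑ N (λ s → Q (suc r ℕ.* s) * sh s)
          f-vanish : ∀ n → N ℕ.< n → f n ≈ 0#
          f-vanish n lt = trans (*-congʳ (Q²-vanish k n lt)) (zeroˡ _)
          f0 : f 0 ≈ 1#
          f0 = trans (*-identityʳ _) (trans (reflexive (≡.cong Q (ℕₚ.*-zeroʳ (suc k)))) Q-0)
          term : ∀ r → f (suc r) ≈ - sh 0 * G r
          term r = begin
            A * (sq (suc r) * (1# + u) * (u * ((1# + 1# - t) * d (suc r))))
              ≈⟨ *-congˡ (*-congˡ (*-congˡ (*-congʳ 2-t))) ⟩
            A * (sq (suc r) * (1# + u) * (u * (- (sh 0 * sh 0) * d (suc r))))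
              ≈⟨ solve 5 (λ A s u h d → let v = con (+ 1) :+ u in
                   A :* (s :* v :* (u :* (:- (h :* h) :* d))) := :- h :* (A :* (s :* u) :* (h :* v :* d)))
                   refl A (sq (suc r)) u (sh 0) (d (suc r)) ⟩
            - sh 0 * (A * (sq (suc r) * u) * (sh 0 * (1# + u) * d (suc r)))
              ≈⟨ *-congˡ (*-congˡ (sh-geometric r)) ⟩
            - sh 0 * G r ∎
            where
            A = Q (suc k ℕ.* (suc r ℕ.* suc r))
            u = Q (suc r)

-- Rational coefficients

ℚring : CommutativeRing _ _
ℚring = ℚₚ.+-*-commutativeRing

open IntegerSolver ℚring using ()
  renaming (solve to solveℚ; con to conℚ; _:=_ to _:=ℚ_; _:+_ to _:+ℚ_; _:*_ to _:*ℚ_; _:-_ to _:-ℚ_; :-_ to :-ℚ_)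
open import Algebra.Properties.CommutativeSemiring.Exp
  (CommutativeRing.commutativeSemiring ℚring)
  using () renaming (_^_ to _^ℚ_; ^-homo-* to ^ℚ-homo-*; ^-distrib-* to ^ℚ-distrib-*)

fromℚᵘ-+ : ∀ x y → fromℚᵘ (x ℚᵘ.+ y) ≡ fromℚᵘ x ℚ.+ fromℚᵘ y
fromℚᵘ-+ x y = ℚₚ.toℚᵘ-injective (ℚᵘₚ.≃-trans (ℚₚ.toℚᵘ-fromℚᵘ (x ℚᵘ.+ y)) (ℚᵘₚ.≃-sym
  (ℚᵘₚ.≃-trans (ℚₚ.toℚᵘ-homo-+ (fromℚᵘ x) (fromℚᵘ y))
    (ℚᵘₚ.+-cong (ℚₚ.toℚᵘ-fromℚᵘ x) (ℚₚ.toℚᵘ-fromℚᵘ y)))))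

fromℚᵘ-* : ∀ x y → fromℚᵘ (x ℚᵘ.* y) ≡ fromℚᵘ x ℚ.* fromℚᵘ y
fromℚᵘ-* x y = ℚₚ.toℚᵘ-injective (ℚᵘₚ.≃-trans (ℚₚ.toℚᵘ-fromℚᵘ (x ℚᵘ.* y)) (ℚᵘₚ.≃-sym
  (ℚᵘₚ.≃-trans (ℚₚ.toℚᵘ-homo-* (fromℚᵘ x) (fromℚᵘ y))
    (ℚᵘₚ.*-cong (ℚₚ.toℚᵘ-fromℚᵘ x) (ℚₚ.toℚᵘ-fromℚᵘ y)))))

fromℤ-+ : ∀ i j → fromℤ (i ℤ.+ j) ≡ fromℤ i ℚ.+ fromℤ j
fromℤ-+ i j = ≡.trans (ℚₚ.fromℚᵘ-cong {mkℚᵘ (i ℤ.+ j) 0} {mkℚᵘ i 0 ℚᵘ.+ mkℚᵘ j 0}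
  (*≡* (≡.cong (ℤ._* + 1) (≡.sym (≡.cong₂ ℤ._+_ (ℤₚ.*-identityʳ i) (ℤₚ.*-identityʳ j))))))
  (fromℚᵘ-+ (mkℚᵘ i 0) (mkℚᵘ j 0))

fromℤ-* : ∀ i j → fromℤ (i ℤ.* j) ≡ fromℤ i ℚ.* fromℤ j
fromℤ-* i j = fromℚᵘ-* (mkℚᵘ i 0) (mkℚᵘ j 0)

fromℤ-^ : ∀ i n → fromℤ (i ℤ.^ n) ≡ fromℤ i ^ℚ n
fromℤ-^ i zero = ≡.refl
fromℤ-^ i (suc n) = ≡.trans (fromℤ-* i (i ℤ.^ n)) (≡.cong (fromℤ i ℚ.*_) (fromℤ-^ i n))

fromℕ-+ : ∀ m n → fromℕ (m ℕ.+ n) ≡ fromℕ m ℚ.+ fromℕ n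
fromℕ-+ m n = fromℤ-+ (+ m) (+ n)

fromℕ-* : ∀ m n → fromℕ (m ℕ.* n) ≡ fromℕ m ℚ.* fromℕ n
fromℕ-* m n = ≡.trans (≡.cong fromℤ (ℤₚ.pos-* m n)) (fromℤ-* (+ m) (+ n))

fromℕ-recip : ∀ n → fromℕ (suc n) ℚ.* recip (suc n) ≡ 1ℚ
fromℕ-recip n = ≡.trans (≡.sym (fromℚᵘ-* (mkℚᵘ (+ suc n) 0) (mkℚᵘ (+ 1) n)))
  (ℚₚ.fromℚᵘ-cong {mkℚᵘ (+ suc n) 0 ℚᵘ.* mkℚᵘ (+ 1) n} {mkℚᵘ (+ 1) 0}
    (*≡* (≡.trans (ℤₚ.*-identityʳ _) (≡.trans (ℤₚ.*-identityʳ _) (≡.sym (≡.trans (ℤₚ.*-identityˡ _) (≡.cong +_ (ℕₚ.*-identityˡ (suc n)))))))))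

fromℕ-recip′ : ∀ n .{{_ : ℕ.NonZero n}} → fromℕ n ℚ.* recip n ≡ 1ℚ
fromℕ-recip′ (suc n) = fromℕ-recip n

ℚ-cancel : ∀ n .{{_ : ℕ.NonZero n}} {x y} → fromℕ n ℚ.* x ≡ fromℕ n ℚ.* y → x ≡ y
ℚ-cancel n {x} {y} e = ≡.trans (≡.sym (undo x)) (≡.trans (≡.cong (recip n ℚ.*_) e) (undo y))
  where
  undo : ∀ z → recip n ℚ.* (fromℕ n ℚ.* z) ≡ z
  undo z = ≡.trans (≡.sym (ℚₚ.*-assoc (recip n) (fromℕ n) z))
    (≡.trans (≡.cong (ℚ._* z) (≡.trans (ℚₚ.*-comm (recip n) (fromℕ n)) (fromℕ-recip′ n))) (ℚₚ.*-identityˡ z))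

recip-* : ∀ m n .{{_ : ℕ.NonZero m}} .{{_ : ℕ.NonZero n}} → recip (m ℕ.* n) ≡ recip m ℚ.* recip n
recip-* m n = ℚ-cancel (m ℕ.* n) {{ℕₚ.m*n≢0 m n}} (≡.trans (fromℕ-recip′ (m ℕ.* n) {{ℕₚ.m*n≢0 m n}}) (≡.sym
  (≡.trans (≡.cong (ℚ._* (recip m ℚ.* recip n)) (fromℕ-* m n))
  (≡.trans (solveℚ 4 (λ a b c d → (a :*ℚ b) :*ℚ (c :*ℚ d) :=ℚ (a :*ℚ c) :*ℚ (b :*ℚ d)) ≡.refl
    (fromℕ m) (fromℕ n) (recip m) (recip n))
  (≡.cong₂ ℚ._*_ (fromℕ-recip′ m) (fromℕ-recip′ n))))))

recip!-suc : ∀ n → fromℕ (suc n) ℚ.* recip (suc n !) ≡ recip (n !)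
recip!-suc n = ≡.trans (≡.cong (fromℕ (suc n) ℚ.*_) (recip-* (suc n) (n !) {{_}} {{n ℕₚ.!≢0}}))
  (≡.trans (≡.sym (ℚₚ.*-assoc (fromℕ (suc n)) (recip (suc n)) (recip (n !))))
  (≡.trans (≡.cong (ℚ._* recip (n !)) (fromℕ-recip n)) (ℚₚ.*-identityˡ _)))

binomial-! : ∀ j l → ((j ℕ.+ l) C j) ℕ.* (j ! ℕ.* l !) ≡ (j ℕ.+ l) !
binomial-! j l = ≡.trans (≡.cong (ℕ._* (j ! ℕ.* l !)) (≡.trans (nCk≡n!/k![n-k]! j≤) (divcong)))
  (m/n*n≡m {{j ℕₚ.!* l !≢0}} (≡.subst (λ z → j ! ℕ.* z ! ∣ (j ℕ.+ l) !) (ℕₚ.m+n∸m≡n j l) (k![n∸k]!∣n! j≤)))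
  where
  j≤ : j ℕ.≤ j ℕ.+ l
  j≤ = ℕₚ.m≤m+n j l
  divcong = /-congʳ {{j ℕₚ.!* (j ℕ.+ l ∸ j) !≢0}} {{j ℕₚ.!* l !≢0}} (≡.cong (λ z → j ! ℕ.* z !) (ℕₚ.m+n∸m≡n j l))

binomial-recip : ∀ j l → fromℕ ((j ℕ.+ l) C j) ℚ.* recip ((j ℕ.+ l) !) ≡ recip (j !) ℚ.* recip (l !)
binomial-recip j l = ℚ-cancel (j ! ℕ.* l !) {{j ℕₚ.!* l !≢0}} (begin
  fromℕ (j ! ℕ.* l !) ℚ.* (fromℕ B ℚ.* recip ((j ℕ.+ l) !))
    ≡⟨ solveℚ 3 (λ a b c → a :*ℚ (b :*ℚ c) :=ℚ (b :*ℚ a) :*ℚ c) ≡.refl (fromℕ (j ! ℕ.* l !)) (fromℕ B) (recip ((j ℕ.+ l) !)) ⟩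
  fromℕ B ℚ.* fromℕ (j ! ℕ.* l !) ℚ.* recip ((j ℕ.+ l) !)
    ≡⟨ ≡.cong (ℚ._* recip ((j ℕ.+ l) !)) (≡.trans (≡.sym (fromℕ-* B (j ! ℕ.* l !))) (≡.cong fromℕ (binomial-! j l))) ⟩
  fromℕ ((j ℕ.+ l) !) ℚ.* recip ((j ℕ.+ l) !)
    ≡⟨ fromℕ-recip′ ((j ℕ.+ l) !) {{(j ℕ.+ l) ℕₚ.!≢0}} ⟩
  1ℚ
    ≡⟨ ≡.sym (fromℕ-recip′ (j ! ℕ.* l !) {{j ℕₚ.!* l !≢0}}) ⟩
  fromℕ (j ! ℕ.* l !) ℚ.* recip (j ! ℕ.* l !)
    ≡⟨ ≡.cong (fromℕ (j ! ℕ.* l !) ℚ.*_) (recip-* (j !) (l !) {{j ℕₚ.!≢0}} {{l ℕₚ.!≢0}}) ⟩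
  fromℕ (j ! ℕ.* l !) ℚ.* (recip (j !) ℚ.* recip (l !)) ∎)
  where
  open ≡.≡-Reasoning
  B = (j ℕ.+ l) C j

-- Power series in w over a ℚ-algebra

module Power {c ℓ} (R : CommutativeRing c ℓ) where
  open CommutativeRing R

  pow : Carrier → ℕ → Carrier
  pow x zero = 1#
  pow x (suc n) = x * pow x n

record ℚ-Structure {c ℓ} (R : CommutativeRing c ℓ) : Set (c ⊔ ℓ) where
  open CommutativeRing R
  field
    ι : ℚ → Carrier
    ι-+ : ∀ x y → ι (x ℚ.+ y) ≈ ι x + ι y
    ι-* : ∀ x y → ι (x ℚ.* y) ≈ ι x * ι y
    ι-1 : ι 1ℚ ≈ 1#

module RationalAlgebra {c ℓ} (R : CommutativeRing c ℓ) (𝒬 : ℚ-Structure R) where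
  open CommutativeRing R
  open ℚ-Structure 𝒬
  open IntegerSolver R
  open Convolution R
  open RangeSum R
  open Power R
  open PowerSeries R (λ _ → ⊤) (λ _ _ → tt) renaming (ring to seriesRing) public
  open import Algebra.Properties.Ring ring using (-0#≈0#)
  open import Relation.Binary.Reasoning.Setoid setoid
  module W = CommutativeRing seriesRing
  open Power seriesRing renaming (pow to powˢ)
  open IntegerSolver seriesRing using () renaming (solve to solveˢ; con to conˢ; _:=_ to _:=ˢ_; _:+_ to _:+ˢ_; _:*_ to _:*ˢ_; _:-_ to _:-ˢ_; :-_ to :-ˢ_)

  ι-0 : ι 0ℚ ≈ 0#
  ι-0 = begin
    ι 0ℚ                       ≈⟨ solve 1 (λ x → x := (x :+ x) :- x) refl (ι 0ℚ) ⟩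
    (ι 0ℚ + ι 0ℚ) - ι 0ℚ       ≈⟨ +-congʳ (sym (ι-+ 0ℚ 0ℚ)) ⟩
    ι 0ℚ - ι 0ℚ                ≈⟨ -‿inverseʳ _ ⟩
    0# ∎

  ι-neg : ∀ x → ι (ℚ.- x) ≈ - ι x
  ι-neg x = begin
    ι (ℚ.- x)                  ≈⟨ solve 2 (λ x y → y := (x :+ y) :- x) refl (ι x) (ι (ℚ.- x)) ⟩
    (ι x + ι (ℚ.- x)) - ι x    ≈⟨ +-congʳ (trans (sym (ι-+ x (ℚ.- x))) (trans (reflexive (≡.cong ι (ℚₚ.+-inverseʳ x))) ι-0)) ⟩
    0# - ι x                   ≈⟨ +-identityˡ _ ⟩
    - ι x ∎

  ι-conv : ∀ n F → ι (Convolution.conv ℚring n F) ≈ conv n (λ i j → ι (F i j))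
  ι-conv zero F = refl
  ι-conv (suc n) F = trans (ι-+ _ _) (+-congˡ (ι-conv n (λ i j → F (suc i) j)))

  ι≡ : ∀ {x y} → x ≡ y → ι x ≈ ι y
  ι≡ e = reflexive (≡.cong ι e)

  ν κ : ℕ → Carrier
  ν n = ι (fromℕ n)
  κ n = ι (recip (n !))

  ν-0 : ∀ x → ν 0 * x ≈ 0#
  ν-0 x = trans (*-congʳ ι-0) (zeroˡ x)

  ν-+ : ∀ m n → ν (m ℕ.+ n) ≈ ν m + ν n
  ν-+ m n = trans (ι≡ (fromℕ-+ m n)) (ι-+ _ _)

  ν-cancel : ∀ n {x y} → ν (suc n) * x ≈ ν (suc n) * y → x ≈ y
  ν-cancel n {x} {y} e = trans (sym (undo x)) (trans (*-congˡ e) (undo y))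
    where
    undo : ∀ z → ι (recip (suc n)) * (ν (suc n) * z) ≈ z
    undo z = begin
      ι (recip (suc n)) * (ν (suc n) * z)  ≈⟨ sym (*-assoc _ _ _) ⟩
      ι (recip (suc n)) * ν (suc n) * z    ≈⟨ *-congʳ (trans (*-comm _ _) (trans (sym (ι-* _ _)) (trans (ι≡ (fromℕ-recip n)) ι-1))) ⟩
      1# * z                               ≈⟨ *-identityˡ z ⟩
      z ∎

  ν-κ : ∀ n → ν (suc n) * κ (suc n) ≈ κ n
  ν-κ n = trans (sym (ι-* _ _)) (ι≡ (recip!-suc n))

  E : ℚ → PS
  E c n = ι (c ^ℚ n ℚ.* recip (n !))

  E-suc : ∀ c n → ν (suc n) * E c (suc n) ≈ ι c * E c n
  E-suc c n = begin
    ν (suc n) * ι (c ^ℚ suc n ℚ.* recip (suc n !))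
      ≈⟨ sym (ι-* _ _) ⟩
    ι (fromℕ (suc n) ℚ.* (c ℚ.* c ^ℚ n ℚ.* recip (suc n !)))
      ≈⟨ ι≡ (≡.trans (solveℚ 4 (λ a b c d → a :*ℚ (b :*ℚ c :*ℚ d) :=ℚ b :*ℚ (c :*ℚ (a :*ℚ d))) ≡.refl
           (fromℕ (suc n)) c (c ^ℚ n) (recip (suc n !)))
           (≡.cong (λ z → c ℚ.* (c ^ℚ n ℚ.* z)) (recip!-suc n))) ⟩
    ι (c ℚ.* (c ^ℚ n ℚ.* recip (n !)))
      ≈⟨ ι-* _ _ ⟩
    ι c * E c n ∎

  E-0 : ∀ c → E c 0 ≈ 1#
  E-0 c = ι-1

  E-+ : ∀ c d → E c ⊠ E d ≋ E (c ℚ.+ d)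
  E-+ c d n _ = trans (⊠-conv (E c) (E d) n) (sum n)
    where
    sum : ∀ n → conv n (λ i j → E c i * E d j) ≈ E (c ℚ.+ d) n
    sum zero = trans (*-cong (E-0 c) (E-0 d)) (trans (*-identityˡ _) (sym (E-0 (c ℚ.+ d))))
    sum (suc n) = ν-cancel n (begin
      ν (suc n) * conv (suc n) F
        ≈⟨ sym (conv-index (suc n) ν F) ⟩
      conv (suc n) (λ i j → ν (i ℕ.+ j) * F i j)
        ≈⟨ conv-cong′ (suc n) (λ i j → trans (*-congʳ (ν-+ i j))
             (solve 4 (λ m n x y → (m :+ n) :* (x :* y) := (m :* x) :* y :+ x :* (n :* y)) refl (ν i) (ν j) (E c i) (E d j))) ⟩
      conv (suc n) (λ i j → G i j + H i j)
        ≈⟨ conv-+ (suc n) G H ⟩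
      conv (suc n) G + conv (suc n) H
        ≈⟨ +-cong (trans (+-congʳ (trans (*-congʳ (ν-0 _)) (zeroˡ _))) (+-identityˡ _))
             (trans (conv-last n H) (trans (+-congˡ (trans (*-congˡ (ν-0 _)) (zeroʳ _))) (+-identityʳ _))) ⟩
      conv n (λ i j → G (suc i) j) + conv n (λ i j → H i (suc j))
        ≈⟨ sym (conv-+ n (λ i j → G (suc i) j) (λ i j → H i (suc j))) ⟩
      conv n (λ i j → G (suc i) j + H i (suc j))
        ≈⟨ conv-cong′ n (λ i j → trans (+-cong (*-congʳ (E-suc c i)) (*-congˡ (E-suc d j)))
             (solve 4 (λ c d x y → (c :* x) :* y :+ x :* (d :* y) := (c :+ d) :* (x :* y)) refl _ _ _ _)) ⟩
      conv n (λ i j → (ι c + ι d) * F i j)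
        ≈⟨ conv-*ˡ n (ι c + ι d) F ⟩
      (ι c + ι d) * conv n F
        ≈⟨ *-cong (sym (ι-+ c d)) (sum n) ⟩
      ι (c ℚ.+ d) * E (c ℚ.+ d) n
        ≈⟨ sym (E-suc (c ℚ.+ d) n) ⟩
      ν (suc n) * E (c ℚ.+ d) (suc n) ∎)
      where
      F G H : ℕ → ℕ → Carrier
      F i j = E c i * E d j
      G i j = ν i * E c i * E d j
      H i j = E c i * (ν j * E d j)

  E-zero : E 0ℚ ≋ W.1#
  E-zero zero _ = E-0 0ℚ
  E-zero (suc n) _ = trans (ι≡ (≡.trans (≡.cong (ℚ._* recip (suc n !)) (ℚₚ.*-zeroˡ (0ℚ ^ℚ n))) (ℚₚ.*-zeroˡ (recip (suc n !))))) ι-0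

  θ : PS → PS
  θ a n = ν n * a n

  θ-cong : ∀ {a b} → a ≋ b → θ a ≋ θ b
  θ-cong h n _ = *-congˡ (h n tt)

  θ-⊠ : ∀ a b → θ (a ⊠ b) ≋ θ a ⊠ b ⊞ a ⊠ θ b
  θ-⊠ a b n _ = begin
    ν n * (a ⊠ b) n                  ≈⟨ *-congˡ (⊠-conv a b n) ⟩
    ν n * conv n (λ i j → a i * b j) ≈⟨ sym (conv-index n ν (λ i j → a i * b j)) ⟩
    conv n (λ i j → ν (i ℕ.+ j) * (a i * b j))
      ≈⟨ conv-cong′ n (λ i j → trans (*-congʳ (ν-+ i j))
             (solve 4 (λ m n x y → (m :+ n) :* (x :* y) := (m :* x) :* y :+ x :* (n :* y)) refl _ _ _ _)) ⟩
    conv n (λ i j → θ a i * b j + a i * θ b j)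
      ≈⟨ conv-+ n (λ i j → θ a i * b j) (λ i j → a i * θ b j) ⟩
    conv n (λ i j → θ a i * b j) + conv n (λ i j → a i * θ b j)
      ≈⟨ sym (+-cong (⊠-conv (θ a) b n) (⊠-conv a (θ b) n)) ⟩
    (θ a ⊠ b ⊞ a ⊠ θ b) n ∎

  θ-const : ∀ u → θ (const u) ≋ W.0#
  θ-const u zero _ = ν-0 u
  θ-const u (suc n) _ = zeroʳ _

  θ-pow : ∀ Y r → θ (powˢ Y (suc r)) ≋ const (ν (suc r)) ⊠ (θ Y ⊠ powˢ Y r)
  θ-pow Y zero = W.trans (θ-⊠ Y (const 1#)) (W.trans
    (W.+-congˡ {x = θ Y ⊠ const 1#} (W.trans (W.*-congˡ {x = Y} (θ-const 1#)) (W.zeroʳ Y)))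
    (W.trans (W.+-identityʳ _) (W.sym (W.trans (W.*-congʳ {x = θ Y ⊠ const 1#} (const-cong ι-1)) (W.*-identityˡ _)))))
  θ-pow Y (suc r) = W.trans (θ-⊠ Y (powˢ Y (suc r)))
    (W.trans (W.+-congˡ {x = θ Y ⊠ powˢ Y (suc r)} (W.*-congˡ {x = Y} (θ-pow Y r)))
    (W.trans (solveˢ 4 (λ y t p n → t :*ˢ (y :*ˢ p) :+ˢ y :*ˢ (n :*ˢ (t :*ˢ p))
                :=ˢ (conˢ (+ 1) :+ˢ n) :*ˢ (t :*ˢ (y :*ˢ p))) W.refl Y (θ Y) (powˢ Y r) (const (ν (suc r))))
    (W.*-congʳ {x = θ Y ⊠ powˢ Y (suc r)} (W.sym (W.trans (const-cong (trans (ν-+ 1 (suc r)) (+-congʳ ι-1))) (const-+ 1# (ν (suc r))))))))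

  pow-order : ∀ Y → Y 0 ≈ 0# → ∀ r i → i ℕ.< r → powˢ Y r i ≈ 0#
  pow-order Y Y0 (suc r) i (s≤s i≤r) = trans (⊠-conv Y (powˢ Y r) i) (conv-≈0 i term)
    where
    term : ∀ a b → a ℕ.+ b ≡ i → Y a * powˢ Y r b ≈ 0#
    term zero b e = trans (*-congʳ Y0) (zeroˡ _)
    term (suc a) b e = trans (*-congˡ (pow-order Y Y0 r b (ℕₚ.≤-trans (≡.subst (suc b ℕ.≤_) e (s≤s (ℕₚ.m≤n+m b a))) i≤r))) (zeroʳ _)

  expo : PS → PS
  expo Y i = sumList (map (λ r → κ r * powˢ Y r i) (range 0 i))

  expo-∑ : ∀ Y → Y 0 ≈ 0# → ∀ M i → i ℕ.≤ M → expo Y i ≈ ∑ M (λ r → κ r * powˢ Y r i)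
  expo-∑ Y Y0 M i i≤M = trans (sum-range₀ i (λ r → κ r * powˢ Y r i))
    (sym (∑-extend i M _ i≤M (λ r lt → trans (*-congˡ (pow-order Y Y0 r i lt)) (zeroʳ _))))

  expo-⊠ : ∀ Y A → Y 0 ≈ 0# → ∀ i → (expo Y ⊠ A) i ≈ ∑ i (λ r → κ r * (powˢ Y r ⊠ A) i)
  expo-⊠ Y A Y0 i = begin
    (expo Y ⊠ A) i
      ≈⟨ ⊠-conv (expo Y) A i ⟩
    conv i (λ j l → expo Y j * A l)
      ≈⟨ conv-cong i (λ j l e → trans (*-congʳ (expo-∑ Y Y0 i j (≡.subst (j ℕ.≤_) e (ℕₚ.m≤m+n j l))))
           (trans (sym (conv-*ʳ i (A l) (λ r _ → κ r * powˢ Y r j))) (conv-cong′ i (λ r _ → *-assoc _ _ _)))) ⟩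
    conv i (λ j l → ∑ i (λ r → κ r * (powˢ Y r j * A l)))
      ≈⟨ sym (∑-conv i i (λ r j l → κ r * (powˢ Y r j * A l))) ⟩
    ∑ i (λ r → conv i (λ j l → κ r * (powˢ Y r j * A l)))
      ≈⟨ conv-cong′ i (λ r _ → trans (conv-*ˡ i (κ r) (λ j l → powˢ Y r j * A l)) (*-congˡ (sym (⊠-conv (powˢ Y r) A i)))) ⟩
    ∑ i (λ r → κ r * (powˢ Y r ⊠ A) i) ∎

  θ-expo : ∀ Y → Y 0 ≈ 0# → θ (expo Y) ≋ expo Y ⊠ θ Y
  θ-expo Y Y0 i _ = begin
    ν i * expo Y i
      ≈⟨ *-congˡ (expo-∑ Y Y0 (suc i) i (ℕₚ.n≤1+n i)) ⟩
    ν i * ∑ (suc i) (λ r → κ r * powˢ Y r i)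
      ≈⟨ sym (conv-*ˡ (suc i) (ν i) (λ r _ → κ r * powˢ Y r i)) ⟩
    ∑ (suc i) (λ r → ν i * (κ r * powˢ Y r i))
      ≈⟨ conv-cong′ (suc i) (λ r _ → solve 3 (λ a b c → a :* (b :* c) := b :* (a :* c)) refl (ν i) (κ r) (powˢ Y r i)) ⟩
    κ 0 * θ (const 1#) i + ∑ i (λ r → κ (suc r) * θ (powˢ Y (suc r)) i)
      ≈⟨ +-cong (trans (*-congˡ (θ-const 1# i tt)) (zeroʳ _)) (conv-cong′ i (λ r _ → term r)) ⟩
    0# + ∑ i (λ r → κ r * (powˢ Y r ⊠ θ Y) i)
      ≈⟨ +-identityˡ _ ⟩
    ∑ i (λ r → κ r * (powˢ Y r ⊠ θ Y) i)
      ≈⟨ sym (expo-⊠ Y (θ Y) Y0 i) ⟩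
    (expo Y ⊠ θ Y) i ∎
    where
    term : ∀ r → κ (suc r) * θ (powˢ Y (suc r)) i ≈ κ r * (powˢ Y r ⊠ θ Y) i
    term r = begin
      κ (suc r) * θ (powˢ Y (suc r)) i
        ≈⟨ *-congˡ (trans (θ-pow Y r i tt) (const-⊠ (ν (suc r)) (θ Y ⊠ powˢ Y r) i)) ⟩
      κ (suc r) * (ν (suc r) * (θ Y ⊠ powˢ Y r) i)
        ≈⟨ trans (sym (*-assoc _ _ _)) (*-cong (trans (*-comm _ _) (ν-κ r)) (⊠-comm (θ Y) (powˢ Y r) i)) ⟩
      κ r * (powˢ Y r ⊠ θ Y) i ∎

  θ-injective : ∀ {a b} → a 0 ≈ b 0 → θ a ≋ θ b → a ≋ b
  θ-injective h e zero _ = h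
  θ-injective h e (suc n) _ = ν-cancel n (e (suc n) tt)

  -- Generating series of the partitions with parts at most m, where the part j contributes
  -- y_j^c / c! if its multiplicity is c.
  module PartitionSeries (y : ℕ → Carrier) where

    part : ℕ → PS
    part m = monomial m ⊠ const (y m)

    partitionSeries : ℕ → PS
    partitionSeries zero = W.1#
    partitionSeries (suc m) = expo (part (suc m)) ⊠ partitionSeries m

    part-0 : ∀ m → part (suc m) 0 ≈ 0#
    part-0 m = monomial-⊠-< (suc m) (const (y (suc m))) 0 (s≤s z≤n)

    pow-part : ∀ m c → powˢ (part m) c ≋ monomial (m ℕ.* c) ⊠ const (pow (y m) c)
    pow-part m zero = W.sym (W.trans (W.*-congʳ {x = W.1#} (λ n _ → reflexive (≡.cong (λ z → monomial z n) (ℕₚ.*-zeroʳ m)))) (W.*-identityˡ W.1#))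
    pow-part m (suc c) = W.trans (W.*-congˡ {x = part m} (pow-part m c)) (W.trans
      (solveˢ 4 (λ a b c d → a :*ˢ b :*ˢ (c :*ˢ d) :=ˢ a :*ˢ c :*ˢ (b :*ˢ d)) W.refl (monomial m) (const (y m)) (monomial (m ℕ.* c)) (const (pow (y m) c)))
      (W.*-cong {x = monomial m ⊠ monomial (m ℕ.* c)} {u = const (y m) ⊠ const (pow (y m) c)}
        (λ n _ → trans (sym (monomial-* m (m ℕ.* c) n)) (reflexive (≡.cong (λ z → monomial z n) (≡.sym (ℕₚ.*-suc m c)))))
        (W.sym (const-* (y m) (pow (y m) c)))))

    monomial-⊠-if : ∀ e a n → (monomial e ⊠ a) n ≈ (if e ℕ.≤ᵇ n then a (n ∸ e) else 0#)
    monomial-⊠-if e a n with e ℕ.≤? n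
    ... | yes le rewrite ≤ᵇ-true le = trans (reflexive (≡.cong (monomial e ⊠ a) (≡.sym (ℕₚ.m+[n∸m]≡n le)))) (monomial-⊠ e a (n ∸ e))
    ... | no ¬le rewrite ≤ᵇ-false (ℕₚ.≰⇒> ¬le) = monomial-⊠-< e a n (ℕₚ.≰⇒> ¬le)

    if-*ˡ : ∀ u b {x} → u * (if b then x else 0#) ≈ (if b then u * x else 0#)
    if-*ˡ u true = refl
    if-*ˡ u false = zeroʳ u

    partitionSeries-suc : ∀ m r → partitionSeries (suc m) r
      ≈ ∑ r (λ c → if suc m ℕ.* c ℕ.≤ᵇ r then κ c * pow (y (suc m)) c * partitionSeries m (r ∸ suc m ℕ.* c) else 0#)
    partitionSeries-suc m r = trans (expo-⊠ (part (suc m)) (partitionSeries m) (part-0 m) r) (conv-cong′ r (λ c _ → begin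
      κ c * (powˢ (part (suc m)) c ⊠ partitionSeries m) r
        ≈⟨ *-congˡ (W.trans (W.*-congʳ {x = partitionSeries m} (pow-part (suc m) c)) (W.*-assoc (monomial (suc m ℕ.* c)) (const (pow (y (suc m)) c)) (partitionSeries m)) r tt) ⟩
      κ c * (monomial (suc m ℕ.* c) ⊠ (const (pow (y (suc m)) c) ⊠ partitionSeries m)) r
        ≈⟨ *-congˡ (trans (W.*-congˡ {x = monomial (suc m ℕ.* c)} (λ n _ → const-⊠ (pow (y (suc m)) c) (partitionSeries m) n) r tt)
             (monomial-⊠-if (suc m ℕ.* c) (λ n → pow (y (suc m)) c * partitionSeries m n) r)) ⟩
      κ c * (if suc m ℕ.* c ℕ.≤ᵇ r then pow (y (suc m)) c * partitionSeries m (r ∸ suc m ℕ.* c) else 0#)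
        ≈⟨ if-*ˡ (κ c) (suc m ℕ.* c ℕ.≤ᵇ r) ⟩
      (if suc m ℕ.* c ℕ.≤ᵇ r then κ c * (pow (y (suc m)) c * partitionSeries m (r ∸ suc m ℕ.* c)) else 0#)
        ≈⟨ if-cong (suc m ℕ.* c ℕ.≤ᵇ r) (sym (*-assoc _ _ _)) ⟩
      _ ∎))
      where
      if-cong : ∀ b {x x′} → x ≈ x′ → (if b then x else 0#) ≈ (if b then x′ else 0#)
      if-cong true h = h
      if-cong false h = refl

    partitionSeries-stable : ∀ m r → r ℕ.≤ m → partitionSeries m r ≈ partitionSeries r r
    partitionSeries-stable zero zero _ = refl
    partitionSeries-stable (suc m) r r≤ with ℕₚ.m≤n⇒m<n∨m≡n r≤
    ... | inj₂ ≡.refl = refl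
    ... | inj₁ (s≤s r≤m) = trans drop (partitionSeries-stable m r r≤m)
      where
      f : ℕ → Carrier
      f c = if suc m ℕ.* c ℕ.≤ᵇ r then κ c * pow (y (suc m)) c * partitionSeries m (r ∸ suc m ℕ.* c) else 0#
      f-vanish : ∀ c → 0 ℕ.< c → f c ≈ 0#
      f-vanish (suc c) _ rewrite ≤ᵇ-false {suc m ℕ.* suc c} {r} (ℕₚ.<-≤-trans (s≤s r≤m) (ℕₚ.m≤m*n (suc m) (suc c))) = refl
      drop : partitionSeries (suc m) r ≈ partitionSeries m r
      drop = begin
        partitionSeries (suc m) r  ≈⟨ partitionSeries-suc m r ⟩
        ∑ r f                      ≈⟨ ∑-extend 0 r f z≤n f-vanish ⟩
        f 0                        ≡⟨ ≡.cong (λ z → if z ℕ.≤ᵇ r then κ 0 * 1# * partitionSeries m (r ∸ z) else 0#) (ℕₚ.*-zeroʳ m) ⟩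
        κ 0 * 1# * partitionSeries m r ≈⟨ *-congʳ (trans (*-identityʳ _) ι-1) ⟩
        1# * partitionSeries m r   ≈⟨ *-identityˡ _ ⟩
        partitionSeries m r ∎

    logDeriv : ℕ → PS
    logDeriv zero = W.0#
    logDeriv (suc m) = logDeriv m ⊞ θ (part (suc m))

    θ-partitionSeries : ∀ m → θ (partitionSeries m) ≋ partitionSeries m ⊠ logDeriv m
    θ-partitionSeries zero = W.trans (θ-const 1#) (W.sym (W.zeroʳ W.1#))
    θ-partitionSeries (suc m) = W.trans (θ-⊠ (expo (part (suc m))) (partitionSeries m)) (W.trans
      (W.+-cong {x = θ (expo (part (suc m))) ⊠ partitionSeries m} {u = expo (part (suc m)) ⊠ θ (partitionSeries m)}
        (W.*-congʳ {x = partitionSeries m} (θ-expo (part (suc m)) (part-0 m)))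
        (W.*-congˡ {x = expo (part (suc m))} (θ-partitionSeries m)))
      (solveˢ 4 (λ e u p l → e :*ˢ u :*ˢ p :+ˢ e :*ˢ (p :*ˢ l) :=ˢ e :*ˢ p :*ˢ (l :+ˢ u)) W.refl
        (expo (part (suc m))) (θ (part (suc m))) (partitionSeries m) (logDeriv m)))

    y⁺ : PS
    y⁺ zero = 0#
    y⁺ (suc n) = y (suc n)

    part-coeff : ∀ m → part m m ≈ y m
    part-coeff m = trans (reflexive (≡.cong (part m) (≡.sym (ℕₚ.+-identityʳ m)))) (monomial-⊠ m (const (y m)) 0)

    part-coeff-> : ∀ m n → m ℕ.< n → part m n ≈ 0#
    part-coeff-> m n lt with ℕₚ.m≤n⇒∃[o]m+o≡n lt
    ... | o , ≡.refl = trans (reflexive (≡.cong (part m) (≡.sym (ℕₚ.+-suc m o)))) (monomial-⊠ m (const (y m)) (suc o))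

    logDeriv-> : ∀ m n → m ℕ.< n → logDeriv m n ≈ 0#
    logDeriv-> zero n _ = refl
    logDeriv-> (suc m) n lt = trans (+-cong (logDeriv-> m n (ℕₚ.<-trans (ℕₚ.n<1+n m) lt))
      (trans (*-congˡ (part-coeff-> (suc m) n lt)) (zeroʳ _))) (+-identityʳ _)

    logDeriv-≤ : ∀ m n → n ℕ.≤ m → logDeriv m n ≈ θ y⁺ n
    logDeriv-≤ zero zero _ = sym (zeroʳ _)
    logDeriv-≤ (suc m) n le with ℕₚ.m≤n⇒m<n∨m≡n le
    ... | inj₂ ≡.refl = trans (+-cong (logDeriv-> m (suc m) (ℕₚ.n<1+n m)) (*-congˡ (part-coeff (suc m)))) (+-identityˡ _)
    ... | inj₁ (s≤s n≤m) = trans (+-cong (logDeriv-≤ m n n≤m)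
        (trans (*-congˡ (monomial-⊠-< (suc m) (const (y (suc m))) n (s≤s n≤m))) (zeroʳ _))) (+-identityʳ _)

    traceSeries : PS
    traceSeries n = partitionSeries n n

    θ-traceSeries : θ traceSeries ≋ traceSeries ⊠ θ y⁺
    θ-traceSeries n _ = begin
      θ (partitionSeries n) n                       ≈⟨ θ-partitionSeries n n tt ⟩
      (partitionSeries n ⊠ logDeriv n) n            ≈⟨ ⊠-cong-≤ n (λ i → partitionSeries-stable n i) (λ i → logDeriv-≤ n i) ⟩
      (traceSeries ⊠ θ y⁺) n ∎

½ : ℚ
½ = recip 2

isEven-suc : ∀ n → isEven (suc n) ≡ not (isEven n)
isEven-suc zero = ≡.refl
isEven-suc (suc zero) = ≡.refl
isEven-suc (suc (suc n)) = isEven-suc n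

neg-^ : ∀ x n → (ℚ.- x) ^ℚ n ≡ (if isEven n then x ^ℚ n else ℚ.- (x ^ℚ n))
neg-^ x zero = ≡.refl
neg-^ x (suc n) rewrite neg-^ x n | isEven-suc n with isEven n
... | true = solveℚ 2 (λ x p → (:-ℚ x) :*ℚ p :=ℚ :-ℚ (x :*ℚ p)) ≡.refl x (x ^ℚ n)
... | false = solveℚ 2 (λ x p → (:-ℚ x) :*ℚ (:-ℚ p) :=ℚ x :*ℚ p) ≡.refl x (x ^ℚ n)

1-^ : ∀ n → 1ℚ ^ℚ n ≡ 1ℚ
1-^ zero = ≡.refl
1-^ (suc n) = ≡.trans (ℚₚ.*-identityˡ _) (1-^ n)

½-^ : ∀ n → ½ ^ℚ n ≡ recip (2 ℕ.^ n)
½-^ zero = ≡.refl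
½-^ (suc n) = ≡.trans (≡.cong (½ ℚ.*_) (½-^ n)) (≡.sym (recip-* 2 (2 ℕ.^ n) {{_}} {{ℕₚ.m^n≢0 2 n}}))

nthD-++ˡ : ∀ xs ys n → n ℕ.< length xs → nthD (xs ++ ys) n ≡ nthD xs n
nthD-++ˡ (x ∷ xs) ys zero _ = ≡.refl
nthD-++ˡ (x ∷ xs) ys (suc n) (s≤s h) = nthD-++ˡ xs ys n h

nthD-snoc : ∀ xs y → nthD (xs ++ y ∷ []) (length xs) ≡ y
nthD-snoc [] y = ≡.refl
nthD-snoc (x ∷ xs) y = nthD-snoc xs y

length-bernList : ∀ m → length (bernList m) ≡ suc m
length-bernList zero = ≡.refl
length-bernList (suc m) = ≡.trans (length-++ (bernList m)) (≡.trans (ℕₚ.+-comm _ 1) (≡.cong suc (length-bernList m)))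

nthD-bernList : ∀ m j → j ℕ.≤ m → nthD (bernList m) j ≡ bernoulli j
nthD-bernList zero zero _ = ≡.refl
nthD-bernList (suc m) j le with ℕₚ.m≤n⇒m<n∨m≡n le
... | inj₂ ≡.refl = ≡.refl
... | inj₁ (s≤s j≤m) = ≡.trans
  (nthD-++ˡ (bernList m) _ j (ℕₚ.<-≤-trans (s≤s j≤m) (ℕₚ.≤-reflexive (≡.sym (length-bernList m)))))
  (nthD-bernList m j j≤m)

module _ where
  open Convolution ℚring
  open RangeSum ℚring
  open ≡.≡-Reasoning

  bernoulli-suc : ∀ m → bernoulli (suc m)
    ≡ ℚ.- (recip (suc (suc m)) ℚ.* ∑ m (λ j → fromℕ (suc (suc m) C j) ℚ.* bernoulli j))
  bernoulli-suc m = begin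
    nthD (bernList m ++ _ ∷ []) (suc m)
      ≡⟨ ≡.cong (nthD (bernList (suc m))) (≡.sym (length-bernList m)) ⟩
    nthD (bernList m ++ _ ∷ []) (length (bernList m))
      ≡⟨ nthD-snoc (bernList m) _ ⟩
    ℚ.- (recip (suc (suc m)) ℚ.* sumℚ (map (λ j → fromℕ (suc (suc m) C j) ℚ.* nthD (bernList m) j) (range 0 m)))
      ≡⟨ ≡.cong (λ z → ℚ.- (recip (suc (suc m)) ℚ.* z)) (≡.trans (sum-range₀ m _)
           (conv-cong m (λ i j e → ≡.cong (fromℕ (suc (suc m) C i) ℚ.*_)
             (nthD-bernList m i (≡.subst (i ℕ.≤_) e (ℕₚ.m≤m+n i j)))))) ⟩
    _ ∎

  bernoulli-conv : ∀ m → conv (suc m) (λ j l → bernoulli j ℚ.* recip (j !) ℚ.* recip (suc l !)) ≡ 0ℚ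
  bernoulli-conv m = begin
    conv (suc m) F
      ≡⟨ conv-last m F ⟩
    conv m (λ j l → F j (suc l)) ℚ.+ F (suc m) 0
      ≡⟨ ≡.cong₂ ℚ._+_ (≡.trans (conv-cong m term) (conv-*ˡ m r _)) last ⟩
    r ℚ.* Σ ℚ.+ ℚ.- (r ℚ.* Σ)
      ≡⟨ ℚₚ.+-inverseʳ (r ℚ.* Σ) ⟩
    0ℚ ∎
    where
    F : ℕ → ℕ → ℚ
    F j l = bernoulli j ℚ.* recip (j !) ℚ.* recip (suc l !)
    r = recip (suc (suc m) !)
    Σ = ∑ m (λ j → fromℕ (suc (suc m) C j) ℚ.* bernoulli j)
    term : ∀ j l → j ℕ.+ l ≡ m → F j (suc l) ≡ r ℚ.* (fromℕ (suc (suc m) C j) ℚ.* bernoulli j)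
    term j l ≡.refl = begin
      bernoulli j ℚ.* recip (j !) ℚ.* recip (suc (suc l) !)
        ≡⟨ ℚₚ.*-assoc (bernoulli j) (recip (j !)) (recip (suc (suc l) !)) ⟩
      bernoulli j ℚ.* (recip (j !) ℚ.* recip (suc (suc l) !))
        ≡⟨ ≡.cong (bernoulli j ℚ.*_) (≡.sym (binomial-recip j (suc (suc l)))) ⟩
      bernoulli j ℚ.* (fromℕ ((j ℕ.+ suc (suc l)) C j) ℚ.* recip ((j ℕ.+ suc (suc l)) !))
        ≡⟨ ≡.cong (λ z → bernoulli j ℚ.* (fromℕ (z C j) ℚ.* recip (z !))) (≡.trans (ℕₚ.+-suc j (suc l)) (≡.cong suc (ℕₚ.+-suc j l))) ⟩
      bernoulli j ℚ.* (fromℕ (suc (suc (j ℕ.+ l)) C j) ℚ.* r)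
        ≡⟨ solveℚ 3 (λ a b c → a :*ℚ (b :*ℚ c) :=ℚ c :*ℚ (b :*ℚ a)) ≡.refl (bernoulli j) (fromℕ (suc (suc (j ℕ.+ l)) C j)) r ⟩
      r ℚ.* (fromℕ (suc (suc m) C j) ℚ.* bernoulli j) ∎
    last : F (suc m) 0 ≡ ℚ.- (r ℚ.* Σ)
    last = begin
      bernoulli (suc m) ℚ.* recip (suc m !) ℚ.* 1ℚ
        ≡⟨ ℚₚ.*-identityʳ _ ⟩
      bernoulli (suc m) ℚ.* recip (suc m !)
        ≡⟨ ≡.cong₂ ℚ._*_ (bernoulli-suc m) (≡.sym (recip!-suc (suc m))) ⟩
      (ℚ.- (recip (suc (suc m)) ℚ.* Σ)) ℚ.* (fromℕ (suc (suc m)) ℚ.* r)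
        ≡⟨ solveℚ 4 (λ a s f r → (:-ℚ (a :*ℚ s)) :*ℚ (f :*ℚ r) :=ℚ (f :*ℚ a) :*ℚ (:-ℚ (r :*ℚ s))) ≡.refl
             (recip (suc (suc m))) Σ (fromℕ (suc (suc m))) r ⟩
      fromℕ (suc (suc m)) ℚ.* recip (suc (suc m)) ℚ.* ℚ.- (r ℚ.* Σ)
        ≡⟨ ≡.cong (ℚ._* ℚ.- (r ℚ.* Σ)) (fromℕ-recip (suc m)) ⟩
      1ℚ ℚ.* ℚ.- (r ℚ.* Σ)
        ≡⟨ ℚₚ.*-identityˡ _ ⟩
      ℚ.- (r ℚ.* Σ) ∎

oddHalf : ℕ → ℚ
oddHalf s = fromℕ (suc (2 ℕ.* s)) ℚ.* ½

oddHalf-suc : ∀ s → oddHalf (suc s) ≡ oddHalf s ℚ.+ 1ℚ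
oddHalf-suc s = ≡.trans (≡.cong (ℚ._* ½) (≡.trans (≡.cong fromℕ (≡.cong suc (≡.trans (ℕₚ.*-suc 2 s) (ℕₚ.+-comm 2 (2 ℕ.* s)))))
  (fromℕ-+ (suc (2 ℕ.* s)) 2))) (≡.trans (ℚₚ.*-distribʳ-+ ½ (fromℕ (suc (2 ℕ.* s))) (fromℕ 2)) (≡.cong (oddHalf s ℚ.+_) ≡.refl))

cosecCoeff : ℕ → ℚ
cosecCoeff n = (fromℕ 2 ℚ.* ½ ^ℚ n ℚ.- 1ℚ) ℚ.* (bernoulli n ℚ.* recip (n !))

module Hyperbolic {c ℓ} (R : CommutativeRing c ℓ) (𝒬 : ℚ-Structure R) where
  open CommutativeRing R
  open ℚ-Structure 𝒬
  open IntegerSolver R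
  open Convolution R
  open RationalAlgebra R 𝒬
  open import Relation.Binary.Reasoning.Setoid setoid
  open IntegerSolver seriesRing using () renaming (solve to solveˢ; con to conˢ; _:=_ to _:=ˢ_; _:+_ to _:+ˢ_; _:*_ to _:*ˢ_; _:-_ to _:-ˢ_; :-_ to :-ˢ_)

  E≡ : ∀ {x y} → x ≡ y → E x ≋ E y
  E≡ ≡.refl = W.refl

  Sh : ℚ → PS
  Sh x = E x W.- E (ℚ.- x)

  Sh-coeff : ∀ x n → Sh x n ≈ (if isEven n then 0# else ι (fromℕ 2 ℚ.* (x ^ℚ n ℚ.* recip (n !))))
  Sh-coeff x n = trans (+-congˡ (-‿cong (ι≡ (≡.cong (ℚ._* recip (n !)) (neg-^ x n))))) split
    where
    split : ι (x ^ℚ n ℚ.* recip (n !)) - ι ((if isEven n then x ^ℚ n else ℚ.- (x ^ℚ n)) ℚ.* recip (n !))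
      ≈ (if isEven n then 0# else ι (fromℕ 2 ℚ.* (x ^ℚ n ℚ.* recip (n !))))
    split with isEven n
    ... | true = -‿inverseʳ _
    ... | false = trans (+-congˡ (sym (ι-neg _))) (trans (sym (ι-+ _ _)) (ι≡
      (solveℚ 2 (λ x r → x :*ℚ r :+ℚ :-ℚ ((:-ℚ x) :*ℚ r)
        :=ℚ (conℚ (+ 1) :+ℚ conℚ (+ 1)) :*ℚ (x :*ℚ r)) ≡.refl (x ^ℚ n) (recip (n !)))))

  t : PS
  t = E 1ℚ ⊞ E (ℚ.- 1ℚ)

  t-Sh : ∀ x → t ⊠ Sh x ≋ Sh (x ℚ.+ 1ℚ) ⊞ Sh (x ℚ.- 1ℚ)
  t-Sh x = W.trans (solveˢ 4 (λ p m a b → (p :+ˢ m) :*ˢ (a :-ˢ b)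
      :=ˢ (a :*ˢ p :-ˢ b :*ˢ m) :+ˢ (a :*ˢ m :-ˢ b :*ˢ p)) W.refl (E 1ℚ) (E (ℚ.- 1ℚ)) (E x) (E (ℚ.- x)))
    (W.+-cong (W.+-cong (E-+ x 1ℚ) (W.-‿cong (W.trans (E-+ (ℚ.- x) (ℚ.- 1ℚ)) (E≡ (≡.sym (ℚₚ.neg-distrib-+ x 1ℚ))))))
              (W.+-cong (E-+ x (ℚ.- 1ℚ)) (W.-‿cong (W.trans (E-+ (ℚ.- x) 1ℚ) (E≡ (≡.sym (ℚₚ.neg-distrib-+ x (ℚ.- 1ℚ))))))))

  sh : ℕ → PS
  sh s = Sh (oddHalf s)

  t-sh-suc : ∀ s → t ⊠ sh (suc s) ≋ sh (suc (suc s)) ⊞ sh s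
  t-sh-suc s = W.trans (t-Sh (oddHalf (suc s))) (W.+-cong (Sh≡ (≡.sym (oddHalf-suc (suc s)))) (Sh≡
    (≡.trans (≡.cong (ℚ._- 1ℚ) (oddHalf-suc s)) (solveℚ 2 (λ a b → (a :+ℚ b) :-ℚ b :=ℚ a) ≡.refl (oddHalf s) 1ℚ))))
    where
    Sh≡ : ∀ {x y} → x ≡ y → Sh x ≋ Sh y
    Sh≡ ≡.refl = W.refl

  t-sh-0 : t ⊠ sh 0 ≋ sh 1 W.- sh 0
  t-sh-0 = W.trans (t-Sh (oddHalf 0)) (W.+-congˡ {x = sh 1}
    (solveˢ 2 (λ a b → a :-ˢ b :=ˢ :-ˢ (b :-ˢ a)) W.refl (E (oddHalf 0 ℚ.- 1ℚ)) (E (ℚ.- (oddHalf 0 ℚ.- 1ℚ)))))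

  2-t : W.1# ⊞ W.1# W.- t ≋ W.- (sh 0 ⊠ sh 0)
  2-t = W.trans (W.+-cong (W.+-cong (W.sym one) (W.sym one)) (W.-‿cong (W.+-cong (W.sym (E-+ h h)) (W.sym (E-+ (ℚ.- h) (ℚ.- h))))))
    (solveˢ 2 (λ a b → a :*ˢ b :+ˢ a :*ˢ b :-ˢ (a :*ˢ a :+ˢ b :*ˢ b) :=ˢ :-ˢ ((a :-ˢ b) :*ˢ (a :-ˢ b))) W.refl (E h) (E (ℚ.- h)))
    where
    h = oddHalf 0
    one : E h ⊠ E (ℚ.- h) ≋ W.1#
    one = W.trans (E-+ h (ℚ.- h)) (W.trans (E≡ (ℚₚ.+-inverseʳ h)) E-zero)

  sinc : PS
  sinc i = if isEven i then ι (recip (2 ℕ.^ i ℕ.* suc i !)) else 0#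

  sinc-sh : monomial 1 ⊠ sinc ≋ sh 0
  sinc-sh zero _ = trans (monomial-⊠-< 1 sinc 0 (s≤s z≤n)) (sym (Sh-coeff (oddHalf 0) 0))
  sinc-sh (suc i) _ = trans (monomial-⊠ 1 sinc i) (trans split (sym (Sh-coeff (oddHalf 0) (suc i))))
    where
    val : recip (2 ℕ.^ i ℕ.* suc i !) ≡ fromℕ 2 ℚ.* (oddHalf 0 ^ℚ suc i ℚ.* recip (suc i !))
    val = ≡.trans (recip-* (2 ℕ.^ i) (suc i !) {{ℕₚ.m^n≢0 2 i}} {{suc i ℕₚ.!≢0}})
      (≡.trans (≡.cong (ℚ._* recip (suc i !)) (≡.sym (½-^ i)))
      (≡.trans (≡.sym (ℚₚ.*-identityˡ _))
      (solveℚ 4 (λ a b x r → (a :*ℚ b) :*ℚ (x :*ℚ r) :=ℚ a :*ℚ (b :*ℚ x :*ℚ r)) ≡.refl (fromℕ 2) ½ (½ ^ℚ i) (recip (suc i !)))))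
    split : sinc i ≈ (if isEven (suc i) then 0# else ι (fromℕ 2 ℚ.* (oddHalf 0 ^ℚ suc i ℚ.* recip (suc i !))))
    split rewrite isEven-suc i with isEven i
    ... | true = ι≡ val
    ... | false = refl

  w-cancel : ∀ {a b} → monomial 1 ⊠ a ≋ monomial 1 ⊠ b → a ≋ b
  w-cancel {a} {b} h n _ = trans (sym (monomial-⊠ 1 a n)) (trans (h (suc n) tt) (monomial-⊠ 1 b n))

  sinc-cancel : ∀ {a b} → sinc ⊠ a ≋ sinc ⊠ b → a ≋ b
  sinc-cancel = ⊠-cancelˡ sinc 1# (trans (*-identityˡ _) ι-1)

  -- substitution of x w for w
  σ : ℚ → PS → PS
  σ x a n = ι (x ^ℚ n) * a n

  σ-⊠ : ∀ x a b → σ x (a ⊠ b) ≋ σ x a ⊠ σ x b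
  σ-⊠ x a b n _ = begin
    ι (x ^ℚ n) * (a ⊠ b) n                      ≈⟨ *-congˡ (⊠-conv a b n) ⟩
    ι (x ^ℚ n) * conv n (λ i j → a i * b j)     ≈⟨ sym (conv-index n (λ m → ι (x ^ℚ m)) (λ i j → a i * b j)) ⟩
    conv n (λ i j → ι (x ^ℚ (i ℕ.+ j)) * (a i * b j))
      ≈⟨ conv-cong′ n (λ i j → trans (*-congʳ (trans (ι≡ (^ℚ-homo-* x i j)) (ι-* _ _)))
           (solve 4 (λ u v a b → u :* v :* (a :* b) := u :* a :* (v :* b)) refl (ι (x ^ℚ i)) (ι (x ^ℚ j)) (a i) (b j))) ⟩
    conv n (λ i j → σ x a i * σ x b j)          ≈⟨ sym (⊠-conv (σ x a) (σ x b) n) ⟩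
    (σ x a ⊠ σ x b) n ∎

  σ-cong : ∀ x {a b} → a ≋ b → σ x a ≋ σ x b
  σ-cong x h n _ = *-congˡ (h n tt)

  σ-- : ∀ x a b → σ x (a W.- b) ≋ σ x a W.- σ x b
  σ-- x a b n _ = solve 3 (λ u a b → u :* (a :- b) := u :* a :- u :* b) refl (ι (x ^ℚ n)) (a n) (b n)

  σ-E : ∀ x y → σ x (E y) ≋ E (x ℚ.* y)
  σ-E x y n _ = trans (sym (ι-* _ _)) (ι≡ (≡.trans (≡.sym (ℚₚ.*-assoc (x ^ℚ n) (y ^ℚ n) (recip (n !))))
    (≡.cong (ℚ._* recip (n !)) (≡.sym (^ℚ-distrib-* x y n)))))

  σ-w : ∀ x → σ x (monomial 1) ≋ const (ι x) ⊠ monomial 1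
  σ-w x n _ = trans (val n) (sym (const-⊠ (ι x) (monomial 1) n))
    where
    val : ∀ n → σ x (monomial 1) n ≈ ι x * monomial 1 n
    val zero = trans (zeroʳ _) (sym (zeroʳ _))
    val (suc zero) = *-congʳ (ι≡ (ℚₚ.*-identityʳ x))
    val (suc (suc n)) = trans (zeroʳ _) (sym (zeroʳ _))

  bernoulliSeries : PS
  bernoulliSeries n = ι (bernoulli n ℚ.* recip (n !))

  bernoulli-identity : (E 1ℚ W.- W.1#) ⊠ bernoulliSeries ≋ monomial 1
  bernoulli-identity = W.trans (W.*-congʳ {x = bernoulliSeries} (W.sym quotient)) (W.trans
    (W.*-assoc (monomial 1) (λ l → κ (suc l)) bernoulliSeries)
    (W.trans (W.*-congˡ {x = monomial 1} inverse) (W.*-identityʳ (monomial 1))))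
    where
    quotient : monomial 1 ⊠ (λ l → κ (suc l)) ≋ E 1ℚ W.- W.1#
    quotient zero _ = trans (monomial-⊠-< 1 (λ l → κ (suc l)) 0 (s≤s z≤n)) (sym (trans (+-congʳ (E-0 1ℚ)) (-‿inverseʳ _)))
    quotient (suc n) _ = trans (monomial-⊠ 1 (λ l → κ (suc l)) n) (sym (trans
      (solve 1 (λ x → x :- con (+ 0) := x) refl (E 1ℚ (suc n)))
      (ι≡ (≡.trans (≡.cong (ℚ._* recip (suc n !)) (1-^ (suc n))) (ℚₚ.*-identityˡ _)))))
    inverse : (λ l → κ (suc l)) ⊠ bernoulliSeries ≋ W.1#
    inverse n _ = trans (⊠-comm (λ l → κ (suc l)) bernoulliSeries n) (trans (⊠-conv bernoulliSeries (λ l → κ (suc l)) n)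
      (trans (conv-cong′ n (λ i j → sym (ι-* _ _))) (trans (sym (ι-conv n _)) (val n))))
      where
      val : ∀ n → ι (Convolution.conv ℚring n (λ j l → bernoulli j ℚ.* recip (j !) ℚ.* recip (suc l !))) ≈ W.1# n
      val zero = ι-1
      val (suc n) = trans (ι≡ (bernoulli-conv n)) ι-0

  cosecSeries : PS
  cosecSeries n = ι (cosecCoeff n)

  cosec-bernoulli : cosecSeries ≋ const (ι (fromℕ 2)) ⊠ σ ½ bernoulliSeries W.- bernoulliSeries
  cosec-bernoulli n _ = begin
    ι ((fromℕ 2 ℚ.* ½ ^ℚ n ℚ.- 1ℚ) ℚ.* b)
      ≈⟨ trans (ι-* _ _) (*-congʳ (trans (ι-+ _ _) (+-cong (ι-* _ _) (trans (ι-neg 1ℚ) (-‿cong ι-1))))) ⟩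
    (ι (fromℕ 2) * ι (½ ^ℚ n) - 1#) * ι b
      ≈⟨ solve 3 (λ a x b → (a :* x :- con (+ 1)) :* b := a :* (x :* b) :- b) refl _ _ _ ⟩
    ι (fromℕ 2) * (ι (½ ^ℚ n) * ι b) - ι b
      ≈⟨ +-congʳ (sym (const-⊠ (ι (fromℕ 2)) (σ ½ bernoulliSeries) n)) ⟩
    _ ∎
    where b = bernoulli n ℚ.* recip (n !)

  -- w / (e^{w/2} - e^{-w/2}) = 2 b(w/2) - b(w) for b(w) = w / (e^w - 1)
  sh-cosec : sh 0 ⊠ cosecSeries ≋ monomial 1
  sh-cosec = W.trans (W.trans (W.sym (W.*-identityˡ _)) (W.*-congʳ {x = sh 0 ⊠ cosecSeries} (W.sym inverse)))
    (W.trans (W.*-assoc (E (ℚ.- h)) (E h) (sh 0 ⊠ cosecSeries))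
    (W.trans (W.*-congˡ {x = E (ℚ.- h)} scaled)
    (W.trans (W.sym (W.*-assoc (E (ℚ.- h)) (E h) (monomial 1)))
    (W.trans (W.*-congʳ {x = monomial 1} inverse) (W.*-identityˡ _)))))
    where
    h = oddHalf 0
    b b½ : PS
    b = bernoulliSeries
    b½ = σ ½ bernoulliSeries
    inverse : E (ℚ.- h) ⊠ E h ≋ W.1#
    inverse = W.trans (E-+ (ℚ.- h) h) (W.trans (E≡ (ℚₚ.+-inverseˡ h)) E-zero)
    square : E h ⊠ E h ≋ E 1ℚ
    square = E-+ h h
    half : (E h W.- W.1#) ⊠ b½ ≋ const (ι ½) ⊠ monomial 1
    half = W.trans (W.*-congʳ {x = b½} (W.+-cong (W.sym (σ-E ½ 1ℚ)) (W.-‿cong (W.sym σ-1)))) (W.trans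
      (W.*-congʳ {x = b½} (W.sym (σ-- ½ (E 1ℚ) W.1#)))
      (W.trans (W.sym (σ-⊠ ½ (E 1ℚ W.- W.1#) b)) (W.trans (σ-cong ½ bernoulli-identity) (σ-w ½))))
      where
      σ-1 : σ ½ W.1# ≋ W.1#
      σ-1 zero _ = trans (*-identityʳ _) ι-1
      σ-1 (suc n) _ = zeroʳ _
    two-half : const (ι (fromℕ 2)) ⊠ const (ι ½) ≋ W.1#
    two-half = W.trans (W.sym (const-* _ _)) (const-cong (trans (sym (ι-* _ _)) ι-1))
    scaled : E h ⊠ (sh 0 ⊠ cosecSeries) ≋ E h ⊠ monomial 1
    scaled = W.trans (W.*-congˡ {x = E h} (W.*-congˡ {x = sh 0} cosec-bernoulli)) (W.trans
      (solveˢ 5 (λ e e′ c x y → e :*ˢ ((e :-ˢ e′) :*ˢ (c :*ˢ x :-ˢ y)) :=ˢ (e :*ˢ e :-ˢ e′ :*ˢ e) :*ˢ (c :*ˢ x) :-ˢ (e :*ˢ e :-ˢ e′ :*ˢ e) :*ˢ y)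
        W.refl (E h) (E (ℚ.- h)) (const (ι (fromℕ 2))) b½ b)
      (W.trans (W.+-cong (W.*-congʳ {x = const (ι (fromℕ 2)) ⊠ b½} (W.+-congˡ {x = E h ⊠ E h} (W.-‿cong inverse)))
         (W.-‿cong (W.trans (W.*-congʳ {x = b} (W.+-cong square (W.-‿cong inverse))) bernoulli-identity)))
      (W.trans (solveˢ 4 (λ e c x w → let i = conˢ (+ 1) in
            (e :*ˢ e :-ˢ i) :*ˢ (c :*ˢ x) :-ˢ w :=ˢ c :*ˢ (e :+ˢ i) :*ˢ ((e :-ˢ i) :*ˢ x) :-ˢ w)
          W.refl (E h) (const (ι (fromℕ 2))) b½ (monomial 1))
      (W.trans (W.+-congʳ {x = W.- monomial 1} (W.*-congˡ {x = const (ι (fromℕ 2)) ⊠ (E h ⊞ W.1#)} half))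
      (W.trans (solveˢ 4 (λ e c x w → let i = conˢ (+ 1) in
            c :*ˢ (e :+ˢ i) :*ˢ (x :*ˢ w) :-ˢ w :=ˢ (c :*ˢ x) :*ˢ ((e :+ˢ i) :*ˢ w) :-ˢ w)
          W.refl (E h) (const (ι (fromℕ 2))) (const (ι ½)) (monomial 1))
      (W.trans (W.+-congʳ {x = W.- monomial 1} (W.*-congʳ {x = (E h ⊞ W.1#) ⊠ monomial 1} two-half))
      (solveˢ 2 (λ e w → let i = conˢ (+ 1) in i :*ˢ ((e :+ˢ i) :*ˢ w) :-ˢ w :=ˢ e :*ˢ w) W.refl (E h) (monomial 1))))))))

  cosec-odd : ∀ n → isEven n ≡ false → ι (cosecCoeff n) ≈ 0#
  cosec-odd n odd = ν-cancel 1 (begin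
    ι (fromℕ 2) * x                ≈⟨ *-congʳ (trans (ν-+ 1 1) (+-cong ι-1 ι-1)) ⟩
    (1# + 1#) * x                  ≈⟨ solve 1 (λ x → (con (+ 1) :+ con (+ 1)) :* x := x :+ x) refl x ⟩
    x + x                          ≈⟨ +-congˡ (parity n tt) ⟩
    x + ι ((ℚ.- 1ℚ) ^ℚ n) * x      ≈⟨ +-congˡ (*-congʳ (trans (ι≡ sign) (trans (ι-neg 1ℚ) (-‿cong ι-1)))) ⟩
    x + - 1# * x                   ≈⟨ solve 1 (λ x → x :+ :- con (+ 1) :* x := con (+ 0)) refl x ⟩
    0#                             ≈⟨ sym (zeroʳ _) ⟩
    ι (fromℕ 2) * 0# ∎)
    where
    x = ι (cosecCoeff n)
    sign : (ℚ.- 1ℚ) ^ℚ n ≡ ℚ.- 1ℚ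
    sign = ≡.trans (neg-^ 1ℚ n) (≡.trans (≡.cong (λ b → if b then 1ℚ ^ℚ n else ℚ.- (1ℚ ^ℚ n)) odd) (≡.cong ℚ.-_ (1-^ n)))
    σ⁻ : PS
    σ⁻ = σ (ℚ.- 1ℚ) cosecSeries
    flip : σ (ℚ.- 1ℚ) (sh 0) ≋ W.- sh 0
    flip = W.trans (σ-- (ℚ.- 1ℚ) (E (oddHalf 0)) (E (ℚ.- oddHalf 0))) (W.trans
      (W.+-cong (σ-E (ℚ.- 1ℚ) (oddHalf 0)) (W.-‿cong (σ-E (ℚ.- 1ℚ) (ℚ.- oddHalf 0))))
      (solveˢ 2 (λ a b → b :-ˢ a :=ˢ :-ˢ (a :-ˢ b)) W.refl (E (oddHalf 0)) (E (ℚ.- oddHalf 0))))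
    mirrored : sh 0 ⊠ σ⁻ ≋ monomial 1
    mirrored = W.trans (solveˢ 2 (λ a b → a :*ˢ b :=ˢ :-ˢ ((:-ˢ a) :*ˢ b)) W.refl (sh 0) σ⁻)
      (W.trans (W.-‿cong (W.trans (W.*-congʳ {x = σ⁻} (W.sym flip)) (W.trans (W.sym (σ-⊠ (ℚ.- 1ℚ) (sh 0) cosecSeries))
        (W.trans (σ-cong (ℚ.- 1ℚ) sh-cosec) (W.trans (σ-w (ℚ.- 1ℚ)) (W.*-congʳ {x = monomial 1} minus))))))
      (solveˢ 1 (λ w → :-ˢ ((:-ˢ conˢ (+ 1)) :*ˢ w) :=ˢ w) W.refl (monomial 1)))
      where
      minus : const (ι (ℚ.- 1ℚ)) ≋ W.- W.1#
      minus = W.trans (const-cong (trans (ι-neg 1ℚ) (-‿cong ι-1))) (const-neg 1#)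
    parity : cosecSeries ≋ σ⁻
    parity = sinc-cancel (w-cancel (W.trans (W.sym (W.*-assoc (monomial 1) sinc cosecSeries))
      (W.trans (W.*-congʳ {x = cosecSeries} sinc-sh) (W.trans sh-cosec (W.trans (W.sym mirrored)
      (W.trans (W.*-congʳ {x = σ⁻} (W.sym sinc-sh)) (W.*-assoc (monomial 1) sinc σ⁻)))))))

-- Lattice sums

≡ᵇ-false : ∀ {m n} → m ≢ n → (m ≡ᵇ n) ≡ false
≡ᵇ-false {m} {n} ne with m ≡ᵇ n in eq
... | false = ≡.refl
... | true = contradiction (ℕₚ.≡ᵇ⇒≡ m n (Equivalence.from T-≡ eq)) ne

triangle : ℕ → ℕ
triangle zero = 0
triangle (suc r) = suc r ℕ.+ triangle r

triangle-odd : ∀ j → triangle (suc (j ℕ.+ j)) ≡ suc (j ℕ.+ j) ℕ.* suc j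
triangle-odd zero = ≡.refl
triangle-odd (suc j) = ≡.trans (≡.cong (λ z → triangle (suc (suc z))) (ℕₚ.+-suc j j))
  (≡.trans (≡.cong (λ z → suc (suc (suc (j ℕ.+ j))) ℕ.+ (suc (suc (j ℕ.+ j)) ℕ.+ z)) (triangle-odd j)) (eq j))
  where
  eq : ∀ j → suc (suc (suc (j ℕ.+ j))) ℕ.+ (suc (suc (j ℕ.+ j)) ℕ.+ suc (j ℕ.+ j) ℕ.* suc j) ≡ suc (suc j ℕ.+ suc j) ℕ.* suc (suc j)
  eq = solve-∀

triangle-even : ∀ j → triangle (suc (suc (j ℕ.+ j))) ≡ suc j ℕ.* suc (suc j ℕ.+ suc j)
triangle-even j = ≡.trans (≡.cong (suc (suc (j ℕ.+ j)) ℕ.+_) (triangle-odd j)) (eq j)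
  where
  eq : ∀ j → suc (suc (j ℕ.+ j)) ℕ.+ suc (j ℕ.+ j) ℕ.* suc j ≡ suc j ℕ.* suc (suc j ℕ.+ suc j)
  eq = solve-∀

isEven-double : ∀ j → isEven (j ℕ.+ j) ≡ true
isEven-double zero = ≡.refl
isEven-double (suc j) rewrite ℕₚ.+-suc j j = isEven-double j

module LatticeSum {c ℓ} (R : CommutativeRing c ℓ)
  (h : ℕ → CommutativeRing.Carrier R) (k N : ℕ) where
  open CommutativeRing R
  open IntegerSolver R
  open Convolution R
  open RangeSum R
  open import Relation.Binary.Reasoning.Setoid setoid

  private
    b = suc (k ℕ.+ k)

  at : ℕ → Carrier → Carrier
  at e x = if e ≡ᵇ N then x else 0#

  at-cong : ∀ e {x y} → x ≈ y → at e x ≈ at e y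
  at-cong e xy with e ≡ᵇ N
  ... | true = xy
  ... | false = refl

  at-> : ∀ {e} → N ℕ.< e → ∀ x → at e x ≈ 0#
  at-> {e} lt x rewrite ≡ᵇ-false {e} {N} (λ e≡N → ℕₚ.<-irrefl (≡.sym e≡N) lt) = refl

  at-0 : ∀ e → at e 0# ≈ 0#
  at-0 e with e ≡ᵇ N
  ... | true = refl
  ... | false = refl

  at-- : ∀ e x y → at e (x - y) ≈ at e x - at e y
  at-- e x y with e ≡ᵇ N
  ... | true = refl
  ... | false = sym (-‿inverseʳ 0#)

  gap : ℕ → ℕ → Carrier
  gap x y = if suc x ℕ.≤ᵇ y then h (y ∸ x) else 0#

  gap-+ : ∀ x s → gap x (x ℕ.+ suc s) ≈ h (suc s)
  gap-+ x s rewrite ≤ᵇ-true {suc x} {x ℕ.+ suc s} (ℕₚ.≤-trans (s≤s (ℕₚ.m≤m+n x s)) (ℕₚ.≤-reflexive (≡.sym (ℕₚ.+-suc x s))))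
    | ℕₚ.m+n∸m≡n x (suc s) = refl

  gap-≥ : ∀ x y → y ℕ.≤ x → gap x y ≈ 0#
  gap-≥ x y le rewrite ≤ᵇ-false {suc x} {y} (s≤s le) = refl

  ∑-parity : ∀ M f → ∑ (suc (M ℕ.+ M)) f ≈ ∑ M (λ j → f (j ℕ.+ j)) + ∑ M (λ j → f (suc (j ℕ.+ j)))
  ∑-parity zero f = refl
  ∑-parity (suc M) f = begin
    ∑ (suc (suc M ℕ.+ suc M)) f
      ≡⟨ ≡.cong (λ z → ∑ (suc (suc z)) f) (ℕₚ.+-suc M M) ⟩
    f 0 + (f 1 + ∑ (suc (M ℕ.+ M)) (λ i → f (suc (suc i))))
      ≈⟨ +-congˡ (+-congˡ (∑-parity M (λ i → f (suc (suc i))))) ⟩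
    f 0 + (f 1 + (∑ M (λ j → f (suc (suc (j ℕ.+ j)))) + ∑ M (λ j → f (suc (suc (suc (j ℕ.+ j)))))))
      ≈⟨ solve 4 (λ a b c d → a :+ (b :+ (c :+ d)) := (a :+ c) :+ (b :+ d)) refl _ _ _ _ ⟩
    (f 0 + ∑ M (λ j → f (suc (suc (j ℕ.+ j))))) + (f 1 + ∑ M (λ j → f (suc (suc (suc (j ℕ.+ j))))))
      ≈⟨ +-cong (+-congˡ (conv-cong′ M (λ j _ → reflexive (≡.cong (λ z → f (suc z)) (≡.sym (ℕₚ.+-suc j j))))))
                (+-congˡ (conv-cong′ M (λ j _ → reflexive (≡.cong (λ z → f (suc (suc z))) (≡.sym (ℕₚ.+-suc j j)))))) ⟩
    ∑ (suc M) (λ j → f (j ℕ.+ j)) + ∑ (suc M) (λ j → f (suc (j ℕ.+ j))) ∎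

  ∑-shift : ∀ a M f → (∀ n → n ℕ.< a → f n ≈ 0#) → ∑ (a ℕ.+ M) f ≈ ∑ M (λ s → f (a ℕ.+ s))
  ∑-shift zero M f z = refl
  ∑-shift (suc a) M f z = trans (+-congʳ (z 0 (s≤s z≤n))) (trans (+-identityˡ _)
    (∑-shift a M (λ i → f (suc i)) (λ n lt → z (suc n) (s≤s lt))))

  ∑-offset : ∀ a f → (∀ n → n ℕ.< a → f n ≈ 0#) → (∀ n → N ℕ.< n → f n ≈ 0#) →
    ∑ N f ≈ ∑ N (λ s → f (a ℕ.+ s))
  ∑-offset a f lo hi = trans (sym (∑-extend N (a ℕ.+ N) f (ℕₚ.m≤n+m N a) hi)) (∑-shift a N f lo)

  ∑-neg : ∀ n f → ∑ n (λ i → - f i) ≈ - ∑ n f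
  ∑-neg n f = begin
    ∑ n (λ i → - f i)        ≈⟨ conv-cong′ n (λ i _ → solve 1 (λ x → :- x := :- con (+ 1) :* x) refl (f i)) ⟩
    ∑ n (λ i → - 1# * f i)   ≈⟨ conv-*ˡ n (- 1#) (λ i _ → f i) ⟩
    - 1# * ∑ n f             ≈⟨ solve 1 (λ x → :- con (+ 1) :* x := :- x) refl _ ⟩
    - ∑ n f ∎

  ∑-- : ∀ n f g → ∑ n (λ i → f i - g i) ≈ ∑ n f - ∑ n g
  ∑-- n f g = trans (conv-+ n (λ i _ → f i) (λ i _ → - g i)) (+-congˡ (∑-neg n g))

  ∑-split : ∀ f → (∀ n → N ℕ.< n → f n ≈ 0#) →
    ∑ N f ≈ ∑ N (λ j → f (j ℕ.+ j)) + ∑ N (λ j → f (suc (j ℕ.+ j)))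
  ∑-split f hi = trans (sym (∑-extend N (suc (N ℕ.+ N)) f (ℕₚ.m≤n⇒m≤1+n (ℕₚ.m≤m+n N N)) hi)) (∑-parity N f)

  exponent : ℕ → ℕ → ℕ
  exponent r s = k ℕ.* (r ℕ.* r) ℕ.+ triangle r ℕ.+ r ℕ.* s

  exponent-odd : ∀ j s → exponent (suc (j ℕ.+ j)) s ≡ suc (j ℕ.+ j) ℕ.* (b ℕ.* j ℕ.+ suc k ℕ.+ s)
  exponent-odd j s = ≡.trans (≡.cong (λ z → k ℕ.* (suc (j ℕ.+ j) ℕ.* suc (j ℕ.+ j)) ℕ.+ z ℕ.+ suc (j ℕ.+ j) ℕ.* s) (triangle-odd j)) (eq k j s)
    where
    eq : ∀ k j s → k ℕ.* (suc (j ℕ.+ j) ℕ.* suc (j ℕ.+ j)) ℕ.+ suc (j ℕ.+ j) ℕ.* suc j ℕ.+ suc (j ℕ.+ j) ℕ.* s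
      ≡ suc (j ℕ.+ j) ℕ.* (suc (k ℕ.+ k) ℕ.* j ℕ.+ suc k ℕ.+ s)
    eq = solve-∀

  exponent-even : ∀ j s → exponent (suc (suc (j ℕ.+ j))) s
    ≡ suc (b ℕ.* suc j ℕ.+ s ℕ.+ (b ℕ.* suc j ℕ.+ s)) ℕ.* suc j
  exponent-even j s = ≡.trans (≡.cong (λ z → k ℕ.* (suc (suc (j ℕ.+ j)) ℕ.* suc (suc (j ℕ.+ j))) ℕ.+ z ℕ.+ suc (suc (j ℕ.+ j)) ℕ.* s) (triangle-even j)) (eq k j s)
    where
    eq : ∀ k j s → k ℕ.* (suc (suc (j ℕ.+ j)) ℕ.* suc (suc (j ℕ.+ j))) ℕ.+ suc j ℕ.* suc (suc j ℕ.+ suc j) ℕ.+ suc (suc (j ℕ.+ j)) ℕ.* s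
      ≡ suc (suc (k ℕ.+ k) ℕ.* suc j ℕ.+ s ℕ.+ (suc (k ℕ.+ k) ℕ.* suc j ℕ.+ s)) ℕ.* suc j
    eq = solve-∀

  signed : ℕ → Carrier → Carrier
  signed r x = if isEven r then x else - x

  F G : ℕ → ℕ → Carrier
  F m n = at (m ℕ.* n) (gap (b ℕ.* m) (2 ℕ.* n))
  G m n = at (m ℕ.* n) (gap (2 ℕ.* b ℕ.* n) m)

  term : ℕ → ℕ → Carrier
  term r s = at (exponent r s) (h (suc (2 ℕ.* s)))

  F-even-G : ∀ j n → F (j ℕ.+ j) n ≈ G (n ℕ.+ n) j
  F-even-G j n = reflexive (≡.cong₂ (λ e x → at e x) (eq₁ j n) (≡.cong₂ gap (eq₂ k j) (eq₃ n)))
    where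
    eq₁ : ∀ j n → (j ℕ.+ j) ℕ.* n ≡ (n ℕ.+ n) ℕ.* j
    eq₁ = solve-∀
    eq₂ : ∀ k j → suc (k ℕ.+ k) ℕ.* (j ℕ.+ j) ≡ 2 ℕ.* suc (k ℕ.+ k) ℕ.* j
    eq₂ = solve-∀
    eq₃ : ∀ n → 2 ℕ.* n ≡ n ℕ.+ n
    eq₃ = solve-∀

  F-odd : ∀ j → ∑ N (F (suc (j ℕ.+ j))) ≈ ∑ N (term (suc (j ℕ.+ j)))
  F-odd j = trans (∑-offset (b ℕ.* j ℕ.+ suc k) (F m) low high) (conv-cong′ N (λ s _ → value s))
    where
    m = suc (j ℕ.+ j)
    low : ∀ n → n ℕ.< b ℕ.* j ℕ.+ suc k → F m n ≈ 0#
    low n lt = trans (at-cong (m ℕ.* n) (gap-≥ (b ℕ.* m) (2 ℕ.* n)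
      (ℕₚ.≤-trans (ℕₚ.*-monoʳ-≤ 2 (ℕₚ.≤-pred (≡.subst (suc n ℕ.≤_) (ℕₚ.+-suc (b ℕ.* j) k) lt)))
        (ℕₚ.≤-trans (ℕₚ.n≤1+n _) (ℕₚ.≤-reflexive (eq k j)))))) (at-0 (m ℕ.* n))
      where
      eq : ∀ k j → suc (2 ℕ.* (suc (k ℕ.+ k) ℕ.* j ℕ.+ k)) ≡ suc (k ℕ.+ k) ℕ.* suc (j ℕ.+ j)
      eq = solve-∀
    high : ∀ n → N ℕ.< n → F m n ≈ 0#
    high n lt = at-> (ℕₚ.<-≤-trans lt (ℕₚ.m≤n*m n m)) _
    value : ∀ s → F m (b ℕ.* j ℕ.+ suc k ℕ.+ s) ≈ term m s
    value s = trans (reflexive (≡.cong₂ at (≡.sym (exponent-odd j s)) (≡.cong (gap (b ℕ.* m)) (eq k j s))))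
      (at-cong (exponent m s) (gap-+ (b ℕ.* m) (2 ℕ.* s)))
      where
      eq : ∀ k j s → 2 ℕ.* (suc (k ℕ.+ k) ℕ.* j ℕ.+ suc k ℕ.+ s) ≡ suc (k ℕ.+ k) ℕ.* suc (j ℕ.+ j) ℕ.+ suc (2 ℕ.* s)
      eq = solve-∀

  G-odd : ∀ n → ∑ N (λ j → G (suc (j ℕ.+ j)) (suc n)) ≈ ∑ N (term (suc (suc (n ℕ.+ n))))
  G-odd n = trans (∑-offset (b ℕ.* suc n) g low high) (conv-cong′ N (λ s _ → value s))
    where
    g : ℕ → Carrier
    g j = G (suc (j ℕ.+ j)) (suc n)
    low : ∀ j → j ℕ.< b ℕ.* suc n → g j ≈ 0#
    low j lt = trans (at-cong (suc (j ℕ.+ j) ℕ.* suc n) (gap-≥ (2 ℕ.* b ℕ.* suc n) (suc (j ℕ.+ j))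
      (ℕₚ.≤-trans (s≤s (ℕₚ.+-monoʳ-≤ j (ℕₚ.n≤1+n j)))
        (ℕₚ.≤-trans (ℕₚ.+-mono-≤ lt lt) (ℕₚ.≤-reflexive (eq k n)))))) (at-0 (suc (j ℕ.+ j) ℕ.* suc n))
      where
      eq : ∀ k n → suc (k ℕ.+ k) ℕ.* suc n ℕ.+ suc (k ℕ.+ k) ℕ.* suc n ≡ 2 ℕ.* suc (k ℕ.+ k) ℕ.* suc n
      eq = solve-∀
    high : ∀ j → N ℕ.< j → g j ≈ 0#
    high j lt = at-> (ℕₚ.<-≤-trans lt (ℕₚ.≤-trans (ℕₚ.m≤n⇒m≤1+n (ℕₚ.m≤m+n j j)) (ℕₚ.m≤m*n (suc (j ℕ.+ j)) (suc n)))) _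
    value : ∀ s → g (b ℕ.* suc n ℕ.+ s) ≈ term (suc (suc (n ℕ.+ n))) s
    value s = trans (reflexive (≡.cong₂ at (≡.sym (exponent-even n s)) (≡.cong (gap (2 ℕ.* b ℕ.* suc n)) (eq k n s))))
      (at-cong (exponent (suc (suc (n ℕ.+ n))) s) (gap-+ (2 ℕ.* b ℕ.* suc n) (2 ℕ.* s)))
      where
      eq : ∀ k n s → suc (suc (k ℕ.+ k) ℕ.* suc n ℕ.+ s ℕ.+ (suc (k ℕ.+ k) ℕ.* suc n ℕ.+ s)) ≡ 2 ℕ.* suc (k ℕ.+ k) ℕ.* suc n ℕ.+ suc (2 ℕ.* s)
      eq = solve-∀

  signed-even : ∀ j x → signed (j ℕ.+ j) x ≈ x
  signed-even j x rewrite isEven-double j = refl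

  signed-odd : ∀ j x → signed (suc (j ℕ.+ j)) x ≈ - x
  signed-odd j x rewrite isEven-suc (j ℕ.+ j) | isEven-double j = refl

  signed-≈0 : ∀ r {x} → x ≈ 0# → signed r x ≈ 0#
  signed-≈0 r z with isEven r
  ... | true = z
  ... | false = trans (-‿cong z) (solve 0 (:- con (+ 0) := con (+ 0)) refl)

  exponent-≥ : ∀ r s → r ℕ.≤ exponent r s
  exponent-≥ zero s = z≤n
  exponent-≥ (suc r) s = ℕₚ.≤-trans (ℕₚ.m≤m+n (suc r) (triangle r))
    (ℕₚ.≤-trans (ℕₚ.m≤n+m _ (k ℕ.* (suc r ℕ.* suc r))) (ℕₚ.m≤m+n _ (suc r ℕ.* s)))

  term-vanish : ∀ r → N ℕ.< r → ∑ N (term r) ≈ 0#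
  term-vanish r lt = conv-≈0 N (λ s _ _ → at-> (ℕₚ.<-≤-trans lt (exponent-≥ r s)) _)

  module _ (N>0 : 0 ℕ.< N) where

    at-zero : ∀ x → at 0 x ≈ 0#
    at-zero x rewrite ≡ᵇ-<ˡ N>0 = refl

    row-vanish : (H : ℕ → ℕ → Carrier) → ∀ m → N ℕ.< m → ∑ N (λ n → at (m ℕ.* n) (H m n)) ≈ 0#
    row-vanish H m lt = conv-≈0 N (λ n _ _ → cell n)
      where
      cell : ∀ n → at (m ℕ.* n) (H m n) ≈ 0#
      cell zero = trans (reflexive (≡.cong (λ z → at z (H m 0)) (ℕₚ.*-zeroʳ m))) (at-zero _)
      cell (suc n) = at-> (ℕₚ.<-≤-trans lt (ℕₚ.m≤m*n m (suc n))) _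

    F-sum : ∑ N (λ m → ∑ N (F m))
      ≈ ∑ N (λ j → ∑ N (F (j ℕ.+ j))) + ∑ N (λ j → ∑ N (term (suc (j ℕ.+ j))))
    F-sum = trans (∑-split _ (row-vanish (λ m n → gap (b ℕ.* m) (2 ℕ.* n)))) (+-congˡ (conv-cong′ N (λ j _ → F-odd j)))

    G-sum : ∑ N (λ m → ∑ N (G m))
      ≈ ∑ N (λ j → ∑ N (F (j ℕ.+ j))) + ∑ N (λ j → ∑ N (term (suc (suc (j ℕ.+ j)))))
    G-sum = trans (∑-split _ (row-vanish (λ m n → gap (2 ℕ.* b ℕ.* n) m))) (+-cong even odd)
      where
      even : ∑ N (λ j → ∑ N (G (j ℕ.+ j))) ≈ ∑ N (λ j → ∑ N (F (j ℕ.+ j)))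
      even = trans (∑-conv N N (λ j n _ → G (j ℕ.+ j) n))
        (conv-cong′ N (λ n _ → conv-cong′ N (λ j _ → sym (F-even-G n j))))
      column : ℕ → Carrier
      column n = ∑ N (λ j → G (suc (j ℕ.+ j)) n)
      column-0 : column 0 ≈ 0#
      column-0 = conv-≈0 N (λ j _ _ → trans (reflexive (≡.cong (λ z → at z (gap (2 ℕ.* b ℕ.* 0) (suc (j ℕ.+ j)))) (ℕₚ.*-zeroʳ (suc (j ℕ.+ j))))) (at-zero _))
      column-vanish : ∀ n → N ℕ.< n → column n ≈ 0#
      column-vanish n lt = conv-≈0 N (λ j _ _ → at-> (ℕₚ.<-≤-trans lt (ℕₚ.m≤n*m n (suc (j ℕ.+ j)))) _)
      odd : ∑ N (λ j → ∑ N (G (suc (j ℕ.+ j)))) ≈ ∑ N (λ j → ∑ N (term (suc (suc (j ℕ.+ j)))))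
      odd = begin
        ∑ N (λ j → ∑ N (G (suc (j ℕ.+ j))))    ≈⟨ ∑-conv N N (λ j n _ → G (suc (j ℕ.+ j)) n) ⟩
        ∑ N column                              ≈⟨ sym (∑-extend N (suc N) column (ℕₚ.n≤1+n N) column-vanish) ⟩
        column 0 + ∑ N (λ n → column (suc n))   ≈⟨ trans (+-congʳ column-0) (+-identityˡ _) ⟩
        ∑ N (λ n → column (suc n))              ≈⟨ conv-cong′ N (λ n _ → G-odd n) ⟩
        ∑ N (λ j → ∑ N (term (suc (suc (j ℕ.+ j))))) ∎

    rank-sum : ∑ N (λ r → signed r (∑ N (term (suc r))))
      ≈ ∑ N (λ j → ∑ N (term (suc (j ℕ.+ j)))) - ∑ N (λ j → ∑ N (term (suc (suc (j ℕ.+ j)))))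
    rank-sum = trans
      (∑-split _ (λ r lt → signed-≈0 r (term-vanish (suc r) (ℕₚ.m≤n⇒m≤1+n lt))))
      (+-cong (conv-cong′ N (λ j _ → signed-even j _))
        (trans (conv-cong′ N (λ j _ → signed-odd j _)) (∑-neg N (λ j → ∑ N (term (suc (suc (j ℕ.+ j))))))))

    -- The lattice points with m even cancel under (m, n) ↦ (2n, m/2); those with m odd give
    -- the odd and the even r respectively.
    lattice-sum : ∑ N (λ m → ∑ N (λ n → at (m ℕ.* n) (gap (b ℕ.* m) (2 ℕ.* n) - gap (2 ℕ.* b ℕ.* n) m)))
      ≈ ∑ N (λ r → signed r (∑ N (term (suc r))))
    lattice-sum = begin
      _ ≈⟨ conv-cong′ N (λ m _ → trans (conv-cong′ N (λ n _ → at-- (m ℕ.* n) _ _)) (∑-- N (F m) (G m))) ⟩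
      ∑ N (λ m → ∑ N (F m) - ∑ N (G m))      ≈⟨ ∑-- N _ _ ⟩
      ∑ N (λ m → ∑ N (F m)) - ∑ N (λ m → ∑ N (G m)) ≈⟨ +-cong F-sum (-‿cong G-sum) ⟩
      _ ≈⟨ solve 3 (λ a b c → (a :+ b) :- (a :+ c) := b :- c) refl _ _ _ ⟩
      _ ≈⟨ sym rank-sum ⟩
      ∑ N (λ r → signed r (∑ N (term (suc r)))) ∎

-- The rank generating function modulo q^(N+1)

module ℚSum where
  open Convolution ℚring public
  open RangeSum ℚring public

ιS : ℚ → QS
ιS c N = indic (N ≡ᵇ 0) c

shCoeff : ℕ → ℕ → ℚ
shCoeff i x = if isEven i then 0ℚ else fromℕ 2 ℚ.* ((fromℕ x ℚ.* ½) ^ℚ i ℚ.* recip (i !))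

≡ᵇ-sym : ∀ m n → (m ≡ᵇ n) ≡ (n ≡ᵇ m)
≡ᵇ-sym zero zero = ≡.refl
≡ᵇ-sym zero (suc n) = ≡.refl
≡ᵇ-sym (suc m) zero = ≡.refl
≡ᵇ-sym (suc m) (suc n) = ≡ᵇ-sym m n

sgn-suc : ∀ n → sgn (suc n) ≡ ℚ.- sgn n
sgn-suc n rewrite isEven-suc n with isEven n
... | true = ≡.refl
... | false = ≡.refl

indic-*ˡ : ∀ b x y → indic b (x ℚ.* y) ≡ x ℚ.* indic b y
indic-*ˡ true x y = ≡.refl
indic-*ˡ false x y = ≡.sym (ℚₚ.*-zeroʳ x)

triangle-double : ∀ m → triangle m ℕ.* 2 ≡ m ℕ.* suc m
triangle-double zero = ≡.refl
triangle-double (suc m) = ≡.trans (ℕₚ.*-distribʳ-+ 2 (suc m) (triangle m)) (≡.trans (≡.cong (suc m ℕ.* 2 ℕ.+_) (triangle-double m)) (eq m))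
  where
  eq : ∀ m → suc m ℕ.* 2 ℕ.+ m ℕ.* suc m ≡ suc m ℕ.* suc (suc m)
  eq = solve-∀

module _ (r : ℕ) where
  private
    b = 2 ℕ.* suc (suc r) ∸ 1

  theta-exponent⁺ : ∀ m → (b ℕ.* m ℕ.* m ℕ.+ 1 ℕ.* m) ℕ./ 2 ≡ suc r ℕ.* (m ℕ.* m) ℕ.+ triangle m
  theta-exponent⁺ m = ≡.trans (≡.cong (ℕ._/ 2) (≡.sym (≡.trans (ℕₚ.*-distribʳ-+ 2 (suc r ℕ.* (m ℕ.* m)) (triangle m))
    (≡.trans (≡.cong (suc r ℕ.* (m ℕ.* m) ℕ.* 2 ℕ.+_) (triangle-double m)) (eq r m))))) (m*n/n≡m _ 2)
    where
    eq : ∀ r m → suc r ℕ.* (m ℕ.* m) ℕ.* 2 ℕ.+ m ℕ.* suc m ≡ (suc r ℕ.+ (suc (suc r) ℕ.+ 0)) ℕ.* m ℕ.* m ℕ.+ 1 ℕ.* m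
    eq = solve-∀

  theta-exponent⁻ : ∀ j → (b ℕ.* suc j ℕ.* suc j ∸ 1 ℕ.* suc j) ℕ./ 2 ≡ suc r ℕ.* (suc j ℕ.* suc j) ℕ.+ triangle j
  theta-exponent⁻ j = ≡.trans (≡.cong (λ z → (z ∸ 1 ℕ.* suc j) ℕ./ 2) (≡.sym split))
    (≡.trans (≡.cong (ℕ._/ 2) (ℕₚ.m+n∸n≡m (e ℕ.* 2) (1 ℕ.* suc j))) (m*n/n≡m e 2))
    where
    e = suc r ℕ.* (suc j ℕ.* suc j) ℕ.+ triangle j
    eq : ∀ r j → suc r ℕ.* (suc j ℕ.* suc j) ℕ.* 2 ℕ.+ j ℕ.* suc j ℕ.+ 1 ℕ.* suc j ≡ (suc r ℕ.+ (suc (suc r) ℕ.+ 0)) ℕ.* suc j ℕ.* suc j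
    eq = solve-∀
    split : e ℕ.* 2 ℕ.+ 1 ℕ.* suc j ≡ b ℕ.* suc j ℕ.* suc j
    split = ≡.trans (≡.cong (ℕ._+ 1 ℕ.* suc j) (≡.trans (ℕₚ.*-distribʳ-+ 2 (suc r ℕ.* (suc j ℕ.* suc j)) (triangle j))
      (≡.cong (suc r ℕ.* (suc j ℕ.* suc j) ℕ.* 2 ℕ.+_) (triangle-double j)))) (eq r j)

-- (q)_∞ FG_{k+1} + θ_{1,2k+1} = 1 + 2 sinh(w/2) · rankSeries k; its outer index r stands for r + 1.
rankSeries : ℕ → BS
rankSeries k i M = ℚSum.∑ M (λ r → LS.signed r (ℚSum.∑ M (LS.term (suc r))))
  where module LS = LatticeSum ℚring (shCoeff i) k M

sh₀ : BS
sh₀ i N = ιS (½ ^ℚ i ℚ.* recip (i !)) N ℚ.- ιS ((ℚ.- ½) ^ℚ i ℚ.* recip (i !)) N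

module AtOrder (N : ℕ) where
  module QP = PowerSeries ℚring (ℕ._≤ N) ℕₚ.≤-trans
  module S = CommutativeRing QP.ring

  ι-+ : ∀ x y → ιS (x ℚ.+ y) S.≈ ιS x S.+ ιS y
  ι-+ = QP.const-+
  ι-* : ∀ x y → ιS (x ℚ.* y) S.≈ ιS x S.* ιS y
  ι-* = QP.const-*
  ι-1 : ιS 1ℚ S.≈ S.1#
  ι-1 = S.refl

  rational : ℚ-Structure QP.ring
  rational = record { ι = ιS ; ι-+ = ι-+ ; ι-* = ι-* ; ι-1 = ι-1 }

  module RA = RationalAlgebra QP.ring rational
  module Hy = Hyperbolic QP.ring rational
  module B = CommutativeRing RA.seriesRing
  module BC = Convolution RA.seriesRing
  module BR = RangeSum RA.seriesRing
  module BS′ = IntegerSolver RA.seriesRing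
  module SS = IntegerSolver QP.ring
  open BS′ using (solve; _:=_; _:+_; _:*_; _:-_; :-_; con)

  ∑-eval : ∀ n (f : ℕ → BS) i M → BR.∑ n f i M ≡ ℚSum.∑ n (λ r → f r i M)
  ∑-eval zero f i M = ≡.refl
  ∑-eval (suc n) f i M = ≡.cong (f 0 i M ℚ.+_) (∑-eval n (λ r → f (suc r)) i M)

  inverse-cancel : ∀ {u a} → u B.* a B.≈ B.1# → ∀ x y → a B.* x B.≈ a B.* y → x B.≈ y
  inverse-cancel {u} {a} ua x y e = B.trans (B.sym (undo x)) (B.trans (B.*-congˡ {x = u} e) (undo y))
    where
    undo : ∀ z → u B.* (a B.* z) B.≈ z
    undo z = B.trans (B.sym (B.*-assoc u a z)) (B.trans (B.*-congʳ {x = z} ua) (B.*-identityˡ z))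

  Q : ℕ → BS
  Q m = constB (mono m)

  Q-+ : ∀ a b → Q (a ℕ.+ b) B.≈ Q a B.* Q b
  Q-+ a b = B.trans (RA.const-cong (λ n _ → QP.monomial-* a b n)) (RA.const-* (mono a) (mono b))

  Q-vanish : ∀ n → N ℕ.< n → Q n B.≈ B.0#
  Q-vanish n lt zero _ M M≤N = QP.monomial-< n M (ℕₚ.≤-<-trans M≤N lt)
  Q-vanish n lt (suc i) _ M _ = ≡.refl

  geometric : ℤ → ℕ → ℕ → BS
  geometric σ m r = RA.E (fromℤ σ ℚ.* fromℕ r) B.* Q (m ℕ.* r)

  geometric-coeff : ∀ σ m r i M → M ℕ.≤ N → geometric σ m r i M
    ≡ indic ((m ℕ.* r) ≡ᵇ M) (fromℤ ((σ ℤ.* (+ r)) ℤ.^ i) ℚ.* recip (i !))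
  geometric-coeff σ m r i M M≤N = begin
    (RA.E c B.* Q e) i M         ≡⟨ B.*-comm (RA.E c) (Q e) i tt M M≤N ⟩
    (Q e B.* RA.E c) i M         ≡⟨ RA.const-⊠ (mono e) (RA.E c) i M M≤N ⟩
    (mono e S.* ιS x) M          ≡⟨ S.*-comm (mono e) (ιS x) M M≤N ⟩
    (ιS x S.* mono e) M          ≡⟨ QP.const-⊠ x (mono e) M ⟩
    x ℚ.* indic (M ≡ᵇ e) 1ℚ      ≡⟨ ≡.sym (indic-*ˡ (M ≡ᵇ e) x 1ℚ) ⟩
    indic (M ≡ᵇ e) (x ℚ.* 1ℚ)    ≡⟨ ≡.cong₂ indic (≡ᵇ-sym M e) (≡.trans (ℚₚ.*-identityʳ x)
      (≡.cong (ℚ._* recip (i !)) (≡.sym (≡.trans (fromℤ-^ (σ ℤ.* + r) i) (≡.cong (_^ℚ i) (fromℤ-* σ (+ r))))))) ⟩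
    _ ∎
    where
    open ≡.≡-Reasoning
    c = fromℤ σ ℚ.* fromℕ r
    e = m ℕ.* r
    x = c ^ℚ i ℚ.* recip (i !)

  geomB-∑ : ∀ σ m → geomB σ (suc m) B.≈ BR.∑ N (geometric σ (suc m))
  geomB-∑ σ m i _ M M≤N = ≡.trans (ℚSum.sum-range₀ M f) (≡.trans
    (≡.sym (ℚSum.∑-extend M N f M≤N (λ r lt → ≡.cong (λ b → indic b (fromℤ ((σ ℤ.* (+ r)) ℤ.^ i) ℚ.* recip (i !)))
       (≡ᵇ-false (λ e → ℕₚ.<-irrefl (≡.sym e) (ℕₚ.<-≤-trans lt (ℕₚ.m≤n*m r (suc m))))))))
    (≡.trans (ℚSum.conv-cong′ N (λ r _ → ≡.sym (geometric-coeff σ (suc m) r i M M≤N)))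
      (≡.sym (∑-eval N (geometric σ (suc m)) i M))))
    where
    f : ℕ → ℚ
    f r = indic ((suc m ℕ.* r) ≡ᵇ M) (fromℤ ((σ ℤ.* (+ r)) ℤ.^ i) ℚ.* recip (i !))

  geometric-0 : ∀ σ m → geometric σ m 0 B.≈ B.1#
  geometric-0 σ m = B.trans (B.*-cong (B.trans (Hy.E≡ (ℚₚ.*-zeroʳ (fromℤ σ))) RA.E-zero)
    (λ i _ M _ → ≡.cong (λ z → Q z i M) (ℕₚ.*-zeroʳ m))) (B.*-identityˡ B.1#)

  geometric-suc : ∀ σ m r → geometric σ m (suc r) B.≈ RA.E (fromℤ σ) B.* Q m B.* geometric σ m r
  geometric-suc σ m r = B.trans (B.*-cong
    (B.trans (Hy.E≡ exponent-eq) (B.sym (RA.E-+ (fromℤ σ) (fromℤ σ ℚ.* fromℕ r))))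
    (B.trans (λ i _ M _ → ≡.cong (λ z → Q z i M) (ℕₚ.*-suc m r)) (Q-+ m (m ℕ.* r))))
    (solve 4 (λ a b c d → (a :* b) :* (c :* d) := a :* c :* (b :* d)) B.refl (RA.E (fromℤ σ)) (RA.E (fromℤ σ ℚ.* fromℕ r)) (Q m) (Q (m ℕ.* r)))
    where
    exponent-eq : fromℤ σ ℚ.* fromℕ (suc r) ≡ fromℤ σ ℚ.+ fromℤ σ ℚ.* fromℕ r
    exponent-eq = ≡.trans (≡.cong (fromℤ σ ℚ.*_) (fromℕ-+ 1 r)) (≡.trans (ℚₚ.*-distribˡ-+ (fromℤ σ) 1ℚ (fromℕ r))
      (≡.cong (ℚ._+ fromℤ σ ℚ.* fromℕ r) (ℚₚ.*-identityʳ (fromℤ σ))))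

  geometric-telescope : ∀ σ m M → (B.1# B.- RA.E (fromℤ σ) B.* Q m) B.* BR.∑ M (geometric σ m) B.≈ B.1# B.- geometric σ m (suc M)
  geometric-telescope σ m zero = B.trans
    (solve 2 (λ x g → (con (+ 1) :- x) :* g := g :- x :* g) B.refl (RA.E (fromℤ σ) B.* Q m) (geometric σ m 0))
    (B.+-cong (geometric-0 σ m) (B.-‿cong (B.sym (geometric-suc σ m 0))))
  geometric-telescope σ m (suc M) = B.trans (B.*-congˡ {x = B.1# B.- x} (BR.∑-snoc M (geometric σ m)))
    (B.trans (solve 3 (λ x s g → (con (+ 1) :- x) :* (s :+ g) := (con (+ 1) :- x) :* s :+ (g :- x :* g)) B.refl x (BR.∑ M (geometric σ m)) g)
    (B.trans (B.+-cong (geometric-telescope σ m M) (B.+-congˡ {x = g} (B.-‿cong (B.sym (geometric-suc σ m (suc M))))))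
    (solve 2 (λ g h → (con (+ 1) :- g) :+ (g :- h) := con (+ 1) :- h) B.refl g (geometric σ m (suc (suc M))))))
    where
    x = RA.E (fromℤ σ) B.* Q m
    g = geometric σ m (suc M)

  geomB-inverse : ∀ σ m → (B.1# B.- RA.E (fromℤ σ) B.* Q (suc m)) B.* geomB σ (suc m) B.≈ B.1#
  geomB-inverse σ m = B.trans (B.*-congˡ {x = B.1# B.- RA.E (fromℤ σ) B.* Q (suc m)} (geomB-∑ σ m))
    (B.trans (geometric-telescope σ (suc m) N)
    (B.trans (B.+-congˡ {x = B.1#} (B.-‿cong (B.trans (B.*-congˡ {x = RA.E (fromℤ σ ℚ.* fromℕ (suc N))}
        (Q-vanish (suc m ℕ.* suc N) (ℕₚ.m≤n*m (suc N) (suc m)))) (B.zeroʳ (RA.E (fromℤ σ ℚ.* fromℕ (suc N)))))))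
      (solve 0 (con (+ 1) :- con (+ 0) := con (+ 1)) B.refl)))

  prodB-++ : ∀ xs ys → prodB (xs ++ ys) B.≈ prodB xs B.* prodB ys
  prodB-++ [] ys = B.sym (B.*-identityˡ (prodB ys))
  prodB-++ (x ∷ xs) ys = B.trans (B.*-congˡ {x = x} (prodB-++ xs ys)) (B.sym (B.*-assoc x (prodB xs) (prodB ys)))

  invPochB-suc : ∀ σ n → invPochB σ (suc n) B.≈ invPochB σ n B.* geomB σ (suc n)
  invPochB-suc σ n = B.trans (λ i _ M _ → ≡.cong (λ z → prodB z i M) (map-++ (geomB σ) (range 1 n) (suc n ∷ [])))
    (B.trans (prodB-++ (map (geomB σ) (range 1 n)) (geomB σ (suc n) ∷ []))
      (B.*-congˡ {x = invPochB σ n} (B.*-identityʳ (geomB σ (suc n)))))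

  1-mono-inverse : ∀ m → (S.1# S.- mono (suc m)) S.* geomB (+ 0) (suc m) 0 S.≈ S.1#
  1-mono-inverse m = S.trans (S.*-congʳ {x = geomB (+ 0) (suc m) 0} (S.+-congˡ {x = S.1#} (S.-‿cong
      (S.sym (S.trans (RA.⊠-coeff₀ (RA.E (fromℤ (+ 0))) (Q (suc m))) (S.trans (S.*-congʳ {x = mono (suc m)} (RA.E-0 0ℚ)) (S.*-identityˡ (mono (suc m)))))))))
    (S.trans (S.sym (RA.⊠-coeff₀ (B.1# B.- RA.E (fromℤ (+ 0)) B.* Q (suc m)) (geomB (+ 0) (suc m)))) (geomB-inverse (+ 0) m 0 tt))

  invPoch-suc : ∀ n → (S.1# S.- mono (suc n)) S.* invPoch (suc n) S.≈ invPoch n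
  invPoch-suc n = S.trans (S.*-congˡ {x = S.1# S.- mono (suc n)} (S.trans (invPochB-suc (+ 0) n 0 tt) (RA.⊠-coeff₀ (invPochB (+ 0) n) (geomB (+ 0) (suc n)))))
    (S.trans (SS.solve 3 (λ a b c → a SS.:* (b SS.:* c) SS.:= b SS.:* (a SS.:* c)) S.refl (S.1# S.- mono (suc n)) (invPoch n) (geomB (+ 0) (suc n) 0))
    (S.trans (S.*-congˡ {x = invPoch n} (1-mono-inverse n)) (S.*-identityʳ (invPoch n))))

  invPoch-stable : ∀ n M → M ℕ.≤ n → M ℕ.≤ N → invPoch n M ≡ invPoch M M
  invPoch-stable zero zero _ _ = ≡.refl
  invPoch-stable (suc n) M le M≤N with ℕₚ.m≤n⇒m<n∨m≡n le
  ... | inj₂ ≡.refl = ≡.refl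
  ... | inj₁ (s≤s M≤n) = ≡.trans (≡.sym drop) (≡.trans (invPoch-suc n M M≤N) (invPoch-stable n M M≤n M≤N))
    where
    drop : ((S.1# S.- mono (suc n)) S.* invPoch (suc n)) M ≡ invPoch (suc n) M
    drop = ≡.trans (SS.solve 2 (λ q p → (SS.con (+ 1) SS.:- q) SS.:* p SS.:= p SS.:- q SS.:* p) S.refl (mono (suc n)) (invPoch (suc n)) M M≤N)
      (≡.trans (≡.cong (λ z → invPoch (suc n) M ℚ.- z) (QP.monomial-⊠-< (suc n) (invPoch (suc n)) M (s≤s M≤n)))
        (ℚₚ.+-identityʳ (invPoch (suc n) M)))

  p : ℕ → BS
  p n = constB (invPoch n)

  1-Q : ∀ m → B.1# B.- Q m B.≈ constB (S.1# S.- mono m)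
  1-Q m zero _ _ _ = ≡.refl
  1-Q m (suc i) _ _ _ = ≡.refl

  1-Q-cancel : ∀ n x y → (B.1# B.- Q (suc n)) B.* x B.≈ (B.1# B.- Q (suc n)) B.* y → x B.≈ y
  1-Q-cancel n = inverse-cancel {u = constB (geomB (+ 0) (suc n) 0)} {a = B.1# B.- Q (suc n)} (B.trans
    (B.*-congˡ {x = constB (geomB (+ 0) (suc n) 0)} (1-Q (suc n)))
    (B.trans (B.sym (RA.const-* (geomB (+ 0) (suc n) 0) (S.1# S.- mono (suc n))))
      (RA.const-cong (S.trans (S.*-comm (geomB (+ 0) (suc n) 0) (S.1# S.- mono (suc n))) (1-mono-inverse n)))))

  p-suc : ∀ n → (B.1# B.- Q (suc n)) B.* p (suc n) B.≈ p n
  p-suc n = B.trans (B.*-congʳ {x = p (suc n)} (1-Q (suc n))) (B.trans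
    (B.sym (RA.const-* (S.1# S.- mono (suc n)) (invPoch (suc n)))) (RA.const-cong (invPoch-suc n)))

  p∞ : BS
  p∞ = constB invPochInf

  p-stable : ∀ n → N ℕ.≤ n → p n B.≈ p∞
  p-stable n N≤n = RA.const-cong (λ M M≤N → invPoch-stable n M (ℕₚ.≤-trans M≤N N≤n) M≤N)

  p∞-cancel : ∀ x y → p∞ B.* x B.≈ p∞ B.* y → x B.≈ y
  p∞-cancel x y e i _ = QP.⊠-cancelˡ invPochInf 1ℚ ≡.refl
    (S.trans (S.sym (RA.const-⊠ invPochInf x i)) (S.trans (e i tt) (RA.const-⊠ invPochInf y i)))

  pochhammer : PochhammerData RA.seriesRing
  pochhammer = record
    { Q = Q ; Q-0 = B.refl ; Q-+ = Q-+ ; 1-Q-cancel = 1-Q-cancel ; p = p ; p-0 = B.refl ; p-suc = p-suc }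

  module Ba = Bailey RA.seriesRing pochhammer
  module TB = Ba.Truncated N Q-vanish p∞ p-stable p∞-cancel

  d : ℕ → BS
  d r = geomB (+ 1) r B.* geomB (ℤ.- (+ 1)) r

  d-inverse : ∀ r → (B.1# B.- Hy.t B.* Q (suc r) B.+ Q (suc r) B.* Q (suc r)) B.* d (suc r) B.≈ B.1#
  d-inverse r = B.trans (B.*-congʳ {x = d (suc r)} factor) (B.trans
    (solve 4 (λ a b c d → (a :* b) :* (c :* d) := (a :* c) :* (b :* d)) B.refl
      (B.1# B.- RA.E 1ℚ B.* q) (B.1# B.- RA.E (ℚ.- 1ℚ) B.* q) (geomB (+ 1) (suc r)) (geomB (ℤ.- (+ 1)) (suc r)))
    (B.trans (B.*-cong (geomB-inverse (+ 1) r) (geomB-inverse (ℤ.- (+ 1)) r)) (B.*-identityˡ B.1#)))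
    where
    q = Q (suc r)
    factor : B.1# B.- Hy.t B.* q B.+ q B.* q B.≈ (B.1# B.- RA.E 1ℚ B.* q) B.* (B.1# B.- RA.E (ℚ.- 1ℚ) B.* q)
    factor = B.sym (B.trans
      (solve 3 (λ e e′ q → (con (+ 1) :- e :* q) :* (con (+ 1) :- e′ :* q) := con (+ 1) :- (e :+ e′) :* q :+ (e :* e′) :* (q :* q)) B.refl
        (RA.E 1ℚ) (RA.E (ℚ.- 1ℚ)) q)
      (B.+-congˡ {x = B.1# B.- Hy.t B.* q} (B.trans (B.*-congʳ {x = q B.* q}
        (B.trans (RA.E-+ 1ℚ (ℚ.- 1ℚ)) RA.E-zero)) (B.*-identityˡ (q B.* q)))))

  module Rk = Ba.Rank Hy.t d d-inverse

  β-invPoch : ∀ n → Rk.β n B.≈ invPochB (+ 1) n B.* invPochB (ℤ.- (+ 1)) n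
  β-invPoch zero = B.sym (B.*-identityˡ B.1#)
  β-invPoch (suc n) = B.trans (B.*-congʳ {x = d (suc n)} (β-invPoch n)) (B.trans
    (solve 4 (λ a b c d → (a :* b) :* (c :* d) := (a :* c) :* (b :* d)) B.refl
      (invPochB (+ 1) n) (invPochB (ℤ.- (+ 1)) n) (geomB (+ 1) (suc n)) (geomB (ℤ.- (+ 1)) (suc n)))
    (B.sym (B.*-cong (invPochB-suc (+ 1) n) (invPochB-suc (ℤ.- (+ 1)) n))))

  sumList-cong : ∀ {f g : ℕ → BS} (xs : List ℕ) → (∀ n → f n B.≈ g n) → BR.sumList (map f xs) B.≈ BR.sumList (map g xs)
  sumList-cong [] h = B.refl
  sumList-cong (x ∷ xs) h = B.+-cong (h x) (sumList-cong xs h)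

  constB-sumS : ∀ (f : ℕ → QS) (xs : List ℕ) → constB (sumS (map f xs)) B.≈ BR.sumList (map (λ n → constB (f n)) xs)
  constB-sumS f [] zero _ _ _ = ≡.refl
  constB-sumS f [] (suc i) _ _ _ = ≡.refl
  constB-sumS f (x ∷ xs) = B.trans (RA.const-+ (f x) (sumS (map f xs))) (B.+-congˡ {x = constB (f x)} (constB-sumS f xs))

  Hsum-truncNested : ∀ r n → constB (Hsum N r n) B.≈ TB.truncNested r n
  Hsum-truncNested zero n = B.refl
  Hsum-truncNested (suc r) n = B.trans
    (constB-sumS (λ m → mono (m ℕ.* m) S.* (invPoch (m ∸ n) S.* Hsum N r m)) (range n N))
    (sumList-cong (range n N) (λ m → B.trans (RA.const-* (mono (m ℕ.* m)) (invPoch (m ∸ n) S.* Hsum N r m))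
      (B.*-congˡ {x = Q (m ℕ.* m)} (B.trans (RA.const-* (invPoch (m ∸ n)) (Hsum N r m))
        (B.*-congˡ {x = p (m ∸ n)} (Hsum-truncNested r m))))))

  FG-truncated : ∀ k → sumB (map (λ n₁ → constB (mono (n₁ ℕ.* n₁) *S Hsum N (k ∸ 2) n₁)
                     *B (invPochB (+ 1) n₁ *B invPochB (ℤ.- (+ 1)) n₁)) (range 1 N))
    B.≈ BR.sumList (map (λ n → Q (n ℕ.* n) B.* TB.truncNested (k ∸ 2) n B.* Rk.β n) (range 1 N))
  FG-truncated k = sumList-cong (range 1 N) (λ n → B.*-cong
    (B.trans (RA.const-* (mono (n ℕ.* n)) (Hsum N (k ∸ 2) n)) (B.*-congˡ {x = Q (n ℕ.* n)} (Hsum-truncNested (k ∸ 2) n)))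
    (B.sym (β-invPoch n)))

  ε : ℕ → BS
  ε s = constB (ιS (sgn s))

  ε-suc : ∀ s → ε (suc s) B.≈ B.- ε s
  ε-suc s = B.trans (RA.const-cong (λ M _ → ≡.trans (≡.cong (indic (M ≡ᵇ 0)) (sgn-suc s)) (neg (M ≡ᵇ 0) (sgn s)))) (RA.const-neg (ιS (sgn s)))
    where
    neg : ∀ b x → indic b (ℚ.- x) ≡ ℚ.- indic b x
    neg true x = ≡.refl
    neg false x = ≡.refl

  sq-Q : ∀ s → Ba.sq s B.* Q s B.≈ ε s B.* Q (triangle s)
  sq-Q zero = B.refl
  sq-Q (suc s) = B.trans (B.*-congʳ {x = Q (suc s)} (B.-‿cong (B.trans (B.*-comm (Q s) (Ba.sq s)) (sq-Q s))))
    (B.trans (solve 3 (λ e t q → :- (e :* t) :* q := (:- e) :* (q :* t)) B.refl (ε s) (Q (triangle s)) (Q (suc s)))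
      (B.*-cong (B.sym (ε-suc s)) (B.sym (Q-+ (suc s) (triangle s)))))

  sq-suc : ∀ s → Ba.sq (suc s) B.≈ ε (suc s) B.* Q (triangle s)
  sq-suc s = B.trans (B.-‿cong (B.trans (B.*-comm (Q s) (Ba.sq s)) (sq-Q s)))
    (B.trans (solve 2 (λ e t → :- (e :* t) := (:- e) :* t) B.refl (ε s) (Q (triangle s)))
      (B.*-congʳ {x = Q (triangle s)} (B.sym (ε-suc s))))

  signedMono : ℕ → ℕ → QS
  signedMono s e M = indic (e ≡ᵇ M) (sgn s)

  ε-Q : ∀ s e → constB (signedMono s e) B.≈ ε s B.* Q e
  ε-Q s e = B.trans (RA.const-cong (λ M _ → ≡.sym (≡.trans (QP.const-⊠ (sgn s) (mono e) M)
    (≡.trans (≡.sym (indic-*ˡ (M ≡ᵇ e) (sgn s) 1ℚ)) (≡.cong₂ indic (≡ᵇ-sym M e) (ℚₚ.*-identityʳ (sgn s)))))))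
    (RA.const-* (ιS (sgn s)) (mono e))

  module _ (r : ℕ) where
    private
      K = suc r
      e⁺ e⁻ : ℕ → ℕ
      e⁺ s = K ℕ.* (s ℕ.* s) ℕ.+ triangle s
      e⁻ j = K ℕ.* (suc j ℕ.* suc j) ℕ.+ triangle j
      f a c : ℕ → BS
      f s = Q (K ℕ.* (s ℕ.* s)) B.* Ba.α⁰ s
      a s = constB (signedMono s (e⁺ s))
      c j = constB (signedMono (suc j) (e⁻ j))

      e⁺-≥ : ∀ s → s ℕ.≤ e⁺ s
      e⁺-≥ s = ℕₚ.≤-trans (TB.n≤n² s) (ℕₚ.≤-trans (ℕₚ.m≤n*m (s ℕ.* s) K) (ℕₚ.m≤m+n _ (triangle s)))

      e⁻-≥ : ∀ j → suc j ℕ.≤ e⁻ j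
      e⁻-≥ j = ℕₚ.≤-trans (TB.n≤n² (suc j)) (ℕₚ.≤-trans (ℕₚ.m≤n*m (suc j ℕ.* suc j) K) (ℕₚ.m≤m+n _ (triangle j)))

      signedMono-vanish : ∀ s {e M} → M ℕ.< e → signedMono s e M ≡ 0ℚ
      signedMono-vanish s {e} {M} lt = ≡.cong (λ z → indic z (sgn s)) (≡.trans (≡ᵇ-sym e M) (≡ᵇ-<ˡ lt))

      f-suc : ∀ j → f (suc j) B.≈ a (suc j) B.+ c j
      f-suc j = B.trans (solve 3 (λ x s q → x :* (s :* (con (+ 1) :+ q)) := x :* (s :* q) :+ x :* s) B.refl
          (Q (K ℕ.* (suc j ℕ.* suc j))) (Ba.sq (suc j)) (Q (suc j)))
        (B.+-cong
          (B.trans (B.*-congˡ {x = Q (K ℕ.* (suc j ℕ.* suc j))} (sq-Q (suc j))) (part (triangle (suc j))))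
          (B.trans (B.*-congˡ {x = Q (K ℕ.* (suc j ℕ.* suc j))} (sq-suc j)) (part (triangle j))))
        where
        part : ∀ t → Q (K ℕ.* (suc j ℕ.* suc j)) B.* (ε (suc j) B.* Q t) B.≈ constB (signedMono (suc j) (K ℕ.* (suc j ℕ.* suc j) ℕ.+ t))
        part t = B.trans (solve 3 (λ x e t → x :* (e :* t) := e :* (x :* t)) B.refl (Q (K ℕ.* (suc j ℕ.* suc j))) (ε (suc j)) (Q t))
          (B.trans (B.*-congˡ {x = ε (suc j)} (B.sym (Q-+ (K ℕ.* (suc j ℕ.* suc j)) t))) (B.sym (ε-Q (suc j) (K ℕ.* (suc j ℕ.* suc j) ℕ.+ t))))

      f-0 : f 0 B.≈ a 0
      f-0 = B.trans (B.*-identityʳ (Q (K ℕ.* 0))) (B.trans (B.trans (Q≡ (≡.sym (ℕₚ.+-identityʳ (K ℕ.* 0))))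
          (B.sym (B.*-identityˡ (Q (e⁺ 0))))) (B.sym (ε-Q 0 (e⁺ 0))))
        where
        Q≡ : ∀ {m n} → m ≡ n → Q m B.≈ Q n
        Q≡ ≡.refl = B.refl

      a-vanish : ∀ s → N ℕ.< s → a s B.≈ B.0#
      a-vanish s lt zero _ M M≤N = signedMono-vanish s (ℕₚ.<-≤-trans (ℕₚ.≤-<-trans M≤N lt) (e⁺-≥ s))
      a-vanish s lt (suc i) _ M M≤N = ≡.refl

      f-vanish : ∀ s → N ℕ.< s → f s B.≈ B.0#
      f-vanish s lt = B.trans (B.*-congʳ {x = Ba.α⁰ s} (TB.Q²-vanish r s lt)) (B.zeroˡ (Ba.α⁰ s))

      f-sum : BR.∑ N f B.≈ BR.∑ N a B.+ BR.∑ N c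
      f-sum = B.trans (B.sym (BR.∑-extend N (suc N) f (ℕₚ.n≤1+n N) f-vanish))
        (B.trans (B.+-cong f-0 (B.trans (BC.conv-cong′ N (λ j _ → f-suc j)) (BC.conv-+ N (λ j _ → a (suc j)) (λ j _ → c j))))
        (B.trans (B.sym (B.+-assoc (a 0) (BR.∑ N (λ j → a (suc j))) (BR.∑ N c)))
          (B.+-congʳ {x = BR.∑ N c} (BR.∑-extend N (suc N) a (ℕₚ.n≤1+n N) a-vanish))))

    theta-plus : ∀ M → M ℕ.≤ N → sumℚ (map (λ m → indic ((((2 ℕ.* suc (suc r) ∸ 1) ℕ.* m ℕ.* m ℕ.+ 1 ℕ.* m) ℕ./ 2) ≡ᵇ M) (sgn m)) (range 0 M))
      ≡ ℚSum.∑ N (λ s → signedMono s (e⁺ s) M)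
    theta-plus M M≤N = ≡.trans (ℚSum.sum-range₀ M g)
      (≡.trans (ℚSum.conv-cong′ M {F = λ m _ → g m} {G = λ s _ → signedMono s (e⁺ s) M} (λ m _ → ≡.cong (λ z → indic (z ≡ᵇ M) (sgn m)) (theta-exponent⁺ r m)))
      (≡.sym (ℚSum.∑-extend M N (λ s → signedMono s (e⁺ s) M) M≤N (λ s lt → signedMono-vanish s (ℕₚ.<-≤-trans lt (e⁺-≥ s))))))
      where
      g : ℕ → ℚ
      g m = indic ((((2 ℕ.* suc (suc r) ∸ 1) ℕ.* m ℕ.* m ℕ.+ 1 ℕ.* m) ℕ./ 2) ≡ᵇ M) (sgn m)

    theta-minus : ∀ M → M ℕ.≤ N → sumℚ (map (λ m → indic ((((2 ℕ.* suc (suc r) ∸ 1) ℕ.* m ℕ.* m ∸ 1 ℕ.* m) ℕ./ 2) ≡ᵇ M) (sgn m)) (range 1 M))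
      ≡ ℚSum.∑ N (λ j → signedMono (suc j) (e⁻ j) M)
    theta-minus zero M≤N = ≡.sym (ℚSum.conv-≈0 N (λ j _ _ → signedMono-vanish (suc j) (ℕₚ.<-≤-trans (s≤s z≤n) (e⁻-≥ j))))
    theta-minus (suc M) M≤N = ≡.trans (ℚSum.sum-range 1 M g)
      (≡.trans (ℚSum.conv-cong′ M {F = λ m _ → g (suc m)} {G = λ j _ → signedMono (suc j) (e⁻ j) (suc M)} (λ m _ → ≡.cong (λ z → indic (z ≡ᵇ suc M) (sgn (suc m))) (theta-exponent⁻ r m)))
      (≡.sym (ℚSum.∑-extend M N (λ j → signedMono (suc j) (e⁻ j) (suc M)) (ℕₚ.≤-trans (ℕₚ.n≤1+n M) M≤N) (λ s lt → signedMono-vanish (suc s) (ℕₚ.≤-trans (s≤s lt) (e⁻-≥ s))))))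
      where
      g : ℕ → ℚ
      g m = indic ((((2 ℕ.* suc (suc r) ∸ 1) ℕ.* m ℕ.* m ∸ 1 ℕ.* m) ℕ./ 2) ≡ᵇ suc M) (sgn m)

    theta-α⁰ : constB (theta 1 (2 ℕ.* suc (suc r) ∸ 1)) B.≈ BR.∑ N f
    theta-α⁰ = B.trans expand (B.sym f-sum)
      where
      value : ∀ i M → M ℕ.≤ N → constB (theta 1 (2 ℕ.* suc (suc r) ∸ 1)) i M ≡ ℚSum.∑ N (λ s → a s i M) ℚ.+ ℚSum.∑ N (λ s → c s i M)
      value (suc i) M M≤N = ≡.sym (≡.cong₂ ℚ._+_ (ℚSum.conv-0 N) (ℚSum.conv-0 N))
      value zero M M≤N = ≡.cong₂ ℚ._+_ (theta-plus M M≤N) (theta-minus M M≤N)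
      expand : constB (theta 1 (2 ℕ.* suc (suc r) ∸ 1)) B.≈ BR.∑ N a B.+ BR.∑ N c
      expand i _ M M≤N = ≡.trans (value i M M≤N) (≡.sym (≡.cong₂ ℚ._+_ (∑-eval N a i M) (∑-eval N c i M)))

    rankSum-coeff : B.- TB.rankSum Hy.t d d-inverse Hy.sh Hy.t-sh-0 Hy.t-sh-suc Hy.2-t r B.≈ rankSeries K
    rankSum-coeff i _ M M≤N = begin
      ℚ.- BR.∑ N G i M
        ≡⟨ ≡.cong ℚ.-_ (BC.conv-cong′ N (λ r′ _ → G-∑ r′) i tt M M≤N) ⟩
      ℚ.- BR.∑ N (λ r′ → BR.∑ N (H r′)) i M
        ≡⟨ ≡.cong ℚ.-_ (≡.trans (∑-eval N (λ r′ → BR.∑ N (H r′)) i M) (ℚSum.conv-cong′ N (λ r′ _ → ∑-eval N (H r′) i M))) ⟩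
      ℚ.- ℚSum.∑ N (λ r′ → ℚSum.∑ N (λ s → H r′ s i M))
        ≡⟨ ≡.sym (LS.∑-neg N (λ r′ → ℚSum.∑ N (λ s → H r′ s i M))) ⟩
      ℚSum.∑ N (λ r′ → ℚ.- ℚSum.∑ N (λ s → H r′ s i M))
        ≡⟨ ℚSum.conv-cong′ N (λ r′ _ → row r′) ⟩
      ℚSum.∑ N (λ r′ → LS.signed r′ (ℚSum.∑ M (LS.term (suc r′))))
        ≡⟨ ℚSum.∑-extend M N (λ r′ → LS.signed r′ (ℚSum.∑ M (LS.term (suc r′)))) M≤N
             (λ r′ lt → LS.signed-≈0 r′ (LS.term-vanish (suc r′) (ℕₚ.m≤n⇒m≤1+n lt))) ⟩
      rankSeries K i M ∎
      where
      open ≡.≡-Reasoning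
      module LS = LatticeSum ℚring (shCoeff i) K M
      G : ℕ → BS
      G r′ = Q (K ℕ.* (suc r′ ℕ.* suc r′)) B.* (Ba.sq (suc r′) B.* Q (suc r′)) B.* BR.∑ N (λ s → Q (suc r′ ℕ.* s) B.* Hy.sh s)
      H : ℕ → ℕ → BS
      H r′ s = constB (signedMono (suc r′) (LS.exponent (suc r′) s)) B.* Hy.sh s
      G-∑ : ∀ r′ → G r′ B.≈ BR.∑ N (H r′)
      G-∑ r′ = B.trans (B.sym (BC.conv-*ˡ N A (λ s _ → Q (suc r′ ℕ.* s) B.* Hy.sh s))) (BC.conv-cong′ N (λ s _ →
        B.trans (B.*-congʳ {x = Q (suc r′ ℕ.* s) B.* Hy.sh s} (B.*-congˡ {x = Q x} (sq-Q (suc r′))))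
        (B.trans (solve 5 (λ x e t y h → x :* (e :* t) :* (y :* h) := e :* (x :* t :* y) :* h) B.refl
            (Q x) (ε (suc r′)) (Q (triangle (suc r′))) (Q (suc r′ ℕ.* s)) (Hy.sh s))
        (B.*-congʳ {x = Hy.sh s} (B.trans (B.*-congˡ {x = ε (suc r′)} (B.sym (B.trans (Q-+ (x ℕ.+ triangle (suc r′)) (suc r′ ℕ.* s))
            (B.*-congʳ {x = Q (suc r′ ℕ.* s)} (Q-+ x (triangle (suc r′))))))) (B.sym (ε-Q (suc r′) (LS.exponent (suc r′) s))))))))
        where
        x = K ℕ.* (suc r′ ℕ.* suc r′)
        A = Q x B.* (Ba.sq (suc r′) B.* Q (suc r′))
      cell : ∀ r′ s → H r′ s i M ≡ sgn (suc r′) ℚ.* LS.term (suc r′) s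
      cell r′ s = begin
        H r′ s i M
          ≡⟨ RA.const-⊠ (signedMono (suc r′) e) (Hy.sh s) i M M≤N ⟩
        (signedMono (suc r′) e S.* Hy.sh s i) M
          ≡⟨ S.*-congˡ {x = signedMono (suc r′) e} sh-coeff M M≤N ⟩
        (signedMono (suc r′) e S.* ιS x) M
          ≡⟨ ≡.trans (S.*-comm (signedMono (suc r′) e) (ιS x) M M≤N) (QP.const-⊠ x (signedMono (suc r′) e) M) ⟩
        x ℚ.* indic (e ≡ᵇ M) (sgn (suc r′))
          ≡⟨ ≡.trans (≡.sym (indic-*ˡ (e ≡ᵇ M) x (sgn (suc r′)))) (≡.cong (indic (e ≡ᵇ M)) (ℚₚ.*-comm x (sgn (suc r′)))) ⟩
        indic (e ≡ᵇ M) (sgn (suc r′) ℚ.* x)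
          ≡⟨ indic-*ˡ (e ≡ᵇ M) (sgn (suc r′)) x ⟩
        sgn (suc r′) ℚ.* LS.term (suc r′) s ∎
        where
        e = LS.exponent (suc r′) s
        x = shCoeff i (suc (2 ℕ.* s))
        sh-coeff : Hy.sh s i S.≈ ιS x
        sh-coeff = S.trans (Hy.Sh-coeff (oddHalf s) i) split
          where
          split : (if isEven i then S.0# else ιS (fromℕ 2 ℚ.* (oddHalf s ^ℚ i ℚ.* recip (i !)))) S.≈ ιS x
          split with isEven i
          ... | true = S.sym RA.ι-0
          ... | false = S.refl
      negate : ∀ r′ y → ℚ.- (sgn (suc r′) ℚ.* y) ≡ LS.signed r′ y
      negate r′ y rewrite sgn-suc r′ with isEven r′
      ... | true = solveℚ 1 (λ y → :-ℚ ((:-ℚ conℚ (+ 1)) :*ℚ y) :=ℚ y) ≡.refl y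
      ... | false = solveℚ 1 (λ y → :-ℚ ((:-ℚ (:-ℚ conℚ (+ 1))) :*ℚ y) :=ℚ :-ℚ y) ≡.refl y
      row : ∀ r′ → ℚ.- ℚSum.∑ N (λ s → H r′ s i M) ≡ LS.signed r′ (ℚSum.∑ M (LS.term (suc r′)))
      row r′ = ≡.trans (≡.cong ℚ.-_ (≡.trans (ℚSum.conv-cong′ N (λ s _ → cell r′ s))
          (≡.trans (ℚSum.conv-*ˡ N (sgn (suc r′)) (λ s _ → LS.term (suc r′) s))
            (≡.cong (sgn (suc r′) ℚ.*_) (ℚSum.∑-extend M N (LS.term (suc r′)) M≤N (λ s lt →
              LS.at-> {LS.exponent (suc r′) s} (ℕₚ.<-≤-trans lt (ℕₚ.≤-trans (ℕₚ.m≤n*m s (suc r′)) (ℕₚ.m≤n+m (suc r′ ℕ.* s) (K ℕ.* (suc r′ ℕ.* suc r′) ℕ.+ triangle (suc r′))))) (shCoeff i (suc (2 ℕ.* s)))))))))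
        (negate r′ (ℚSum.∑ M (LS.term (suc r′))))

    FG-truncated-identity :
      sumB (map (λ n₁ → constB (mono (n₁ ℕ.* n₁) *S Hsum N r n₁)
                     *B (invPochB (+ 1) n₁ *B invPochB (ℤ.- (+ 1)) n₁)) (range 1 N))
        B.+ constB (theta 1 (2 ℕ.* suc (suc r) ∸ 1) S.* invPochInf)
      B.≈ p∞ B.* (B.1# B.+ Hy.sh 0 B.* rankSeries K)
    FG-truncated-identity = B.trans
      (B.+-cong (FG-truncated (suc (suc r)))
          (B.trans (RA.const-* Θ invPochInf)
            (B.trans (B.*-comm (constB Θ) p∞) (B.*-congˡ {x = p∞} theta-α⁰))))
      (B.trans (TB.garvan-rank Hy.t d d-inverse r)
        (B.*-congˡ {x = p∞} (B.trans
          (TB.α-sum Hy.t d d-inverse Hy.sh Hy.t-sh-0 Hy.t-sh-suc Hy.2-t r)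
          (B.+-congˡ {x = B.1#} (B.*-congˡ {x = Hy.sh 0} rankSum-coeff)))))
      where
      Θ = theta 1 (2 ℕ.* suc (suc r) ∸ 1)
      rank = BR.sumList (map (λ n → Q (n ℕ.* n) B.* TB.truncNested r n B.* Rk.β n) (range 1 N))
      g : ℕ → BS
      g s = Q (K ℕ.* (s ℕ.* s)) B.* Rk.α s
      Y = B.- TB.rankSum Hy.t d d-inverse Hy.sh Hy.t-sh-0 Hy.t-sh-suc Hy.2-t r

    FG-identity : ∀ i → (FG (suc (suc r)) +B constB (theta 1 (2 ℕ.* suc (suc r) ∸ 1) *S invPochInf)) i N
      ≡ (constB invPochInf *B (oneB +B (sh₀ *B rankSeries K))) i N
    FG-identity i = FG-truncated-identity i tt N ℕₚ.≤-refl

module _ where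
  open ≡.≡-Reasoning

  ≤ᵇ-pred : ∀ x y → (+ x ℤ.≤ᵇ (+ y ℤ.- + 1)) ≡ (suc x ℕ.≤ᵇ y)
  ≤ᵇ-pred x zero = ≡.refl
  ≤ᵇ-pred zero (suc y) = ≡.refl
  ≤ᵇ-pred (suc x) (suc y) = ≡.refl

  gap-ℤ : ∀ i x y {c} → c ≡ true →
    indic ((+ x ℤ.≤ᵇ (+ y ℤ.- + 1)) ∧ c) (fromℤ ((+ y ℤ.- + x) ℤ.^ i))
    ≡ (if suc x ℕ.≤ᵇ y then fromℕ (y ∸ x) ^ℚ i else 0ℚ)
  gap-ℤ i x y ≡.refl rewrite ∧-identityʳ (+ x ℤ.≤ᵇ (+ y ℤ.- + 1)) | ≤ᵇ-pred x y with suc x ℕ.≤? y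
  ... | yes x<y rewrite ≤ᵇ-true x<y = ≡.trans (fromℤ-^ (+ y ℤ.- + x) i)
          (≡.cong (λ z → fromℤ z ^ℚ i) (≡.trans (ℤₚ.m-n≡m⊖n y x) (ℤₚ.⊖-≥ (ℕₚ.<⇒≤ x<y))))
  ... | no x≮y rewrite ≤ᵇ-false (ℕₚ.≰⇒> x≮y) = ≡.refl

  concatMap-sum : ∀ (T : ℕ → ℕ → ℚ) (ys xs : List ℕ) →
    sumℚ (concatMap (λ m → map (T m) ys) xs) ≡ sumℚ (map (λ m → sumℚ (map (T m) ys)) xs)
  concatMap-sum T ys [] = ≡.refl
  concatMap-sum T ys (x ∷ xs) = ≡.trans (ℚSum.sumList-++ (map (T x) ys) (concatMap (λ m → map (T m) ys) xs))
    (≡.cong (sumℚ (map (T x) ys) ℚ.+_) (concatMap-sum T ys xs))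

  square-sum : ∀ N (T : ℕ → ℕ → ℚ) → sumℚ (concatMap (λ m → map (T m) (range 1 (suc N))) (range 1 (suc N)))
    ≡ ℚSum.∑ N (λ m → ℚSum.∑ N (λ n → T (suc m) (suc n)))
  square-sum N T = begin
    _ ≡⟨ concatMap-sum T (range 1 (suc N)) (range 1 (suc N)) ⟩
    sumℚ (map (λ m → sumℚ (map (T m) (range 1 (suc N)))) (range 1 (suc N)))
      ≡⟨ ℚSum.sum-range 1 N (λ m → sumℚ (map (T m) (range 1 (suc N)))) ⟩
    ℚSum.∑ N (λ m → sumℚ (map (T (suc m)) (range 1 (suc N))))
      ≡⟨ ℚSum.conv-cong′ N
           (λ m _ → ℚSum.sum-range 1 N (T (suc m))) ⟩
    _ ∎

  ∑-suc² : ∀ N (T : ℕ → ℕ → ℚ) → (∀ n → T 0 n ≡ 0ℚ) → (∀ m → T m 0 ≡ 0ℚ) →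
    ℚSum.∑ (suc N) (λ m → ℚSum.∑ (suc N) (T m)) ≡ ℚSum.∑ N (λ m → ℚSum.∑ N (λ n → T (suc m) (suc n)))
  ∑-suc² N T z₁ z₂ = begin
    ℚSum.∑ (suc N) (T 0) ℚ.+ ℚSum.∑ N (λ m → T (suc m) 0 ℚ.+ ℚSum.∑ N (λ n → T (suc m) (suc n)))
      ≡⟨ ≡.cong₂ ℚ._+_ (ℚSum.conv-≈0 (suc N) (λ n _ _ → z₁ n))
           (ℚSum.conv-cong′ N
              (λ m _ → ≡.trans (≡.cong (ℚ._+ ℚSum.∑ N (λ n → T (suc m) (suc n))) (z₂ (suc m))) (ℚₚ.+-identityˡ (ℚSum.∑ N (λ n → T (suc m) (suc n)))))) ⟩
    0ℚ ℚ.+ ℚSum.∑ N (λ m → ℚSum.∑ N (λ n → T (suc m) (suc n)))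
      ≡⟨ ℚₚ.+-identityˡ _ ⟩
    _ ∎

  gConst : ℕ → ℚ
  gConst i = (1ℚ ℚ.- fromℕ (2 ℕ.^ i)) ℚ.* bernoulli (suc i) ℚ.* recip (2 ℕ.* suc i)

  gTerm : ℕ → ℕ → ℕ → ℕ → ℕ → ℚ
  gTerm β i N m n =
    indic ((m ℕ.* n) ≡ᵇ N)
      (indic (((+ β ℤ.* + m) ℤ.≤ᵇ (+ 2 ℤ.* + n ℤ.- + 1)) ∧ (+ β ℤ.≤ᵇ (+ β ℤ.* + m)))
             (fromℤ ((+ 2 ℤ.* + n ℤ.- + β ℤ.* + m) ℤ.^ i))
       ℚ.-
       indic (((+ 2 ℤ.* + β ℤ.* + n) ℤ.≤ᵇ (+ m ℤ.- + 1)) ∧ ((+ 2 ℤ.* + β) ℤ.≤ᵇ (+ 2 ℤ.* + β ℤ.* + n)))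
             (fromℤ ((+ m ℤ.- + 2 ℤ.* + β ℤ.* + n) ℤ.^ i)))

  gSum : ℕ → ℕ → ℕ → ℚ
  gSum β i N = sumℚ (concatMap (λ m → map (gTerm β i N m) (range 1 N)) (range 1 N))

  gSeries-even : ∀ β i N → isEven (suc i) ≡ true →
    gSeries (+ 2) (+ β) (suc i) N ≡ indic (N ≡ᵇ 0) (gConst i) ℚ.+ gSum β i N
  gSeries-even β i N e rewrite e = ≡.refl

  gSeries-odd : ∀ β i N → isEven (suc i) ≡ false → gSeries (+ 2) (+ β) (suc i) N ≡ 0ℚ
  gSeries-odd β i N e rewrite e = ≡.refl

  -- The coefficient of w^(i+1) in exp(2 Σ f_j w^j/j!) is prefactor i · g_(i+1).
  prefactor : ℕ → ℚ
  prefactor i = fromℕ 4 ℚ.* (½ ^ℚ suc i ℚ.* recip (i !))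

  module _ (i k N : ℕ) where
    private
      β = suc (k ℕ.+ k)
    module LS = LatticeSum ℚring (λ x → fromℕ x ^ℚ i) k N

    gTerm-lattice : ∀ m n → gTerm β i N (suc m) (suc n)
      ≡ LS.at (suc m ℕ.* suc n) (LS.gap (β ℕ.* suc m) (2 ℕ.* suc n) ℚ.- LS.gap (2 ℕ.* β ℕ.* suc n) (suc m))
    gTerm-lattice m n rewrite ≡.sym (ℤₚ.pos-* β (suc m)) | ≡.sym (ℤₚ.pos-* 2 (suc n)) | ≡.sym (ℤₚ.pos-* 2 β) | ≡.sym (ℤₚ.pos-* (2 ℕ.* β) (suc n)) =
      ≡.cong (LS.at (suc m ℕ.* suc n)) (≡.cong₂ ℚ._-_
        (gap-ℤ i (β ℕ.* suc m) (2 ℕ.* suc n) (≤ᵇ-true (ℕₚ.m≤m*n β (suc m))))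
        (gap-ℤ i (2 ℕ.* β ℕ.* suc n) (suc m) (≤ᵇ-true (ℕₚ.m≤m*n (2 ℕ.* β) (suc n)))))

  shCoeff-odd : ∀ i x → isEven i ≡ false → shCoeff i x ≡ prefactor i ℚ.* fromℕ x ^ℚ i
  shCoeff-odd i x e rewrite e = begin
    fromℕ 2 ℚ.* ((fromℕ x ℚ.* ½) ^ℚ i ℚ.* recip (i !))
      ≡⟨ ≡.cong (λ z → fromℕ 2 ℚ.* (z ℚ.* recip (i !))) (^ℚ-distrib-* (fromℕ x) ½ i) ⟩
    fromℕ 2 ℚ.* (fromℕ x ^ℚ i ℚ.* ½ ^ℚ i ℚ.* recip (i !))
      ≡⟨ solveℚ 5 (λ a b p x r → (a :*ℚ b) :*ℚ (x :*ℚ p :*ℚ r)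
            :=ℚ a :*ℚ (b :*ℚ p :*ℚ r) :*ℚ x) ≡.refl (fromℕ 4) ½ (½ ^ℚ i) (fromℕ x ^ℚ i) (recip (i !)) ⟩
    fromℕ 4 ℚ.* (½ ℚ.* ½ ^ℚ i ℚ.* recip (i !)) ℚ.* fromℕ x ^ℚ i ∎

  module _ (i k : ℕ) where
    private
      β = suc (k ℕ.+ k)

    gSum-lattice : ∀ N → gSum β i (suc N) ≡ ℚSum.∑ (suc N) (λ r → LS.signed i k (suc N) r (ℚSum.∑ (suc N) (LS.term i k (suc N) (suc r))))
    gSum-lattice N = begin
      gSum β i (suc N)
        ≡⟨ square-sum N (gTerm β i (suc N)) ⟩
      ℚSum.∑ N (λ m → ℚSum.∑ N (λ n → gTerm β i (suc N) (suc m) (suc n)))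
        ≡⟨ ℚSum.conv-cong′ N
             (λ m _ → ℚSum.conv-cong′ N
               (λ n _ → gTerm-lattice i k (suc N) m n)) ⟩
      ℚSum.∑ N (λ m → ℚSum.∑ N (λ n → T (suc m) (suc n)))
        ≡⟨ ≡.sym (∑-suc² N T (λ n → ≡.refl) (λ m → ≡.cong (λ z → L.at z (value m 0)) (ℕₚ.*-zeroʳ m))) ⟩
      ℚSum.∑ (suc N) (λ m → ℚSum.∑ (suc N) (T m))
        ≡⟨ L.lattice-sum (s≤s z≤n) ⟩
      _ ∎
      where
      module L = LS i k (suc N)
      value : ℕ → ℕ → ℚ
      value m n = L.gap (β ℕ.* m) (2 ℕ.* n) ℚ.- L.gap (2 ℕ.* β ℕ.* n) m
      T : ℕ → ℕ → ℚ
      T m n = L.at (m ℕ.* n) (value m n)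

    rankSeries-gSum : ∀ N → isEven i ≡ false → rankSeries k i N ≡ prefactor i ℚ.* gSum β i N
    rankSeries-gSum N odd = ≡.trans scale (≡.cong (prefactor i ℚ.*_) (sums N))
      where
      sums : ∀ N → ℚSum.∑ N (λ r → LS.signed i k N r (ℚSum.∑ N (LS.term i k N (suc r)))) ≡ gSum β i N
      sums zero = LS.term-vanish i k 0 1 (s≤s z≤n)
      sums (suc N) = ≡.sym (gSum-lattice N)
      module L = LS i k N
      module L′ = LatticeSum ℚring (shCoeff i) k N
      scale-term : ∀ r s → L′.term r s ≡ prefactor i ℚ.* L.term r s
      scale-term r s = ≡.trans (≡.cong (indic (L.exponent r s ≡ᵇ N)) (shCoeff-odd i (suc (2 ℕ.* s)) odd))
        (indic-*ˡ (L.exponent r s ≡ᵇ N) (prefactor i) (fromℕ (suc (2 ℕ.* s)) ^ℚ i))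
      scale-signed : ∀ r x → L.signed r (prefactor i ℚ.* x) ≡ prefactor i ℚ.* L.signed r x
      scale-signed r x with isEven r
      ... | true = ≡.refl
      ... | false = ℚₚ.neg-distribʳ-* (prefactor i) x
      scale : rankSeries k i N ≡ prefactor i ℚ.* ℚSum.∑ N (λ r → L.signed r (ℚSum.∑ N (L.term (suc r))))
      scale = ≡.trans (ℚSum.conv-cong′ N
         
          (λ r _ → ≡.trans (≡.cong (L.signed r) (≡.trans (ℚSum.conv-cong′ N (λ s _ → scale-term (suc r) s))
                (ℚSum.conv-*ˡ N (prefactor i) (λ s _ → L.term (suc r) s))))
              (scale-signed r (ℚSum.∑ N (L.term (suc r))))))
        (ℚSum.conv-*ˡ N (prefactor i) (λ r _ → L.signed r (ℚSum.∑ N (L.term (suc r)))))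

    rankSeries-even : ∀ N → isEven i ≡ true → rankSeries k i N ≡ 0ℚ
    rankSeries-even N even = ℚSum.conv-≈0 N (λ r _ _ → L′.signed-≈0 r
      (ℚSum.conv-≈0 N (λ s _ _ → ≡.trans (≡.cong (L′.at (L′.exponent (suc r) s)) (zero-coeff (suc (2 ℕ.* s)))) (L′.at-0 (L′.exponent (suc r) s)))))
      where
      module L′ = LatticeSum ℚring (shCoeff i) k N
      zero-coeff : ∀ x → shCoeff i x ≡ 0ℚ
      zero-coeff x rewrite even = ≡.refl

  ½-2^ : ∀ i → ½ ^ℚ i ℚ.* fromℕ (2 ℕ.^ i) ≡ 1ℚ
  ½-2^ i = ≡.trans (≡.cong (ℚ._* fromℕ (2 ℕ.^ i)) (½-^ i)) (≡.trans (ℚₚ.*-comm (recip (2 ℕ.^ i)) (fromℕ (2 ℕ.^ i)))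
    (fromℕ-recip′ (2 ℕ.^ i) {{ℕₚ.m^n≢0 2 i}}))

  cosecCoeff-gConst : ∀ i → cosecCoeff (suc i) ≡ prefactor i ℚ.* gConst i
  cosecCoeff-gConst i = ≡.sym (begin
    fromℕ 4 ℚ.* (½ ℚ.* h ℚ.* recip (i !)) ℚ.* ((1ℚ ℚ.- P) ℚ.* b ℚ.* recip (2 ℕ.* suc i))
      ≡⟨ ≡.cong₂ (λ x y → fromℕ 4 ℚ.* (½ ℚ.* h ℚ.* x) ℚ.* ((1ℚ ℚ.- P) ℚ.* b ℚ.* y)) (≡.sym (recip!-suc i)) (recip-* 2 (suc i)) ⟩
    fromℕ 4 ℚ.* (½ ℚ.* h ℚ.* (n ℚ.* R)) ℚ.* ((1ℚ ℚ.- P) ℚ.* b ℚ.* (½ ℚ.* recip (suc i)))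
      ≡⟨ solveℚ 9 (λ f o h n R P b s q → f :*ℚ (o :*ℚ h :*ℚ (n :*ℚ R)) :*ℚ ((q :-ℚ P) :*ℚ b :*ℚ (o :*ℚ s))
           :=ℚ (n :*ℚ s) :*ℚ (f :*ℚ o :*ℚ (o :*ℚ h) :*ℚ q :-ℚ f :*ℚ o :*ℚ o :*ℚ (h :*ℚ P)) :*ℚ (b :*ℚ R)) ≡.refl
           (fromℕ 4) ½ h n R P b (recip (suc i)) 1ℚ ⟩
    n ℚ.* recip (suc i) ℚ.* (fromℕ 2 ℚ.* (½ ℚ.* h) ℚ.* 1ℚ ℚ.- 1ℚ ℚ.* (h ℚ.* P)) ℚ.* (b ℚ.* R)
      ≡⟨ ≡.cong₂ (λ x y → x ℚ.* y ℚ.* (b ℚ.* R)) (fromℕ-recip i)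
           (≡.cong₂ (λ x y → x ℚ.- 1ℚ ℚ.* y) (ℚₚ.*-identityʳ (fromℕ 2 ℚ.* (½ ℚ.* h))) (½-2^ i)) ⟩
    1ℚ ℚ.* (fromℕ 2 ℚ.* (½ ℚ.* h) ℚ.- 1ℚ) ℚ.* (b ℚ.* R)
      ≡⟨ ≡.cong (ℚ._* (b ℚ.* R)) (ℚₚ.*-identityˡ (fromℕ 2 ℚ.* (½ ℚ.* h) ℚ.- 1ℚ)) ⟩
    cosecCoeff (suc i) ∎)
    where
    h = ½ ^ℚ i
    P = fromℕ (2 ℕ.^ i)
    b = bernoulli (suc i)
    n = fromℕ (suc i)
    R = recip (suc i !)

  rank-g-even : ∀ i k N → isEven (suc i) ≡ true →
    indic (N ≡ᵇ 0) (cosecCoeff (suc i)) ℚ.+ rankSeries k i N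
    ≡ prefactor i ℚ.* gSeries (+ 2) (+ suc (k ℕ.+ k)) (suc i) N
  rank-g-even i k N even = begin
    indic (N ≡ᵇ 0) (cosecCoeff (suc i)) ℚ.+ rankSeries k i N
      ≡⟨ ≡.cong₂ ℚ._+_ (≡.trans (≡.cong (indic (N ≡ᵇ 0)) (cosecCoeff-gConst i)) (indic-*ˡ (N ≡ᵇ 0) (prefactor i) (gConst i)))
           (rankSeries-gSum i k N (odd (isEven i) (≡.trans (≡.sym (isEven-suc i)) even))) ⟩
    prefactor i ℚ.* indic (N ≡ᵇ 0) (gConst i) ℚ.+ prefactor i ℚ.* gSum (suc (k ℕ.+ k)) i N
      ≡⟨ ≡.sym (ℚₚ.*-distribˡ-+ (prefactor i) _ _) ⟩
    prefactor i ℚ.* (indic (N ≡ᵇ 0) (gConst i) ℚ.+ gSum (suc (k ℕ.+ k)) i N)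
      ≡⟨ ≡.cong (prefactor i ℚ.*_) (≡.sym (gSeries-even (suc (k ℕ.+ k)) i N even)) ⟩
    _ ∎
    where
    odd : ∀ b → not b ≡ true → b ≡ false
    odd false _ = ≡.refl

-- Traces and recursions

sgn-+ : ∀ m n → sgn (m ℕ.+ n) ≡ sgn m ℚ.* sgn n
sgn-+ zero n = ≡.sym (ℚₚ.*-identityˡ (sgn n))
sgn-+ (suc m) n = ≡.trans (sgn-suc (m ℕ.+ n)) (≡.trans (≡.cong ℚ.-_ (sgn-+ m n))
  (≡.trans (ℚₚ.neg-distribˡ-* (sgn m) (sgn n)) (≡.cong (ℚ._* sgn n) (≡.sym (sgn-suc m)))))

partWeight : ℕ → ℕ → ℚ
partWeight m l = sgn l ℚ.* (fromℕ (2 ℕ.^ l) ℚ.* recip (l ! ℕ.* (m !) ℕ.^ l))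

psi-∷ : ∀ m l λ′ → psi ((m , l) ∷ λ′) ≡ partWeight m l ℚ.* psi λ′
psi-∷ m l λ′ = regroup l _ _ _
  where
  regroup : ∀ l X c Φ → sgn (l ℕ.+ X) ℚ.* (c ℚ.* Φ) ≡ sgn l ℚ.* c ℚ.* (sgn X ℚ.* Φ)
  regroup l X c Φ = ≡.trans (≡.cong (ℚ._* (c ℚ.* Φ)) (sgn-+ l X))
    (solveℚ 4 (λ a b c d → (a :*ℚ b) :*ℚ (c :*ℚ d) :=ℚ a :*ℚ c :*ℚ (b :*ℚ d)) ≡.refl (sgn l) (sgn X) c Φ)

partWeight-suc : ∀ m l → partWeight m (suc l) ≡ ℚ.- (fromℕ 2 ℚ.* recip (m !)) ℚ.* recip (suc l) ℚ.* partWeight m l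
partWeight-suc m l = begin
  sgn (suc l) ℚ.* (fromℕ (2 ℕ.* 2 ℕ.^ l) ℚ.* recip ((suc l ℕ.* l !) ℕ.* (m ! ℕ.* (m !) ℕ.^ l)))
    ≡⟨ ≡.cong₂ ℚ._*_ (sgn-suc l) (≡.cong₂ ℚ._*_ (fromℕ-* 2 (2 ℕ.^ l)) (≡.trans
         (recip-* (suc l ℕ.* l !) (m ! ℕ.* M) {{ℕₚ.m*n≢0 (suc l) (l !) {{_}} {{l ℕₚ.!≢0}}}} {{ℕₚ.m*n≢0 (m !) M {{m ℕₚ.!≢0}} {{nz}}}})
         (≡.cong₂ ℚ._*_ (recip-* (suc l) (l !) {{_}} {{l ℕₚ.!≢0}}) (recip-* (m !) M {{m ℕₚ.!≢0}} {{nz}})))) ⟩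
  (ℚ.- sgn l) ℚ.* (fromℕ 2 ℚ.* P ℚ.* ((recip (suc l) ℚ.* recip (l !)) ℚ.* (recip (m !) ℚ.* recip M)))
    ≡⟨ solveℚ 7 (λ s t p a b c d → (:-ℚ s) :*ℚ (t :*ℚ p :*ℚ ((a :*ℚ b) :*ℚ (c :*ℚ d)))
          :=ℚ (:-ℚ (t :*ℚ c)) :*ℚ a :*ℚ (s :*ℚ (p :*ℚ (b :*ℚ d)))) ≡.refl
          (sgn l) (fromℕ 2) P (recip (suc l)) (recip (l !)) (recip (m !)) (recip M) ⟩
  (ℚ.- (fromℕ 2 ℚ.* recip (m !))) ℚ.* recip (suc l) ℚ.* (sgn l ℚ.* (P ℚ.* (recip (l !) ℚ.* recip M)))
    ≡⟨ ≡.cong (λ z → (ℚ.- (fromℕ 2 ℚ.* recip (m !))) ℚ.* recip (suc l) ℚ.* (sgn l ℚ.* (P ℚ.* z))) (≡.sym (recip-* (l !) M {{l ℕₚ.!≢0}} {{nz}})) ⟩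
  _ ∎
  where
  open ≡.≡-Reasoning
  M = (m !) ℕ.^ l
  P = fromℕ (2 ℕ.^ l)
  nz : ℕ.NonZero M
  nz = ℕₚ.m^n≢0 (m !) l {{m ℕₚ.!≢0}}

module TraceAtOrder (N : ℕ) (f : ℕ → QS) where
  open AtOrder N
  module SR = RangeSum QP.ring
  module SC = Convolution QP.ring
  open Power QP.ring

  scaleS-ι : ∀ c a → scaleS c a S.≈ ιS c S.* a
  scaleS-ι c a M _ = ≡.sym (QP.const-⊠ c a M)

  y : ℕ → QS
  y m = S.- scaleS (fromℕ 2 ℚ.* recip (m !)) (f m)

  module PT = RA.PartitionSeries y

  weight : List (ℕ × ℕ) → QS
  weight λ′ = scaleS (psi λ′) (fLam f λ′)

  part-power : ∀ m l → ιS (partWeight m l) S.* powS (f m) l S.≈ RA.κ l S.* pow (y m) l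
  part-power m zero = S.refl {x = S.1# S.* S.1#}
  part-power m (suc l) = S.trans
   
    (S.*-congʳ {x = f m S.* powS (f m) l} (S.trans (λ M _ → ≡.cong (λ z → ιS z M) (partWeight-suc m l)) (ι-* (a ℚ.* recip (suc l)) (partWeight m l))))
    (S.trans
      (S.trans
        (S.*-congʳ {x = f m S.* powS (f m) l} (S.*-congʳ {x = ιS (partWeight m l)} (ι-* a (recip (suc l)))))
        (SS.solve 5 (λ a r w f p → a SS.:* r SS.:* w SS.:* (f SS.:* p) SS.:= a SS.:* f SS.:* (r SS.:* (w SS.:* p))) S.refl
          (ιS a) (ιS (recip (suc l))) (ιS (partWeight m l)) (f m) (powS (f m) l)))
      (S.trans
        (S.*-cong {x = ιS a S.* f m} {u = ιS (recip (suc l)) S.* (ιS (partWeight m l) S.* powS (f m) l)} neg (S.*-congˡ {x = ιS (recip (suc l))} (part-power m l)))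
        (S.trans
          (SS.solve 4 (λ y r k p → y SS.:* (r SS.:* (k SS.:* p)) SS.:= (r SS.:* k) SS.:* (y SS.:* p)) S.refl (y m) (ιS (recip (suc l))) (RA.κ l) (pow (y m) l))
          (S.*-congʳ {x = y m S.* pow (y m) l} (S.trans (S.sym (ι-* (recip (suc l)) (recip (l !))))
            (λ M _ → ≡.cong (λ z → ιS z M) (≡.sym (recip-* (suc l) (l !) {{_}} {{l ℕₚ.!≢0}}))))))))
    where
    a = ℚ.- (fromℕ 2 ℚ.* recip (m !))
    neg : ιS a S.* f m S.≈ y m
    neg = S.trans (S.sym (scaleS-ι a (f m))) (λ M _ → ≡.sym (ℚₚ.neg-distribˡ-* (fromℕ 2 ℚ.* recip (m !)) (f m M)))

  weight-∷ : ∀ m l λ′ → weight ((m , l) ∷ λ′) S.≈ RA.κ l S.* pow (y m) l S.* weight λ′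
  weight-∷ m l λ′ = S.trans (scaleS-ι (psi ((m , l) ∷ λ′)) (fLam f ((m , l) ∷ λ′)))
    (S.trans
      (S.*-congʳ {x = powS (f m) l S.* fLam f λ′} (S.trans (λ M _ → ≡.cong (λ z → ιS z M) (psi-∷ m l λ′)) (ι-* (partWeight m l) (psi λ′))))
      (S.trans
        (SS.solve 4 (λ a b c d → a SS.:* b SS.:* (c SS.:* d) SS.:= a SS.:* c SS.:* (b SS.:* d)) S.refl (ιS (partWeight m l)) (ιS (psi λ′)) (powS (f m) l) (fLam f λ′))
        (S.*-cong {x = ιS (partWeight m l) S.* powS (f m) l} {u = ιS (psi λ′) S.* fLam f λ′} (part-power m l) (S.sym (scaleS-ι (psi λ′) (fLam f λ′))))))

  sum-weight-∷ : ∀ m l ps → sumS (map weight (map ((m , l) ∷_) ps)) S.≈ RA.κ l S.* pow (y m) l S.* sumS (map weight ps)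
  sum-weight-∷ m l [] = S.sym (S.zeroʳ (RA.κ l S.* pow (y m) l))
  sum-weight-∷ m l (λ′ ∷ ps) = S.trans
    (S.+-cong {x = weight ((m , l) ∷ λ′)} {u = sumS (map weight (map ((m , l) ∷_) ps))} (weight-∷ m l λ′) (sum-weight-∷ m l ps))
    (S.sym (S.distribˡ A (weight λ′) (sumS (map weight ps))))
    where A = RA.κ l S.* pow (y m) l

  sum-concatMap : ∀ (F : ℕ → List (List (ℕ × ℕ))) xs → sumS (map weight (concatMap F xs)) S.≈ sumS (map (λ c → sumS (map weight (F c))) xs)
  sum-concatMap F [] = S.refl {x = S.0#}
  sum-concatMap F (x ∷ xs) = S.trans
    (S.trans (λ M _ → ≡.cong (λ z → sumS z M) (map-++ weight (F x) (concatMap F xs)))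
      (SR.sumList-++ (map weight (F x)) (map weight (concatMap F xs))))
    (S.+-congˡ {x = sumS (map weight (F x))} (sum-concatMap F xs))

  parts-series : ∀ m r → sumS (map weight (partsAux m r)) S.≈ PT.partitionSeries m r
  parts-series zero zero = λ M _ → ≡.trans (ℚₚ.+-identityʳ (1ℚ ℚ.* oneS M)) (ℚₚ.*-identityˡ (oneS M))
  parts-series zero (suc r) = S.refl {x = S.0#}
  parts-series (suc m) r = S.trans (sum-concatMap F (range 0 r))
    (S.trans (SR.sum-range₀ r (λ c → sumS (map weight (F c))))
    (S.trans (SC.conv-cong′ r (λ c _ → term c))
      (S.sym {x = PT.partitionSeries (suc m) r} (PT.partitionSeries-suc m r))))
    where
    F : ℕ → List (List (ℕ × ℕ))
    F c = if (suc m ℕ.* c) ℕ.≤ᵇ r then map ((suc m , c) ∷_) (partsAux m (r ∸ suc m ℕ.* c)) else []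
    G : ℕ → QS
    G c = if suc m ℕ.* c ℕ.≤ᵇ r then RA.κ c S.* pow (y (suc m)) c S.* PT.partitionSeries m (r ∸ suc m ℕ.* c) else S.0#
    term : ∀ c → sumS (map weight (F c)) S.≈ G c
    term c with suc m ℕ.* c ℕ.≤ᵇ r
    ... | false = S.refl {x = S.0#}
    ... | true = S.trans
      (sum-weight-∷ (suc m) c (partsAux m (r ∸ suc m ℕ.* c)))
      (S.*-congˡ {x = A} (parts-series m (r ∸ suc m ℕ.* c)))
      where A = RA.κ c S.* pow (y (suc m)) c

  Tr-series : ∀ n → Tr n f S.≈ PT.traceSeries n
  Tr-series n = parts-series n n

twoPowNeg-pred : ∀ i → twoPowNeg (+ suc i ℤ.- + 1) ≡ ½ ^ℚ i
twoPowNeg-pred i = ≡.sym (½-^ i)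

twoPowNeg-diff : ∀ ℓ l → twoPowNeg (+ (ℓ ℕ.+ suc l) ℤ.- + ℓ ℤ.- + 2) ≡ fromℕ 4 ℚ.* ½ ^ℚ suc l
twoPowNeg-diff ℓ l = ≡.trans (≡.cong (λ z → twoPowNeg (z ℤ.- + 2)) difference) (value l)
  where
  difference : + (ℓ ℕ.+ suc l) ℤ.- + ℓ ≡ + suc l
  difference = ≡.trans (ℤₚ.m-n≡m⊖n (ℓ ℕ.+ suc l) ℓ) (≡.trans (ℤₚ.⊖-≥ (ℕₚ.m≤m+n ℓ (suc l))) (≡.cong +_ (ℕₚ.m+n∸m≡n ℓ (suc l))))
  value : ∀ l → twoPowNeg (+ suc l ℤ.- + 2) ≡ fromℕ 4 ℚ.* ½ ^ℚ suc l
  value zero = ≡.refl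
  value (suc l) = ≡.trans (≡.sym (½-^ l)) (≡.trans (≡.sym (ℚₚ.*-identityˡ (½ ^ℚ l)))
    (solveℚ 3 (λ f o h → f :*ℚ o :*ℚ o :*ℚ h :=ℚ f :*ℚ (o :*ℚ (o :*ℚ h))) ≡.refl (fromℕ 4) ½ (½ ^ℚ l)))

-- i! / 2 turns the coefficient of w^(i+1) in w d/dw (2 Σ f_j w^j/j!) into f_(i+1).
halfFactorial : ℕ → ℚ
halfFactorial i = ½ ℚ.* fromℕ (i !)

fromℕ!-recip : ∀ i → fromℕ (i !) ℚ.* recip (i !) ≡ 1ℚ
fromℕ!-recip i = fromℕ-recip′ (i !) {{i ℕₚ.!≢0}}

halfFactorial-f : ∀ i → halfFactorial i ℚ.* (fromℕ (suc i) ℚ.* (fromℕ 2 ℚ.* recip (suc i !))) ≡ 1ℚ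
halfFactorial-f i = begin
  ½ ℚ.* F ℚ.* (fromℕ (suc i) ℚ.* (fromℕ 2 ℚ.* recip (suc i !)))
    ≡⟨ solveℚ 5 (λ o F n t r → o :*ℚ F :*ℚ (n :*ℚ (t :*ℚ r)) :=ℚ (o :*ℚ t) :*ℚ (F :*ℚ (n :*ℚ r))) ≡.refl ½ F (fromℕ (suc i)) (fromℕ 2) (recip (suc i !)) ⟩
  1ℚ ℚ.* (F ℚ.* (fromℕ (suc i) ℚ.* recip (suc i !)))
    ≡⟨ ≡.trans (ℚₚ.*-identityˡ _) (≡.cong (F ℚ.*_) (recip!-suc i)) ⟩
  F ℚ.* recip (i !) ≡⟨ fromℕ!-recip i ⟩
  1ℚ ∎
  where
  open ≡.≡-Reasoning
  F = fromℕ (i !)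

halfFactorial-g : ∀ i ℓ → halfFactorial i ℚ.* (fromℕ (suc ℓ) ℚ.* prefactor ℓ)
  ≡ fromℕ (suc ℓ) ℚ.* twoPowNeg (+ suc ℓ ℤ.- + 1) ℚ.* (fromℕ (i !) ℚ.* recip (ℓ !))
halfFactorial-g i ℓ = begin
  ½ ℚ.* F ℚ.* (n ℚ.* (fromℕ 4 ℚ.* (½ ℚ.* h ℚ.* R)))
    ≡⟨ solveℚ 6 (λ o F n f h R → o :*ℚ F :*ℚ (n :*ℚ (f :*ℚ (o :*ℚ h :*ℚ R)))
         :=ℚ (o :*ℚ f :*ℚ o) :*ℚ (n :*ℚ h :*ℚ (F :*ℚ R))) ≡.refl ½ F n (fromℕ 4) h R ⟩
  1ℚ ℚ.* (n ℚ.* h ℚ.* (F ℚ.* R))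
    ≡⟨ ≡.trans (ℚₚ.*-identityˡ _) (≡.cong (λ z → n ℚ.* z ℚ.* (F ℚ.* R)) (≡.sym (twoPowNeg-pred ℓ))) ⟩
  _ ∎
  where
  open ≡.≡-Reasoning
  F = fromℕ (i !)
  n = fromℕ (suc ℓ)
  h = ½ ^ℚ ℓ
  R = recip (ℓ !)

halfFactorial-fg : ∀ j l → let i = j ℕ.+ suc l in
  halfFactorial i ℚ.* (fromℕ (suc j) ℚ.* (fromℕ 2 ℚ.* recip (suc j !)) ℚ.* prefactor l)
  ≡ fromℕ (i C j) ℚ.* fromℕ (suc l) ℚ.* twoPowNeg (+ suc i ℤ.- + suc j ℤ.- + 2)
halfFactorial-fg j l = begin
  ½ ℚ.* F ℚ.* (fromℕ (suc j) ℚ.* (fromℕ 2 ℚ.* recip (suc j !)) ℚ.* (fromℕ 4 ℚ.* (h ℚ.* R)))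
    ≡⟨ solveℚ 8 (λ o F n t r f h R → o :*ℚ F :*ℚ (n :*ℚ (t :*ℚ r) :*ℚ (f :*ℚ (h :*ℚ R)))
         :=ℚ (o :*ℚ t) :*ℚ F :*ℚ ((n :*ℚ r) :*ℚ R) :*ℚ (f :*ℚ h)) ≡.refl
         ½ F (fromℕ (suc j)) (fromℕ 2) (recip (suc j !)) (fromℕ 4) h R ⟩
  1ℚ ℚ.* F ℚ.* ((fromℕ (suc j) ℚ.* recip (suc j !)) ℚ.* R) ℚ.* p
    ≡⟨ ≡.cong₂ (λ x z → x ℚ.* z ℚ.* p) (ℚₚ.*-identityˡ F) (≡.cong₂ ℚ._*_ (recip!-suc j) (≡.sym (recip!-suc l))) ⟩
  F ℚ.* (recip (j !) ℚ.* (fromℕ (suc l) ℚ.* recip (suc l !))) ℚ.* p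
    ≡⟨ solveℚ 5 (λ F a s b p → F :*ℚ (a :*ℚ (s :*ℚ b)) :*ℚ p :=ℚ F :*ℚ (a :*ℚ b) :*ℚ (s :*ℚ p)) ≡.refl F (recip (j !)) (fromℕ (suc l)) (recip (suc l !)) p ⟩
  F ℚ.* (recip (j !) ℚ.* recip (suc l !)) ℚ.* (fromℕ (suc l) ℚ.* p)
    ≡⟨ ≡.cong (λ z → F ℚ.* z ℚ.* (fromℕ (suc l) ℚ.* p)) (≡.sym (binomial-recip j (suc l))) ⟩
  F ℚ.* (B ℚ.* recip (i !)) ℚ.* (fromℕ (suc l) ℚ.* p)
    ≡⟨ solveℚ 5 (λ F B r s p → F :*ℚ (B :*ℚ r) :*ℚ (s :*ℚ p) :=ℚ (F :*ℚ r) :*ℚ (B :*ℚ s :*ℚ p)) ≡.refl F B (recip (i !)) (fromℕ (suc l)) p ⟩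
  F ℚ.* recip (i !) ℚ.* (B ℚ.* fromℕ (suc l) ℚ.* p)
    ≡⟨ ≡.trans (≡.cong (ℚ._* (B ℚ.* fromℕ (suc l) ℚ.* p)) (fromℕ!-recip i)) (ℚₚ.*-identityˡ (B ℚ.* fromℕ (suc l) ℚ.* p)) ⟩
  B ℚ.* fromℕ (suc l) ℚ.* p
    ≡⟨ ≡.cong (B ℚ.* fromℕ (suc l) ℚ.*_) (≡.sym (twoPowNeg-diff (suc j) l)) ⟩
  _ ∎
  where
  open ≡.≡-Reasoning
  i = j ℕ.+ suc l
  F = fromℕ (i !)
  h = ½ ^ℚ suc l
  p = fromℕ 4 ℚ.* h
  R = recip (l !)
  B = fromℕ (i C j)

module Recursions (r : ℕ) (f : ℕ → QS) (isFk : IsFk (suc (suc r)) f) (N : ℕ) where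
  open AtOrder N
  open TraceAtOrder N f
  open BS′ using (solve; _:=_; _:+_; _:*_; _:-_; :-_; con)
  private
    k = suc (suc r)
    Y F X T : BS
    Y = rankSeries (suc r)
    F = expArg f
    X = expB F
    T = PT.traceSeries

  product-identity : p∞ B.* (B.1# B.+ Hy.sh 0 B.* Y) B.≈ sincB B.* (p∞ B.* X)
  product-identity i _ M M≤N = ≡.trans (≡.sym (AtOrder.FG-identity M r i)) (isFk i M)

  sincB-sinc : sincB B.≈ Hy.sinc
  sincB-sinc i _ with isEven i
  ... | true = λ M _ → ≡.trans (≡.sym (indic-*ˡ (M ≡ᵇ 0) c 1ℚ)) (≡.cong (indic (M ≡ᵇ 0)) (ℚₚ.*-identityʳ c))
    where c = recip (2 ℕ.^ i ℕ.* suc i !)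
  ... | false = λ M _ → ≡.refl

  sinc-X : B.1# B.+ Hy.sh 0 B.* Y B.≈ Hy.sinc B.* X
  sinc-X = p∞-cancel (B.1# B.+ Hy.sh 0 B.* Y) (Hy.sinc B.* X)
    (B.trans product-identity
    (B.trans (B.*-congʳ {x = p∞ B.* X} sincB-sinc)
      (solve 3 (λ s p x → s :* (p :* x) := p :* (s :* x)) B.refl Hy.sinc p∞ X)))

  w : BS
  w = RA.monomial 1

  X-formula : X B.≈ Hy.cosecSeries B.+ w B.* Y
  X-formula = Hy.sinc-cancel {X} {Z} (Hy.w-cancel {Hy.sinc B.* X} {Hy.sinc B.* Z}
    (B.trans (B.*-congˡ {x = w} (B.sym sinc-X))
    (B.trans
      (solve 3 (λ w s y → w :* (con (+ 1) :+ s :* y) := w :+ s :* (w :* y)) B.refl w (Hy.sh 0) Y)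
    (B.trans (B.+-congʳ {x = Hy.sh 0 B.* (w B.* Y)} (B.sym Hy.sh-cosec))
    (B.trans (B.sym (B.distribˡ (Hy.sh 0) Hy.cosecSeries (w B.* Y)))
    (B.trans (B.*-congʳ {x = Z} (B.sym Hy.sinc-sh)) (B.*-assoc w Hy.sinc Z)))))))
    where
    Z : BS
    Z = Hy.cosecSeries B.+ w B.* Y

  g : ℕ → QS
  g = gk k

  X-suc : ∀ i → X (suc i) S.≈ ιS (prefactor i) S.* g (suc i)
  X-suc i = S.trans (S.trans (X-formula (suc i) tt)
      (S.+-congˡ {x = ιS (cosecCoeff (suc i))} (RA.monomial-⊠ 1 Y i)))
    (S.trans coeff (scaleS-ι (prefactor i) (g (suc i))))
    where
    b≡ : 2 ℕ.* k ∸ 1 ≡ suc (suc r ℕ.+ suc r)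
    b≡ = eq r
      where
      eq : ∀ r → suc r ℕ.+ (suc (suc r) ℕ.+ 0) ≡ suc (suc r ℕ.+ suc r)
      eq = solve-∀
    coeff : ιS (cosecCoeff (suc i)) S.+ Y i S.≈ scaleS (prefactor i) (g (suc i))
    coeff M M≤N = bool (isEven (suc i)) ≡.refl
      where
      bool : ∀ b → isEven (suc i) ≡ b → ιS (cosecCoeff (suc i)) M ℚ.+ Y i M ≡ prefactor i ℚ.* g (suc i) M
      bool true e = ≡.trans (rank-g-even i (suc r) M e) (≡.cong (λ z → prefactor i ℚ.* gSeries (+ 2) (+ z) (suc i) M) (≡.sym b≡))
      bool false e = ≡.trans (≡.cong₂ ℚ._+_ (Hy.cosec-odd (suc i) e M M≤N) (rankSeries-even i (suc r) M (even (isEven i) (≡.trans (≡.sym (isEven-suc i)) e))))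
        (≡.sym (≡.trans (≡.cong (prefactor i ℚ.*_) (gSeries-odd (2 ℕ.* k ∸ 1) i M e)) (ℚₚ.*-zeroʳ (prefactor i))))
        where
        even : ∀ b → not b ≡ false → b ≡ true
        even true _ = ≡.refl

  powB-pow : ∀ A n → powB A n B.≈ Power.pow RA.seriesRing A n
  powB-pow A zero = B.refl
  powB-pow A (suc n) = B.*-congˡ {x = A} (powB-pow A n)

  X-expo : X B.≈ RA.expo F
  X-expo i _ = go (range 0 i)
    where
    go : ∀ xs → sumS (map (λ n → scaleS (recip (n !)) (powB F n i)) xs) S.≈ SR.sumList (map (λ n → RA.κ n S.* Power.pow RA.seriesRing F n i) xs)
    go [] = S.refl {x = S.0#}
    go (n ∷ xs) = S.+-cong {x = scaleS (recip (n !)) (powB F n i)}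
        {u = sumS (map (λ n → scaleS (recip (n !)) (powB F n i)) xs)}
        (S.trans (scaleS-ι (recip (n !)) (powB F n i)) (S.*-congˡ {x = RA.κ n} (powB-pow F n i tt))) (go xs)

  θ-X : RA.θ X B.≈ X B.* RA.θ F
  θ-X = B.trans (RA.θ-cong X-expo) (B.trans (RA.θ-expo F (S.refl {x = S.0#})) (B.*-congʳ {x = RA.θ F} (B.sym X-expo)))

  X-0 : X 0 S.≈ S.1#
  X-0 M _ = ≡.trans (ℚₚ.+-identityʳ (1ℚ ℚ.* oneS M)) (ℚₚ.*-identityˡ (oneS M))

  y⁺-F : PT.y⁺ B.≈ B.- F
  y⁺-F zero _ M _ = ≡.refl
  y⁺-F (suc n) _ M _ = ≡.refl

  T-X : T B.* X B.≈ B.1#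
  T-X = RA.θ-injective {T B.* X} {B.1#} coeff₀
    (B.trans (RA.θ-⊠ T X)
    (B.trans
      (B.+-cong {x = RA.θ T B.* X} {u = T B.* RA.θ X}
        (B.*-congʳ {x = X} (B.trans PT.θ-traceSeries (B.*-congˡ {x = T} θy)))
        (B.*-congˡ {x = T} θ-X))
    (B.trans (solve 3 (λ t x d → t :* (:- d) :* x :+ t :* (x :* d) := con (+ 0)) B.refl T X (RA.θ F))
      (B.sym (RA.θ-const S.1#)))))
    where
    coeff₀ : (T B.* X) 0 S.≈ S.1#
    coeff₀ = S.trans (RA.⊠-coeff₀ T X) (S.trans (S.*-congˡ {x = S.1#} X-0) (S.*-identityˡ S.1#))
    θy : RA.θ PT.y⁺ B.≈ B.- RA.θ F
    θy = B.trans (RA.θ-cong y⁺-F) (λ n _ → SS.solve 2 (λ a b → a SS.:* (SS.:- b) SS.:= SS.:- (a SS.:* b)) S.refl (RA.ν n) (F n))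

  θ-F : RA.θ F B.≈ RA.θ X B.* T
  θ-F = B.sym (B.trans (B.*-congʳ {x = T} θ-X)
    (B.trans (solve 3 (λ x d t → x :* d :* t := t :* x :* d) B.refl X (RA.θ F) T)
    (B.trans (B.*-congʳ {x = RA.θ F} T-X) (B.*-identityˡ (RA.θ F)))))

  conv-range₂ : ∀ i (G : ℕ → ℕ → QS) (h : ℕ → QS) → (∀ l → G 0 l S.≈ S.0#) → (∀ l → G 1 l S.≈ S.0#) →
    (∀ j l → suc (suc j) ℕ.+ l ≡ i → G (suc (suc j)) l S.≈ h (suc (suc j))) → SC.conv i G S.≈ sumS (map h (range 2 i))
  conv-range₂ zero G h z₀ z₁ e = z₀ 0
  conv-range₂ (suc zero) G h z₀ z₁ e = S.trans (S.+-cong {x = G 0 1} {u = G 1 0} (z₀ 1) (z₁ 0)) (S.+-identityˡ S.0#)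
  conv-range₂ (suc (suc i)) G h z₀ z₁ e = S.trans (S.+-cong {x = G 0 (suc (suc i))} {u = G 1 (suc i) S.+ C} (z₀ (suc (suc i))) (S.+-congʳ {x = C} (z₁ (suc i))))
    (S.trans (S.trans (S.+-identityˡ (S.0# S.+ C)) (S.+-identityˡ C))
    (S.trans (SC.conv-cong i (λ j l eq → e j l (≡.cong (λ z → suc (suc z)) eq)))
      (S.sym {x = sumS (map h (range 2 (suc (suc i))))} (SR.sum-range 2 i h))))
    where
    C : QS
    C = SC.conv i (λ j l → G (suc (suc j)) l)

  scale-collect : ∀ {a b d} u v → a ℚ.* (b ℚ.* d) ≡ u → ιS a S.* (ιS b S.* (ιS d S.* v)) S.≈ scaleS u v
  scale-collect {a} {b} {d} u v e = S.trans
    (S.sym (S.trans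
      (S.*-congʳ {x = v} (S.trans (ι-* a (b ℚ.* d)) (S.*-congˡ {x = ιS a} (ι-* b d))))
      (SS.solve 4 (λ a b d v → a SS.:* (b SS.:* d) SS.:* v SS.:= a SS.:* (b SS.:* (d SS.:* v))) S.refl (ιS a) (ιS b) (ιS d) v)))
    (S.trans (S.sym (scaleS-ι (a ℚ.* (b ℚ.* d)) v)) (λ M _ → ≡.cong (λ z → z ℚ.* v M) e))

  θF-suc : ∀ j → RA.θ F (suc j) S.≈ ιS (fromℕ (suc j)) S.* (ιS (fromℕ 2 ℚ.* recip (suc j !)) S.* f (suc j))
  θF-suc j = S.*-congˡ {x = ιS (fromℕ (suc j))} (scaleS-ι (fromℕ 2 ℚ.* recip (suc j !)) (f (suc j)))

  f-θF : ∀ i → ιS (halfFactorial i) S.* RA.θ F (suc i) S.≈ f (suc i)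
  f-θF i = S.trans
    (S.*-congˡ {x = ιS (halfFactorial i)} (θF-suc i))
    (S.trans (scale-collect 1ℚ (f (suc i)) (halfFactorial-f i)) (λ M _ → ℚₚ.*-identityˡ (f (suc i) M)))

  θX-suc : ∀ i → RA.θ X (suc i) S.≈ ιS (fromℕ (suc i)) S.* (ιS (prefactor i) S.* g (suc i))
  θX-suc i = S.*-congˡ {x = ιS (fromℕ (suc i))} (X-suc i)

  X-1 : X 1 S.≈ S.0#
  X-1 = S.trans (X-suc 0) (S.zeroʳ (ιS (prefactor 0)))

  θX-1 : RA.θ X 1 S.≈ S.0#
  θX-1 = S.trans (S.*-congˡ {x = RA.ν 1} X-1) (S.zeroʳ (RA.ν 1))

  θ-0 : ∀ A → RA.θ A 0 S.≈ S.0#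
  θ-0 A = RA.ν-0 (A 0)

  *-zero : ∀ {a} → a S.≈ S.0# → ∀ b → a S.* b S.≈ S.0#
  *-zero {a} e b = S.trans (S.*-congʳ {x = b} e) (S.zeroˡ b)

  θF-step : ∀ i → RA.θ X (suc i) S.≈ SC.conv i (λ j l → RA.θ F j S.* X (suc l)) S.+ RA.θ F (suc i)
  θF-step i = S.trans (θ-X (suc i) tt)
    (S.trans (RA.⊠-comm X (RA.θ F) (suc i))
    (S.trans (RA.⊠-conv (RA.θ F) X (suc i))
    (S.trans (SC.conv-last i (λ j l → RA.θ F j S.* X l))
      (S.+-congˡ {x = SC.conv i (λ j l → RA.θ F j S.* X (suc l))} (S.trans (S.*-congˡ {x = RA.θ F (suc i)} X-0) (S.*-identityʳ (RA.θ F (suc i))))))))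

  θF-1 : RA.θ F 1 S.≈ S.0#
  θF-1 = S.trans (S.sym (S.+-identityˡ (RA.θ F 1)))
    (S.trans (S.+-congʳ {x = RA.θ F 1} (S.sym (*-zero (θ-0 F) (X 1))))
    (S.trans (S.sym (θF-step 0)) θX-1))

  rhs1-term : ℕ → ℕ → QS
  rhs1-term n ℓ = scaleS (fromℕ ((n ∸ 1) C (ℓ ∸ 1)) ℚ.* fromℕ (n ∸ ℓ) ℚ.* twoPowNeg (+ n ℤ.- + ℓ ℤ.- + 2)) (f ℓ *S g (n ∸ ℓ))

  recursion₁ : ∀ i → f (suc i) S.≈ rhs1 k f (suc i)
  recursion₁ i = S.trans (S.sym (f-θF i))
    (S.trans
      (S.trans
        (SS.solve 3 (λ s c x → s SS.:* x SS.:= s SS.:* (c SS.:+ x) SS.:- s SS.:* c) S.refl s V (RA.θ F (suc i)))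
        (S.+-congʳ {x = S.- (s S.* V)} (S.*-congˡ {x = s} (S.sym (θF-step i)))))
      (S.+-cong {x = s S.* RA.θ X (suc i)} {u = S.- (s S.* V)}
        head (S.-‿cong (S.trans
        (S.sym (SC.conv-*ˡ i s (λ j l → RA.θ F j S.* X (suc l))))
        (conv-range₂ i (λ j l → s S.* (RA.θ F j S.* X (suc l))) (rhs1-term (suc i))
          (λ l → vanish (θ-0 F) l) (λ l → vanish θF-1 l) term)))))
    where
    s = ιS (halfFactorial i)
    V : QS
    V = SC.conv i (λ j l → RA.θ F j S.* X (suc l))
    head : s S.* RA.θ X (suc i) S.≈ scaleS (fromℕ (suc i) ℚ.* twoPowNeg (+ suc i ℤ.- + 1)) (g (suc i))
    head = S.trans (S.*-congˡ {x = s} (θX-suc i))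
      (scale-collect (fromℕ (suc i) ℚ.* twoPowNeg (+ suc i ℤ.- + 1)) (g (suc i)) (≡.trans (halfFactorial-g i i)
        (≡.trans (≡.cong (fromℕ (suc i) ℚ.* twoPowNeg (+ suc i ℤ.- + 1) ℚ.*_) (fromℕ!-recip i)) (ℚₚ.*-identityʳ (fromℕ (suc i) ℚ.* twoPowNeg (+ suc i ℤ.- + 1))))))
    vanish : ∀ {a} → a S.≈ S.0# → ∀ l → s S.* (a S.* X (suc l)) S.≈ S.0#
    vanish {a} e l = S.trans (S.*-congˡ {x = s} (*-zero e (X (suc l)))) (S.zeroʳ s)
    term : ∀ j l → suc (suc j) ℕ.+ l ≡ i → s S.* (RA.θ F (suc (suc j)) S.* X (suc l)) S.≈ rhs1-term (suc i) (suc (suc j))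
    term j l ≡.refl = S.trans
        (S.*-congˡ {x = s} (S.trans
          (S.*-cong {x = RA.θ F (suc (suc j))} {u = X (suc l)} (θF-suc (suc j)) (X-suc l))
          (S.trans
            (SS.solve 5 (λ n c f p g → n SS.:* (c SS.:* f) SS.:* (p SS.:* g) SS.:= n SS.:* c SS.:* (p SS.:* (f SS.:* g))) S.refl (ιS n) (ιS c) (f (suc (suc j))) (ιS (prefactor l)) (g (suc l)))
            (S.*-congʳ {x = ιS (prefactor l) S.* (f (suc (suc j)) S.* g (suc l))} (S.sym (ι-* n c))))))
        (S.trans
          (scale-collect coefficient (f (suc (suc j)) S.* g (suc l)) value)
          (λ M _ → ≡.cong (λ z → (scaleS (fromℕ (i C suc j) ℚ.* fromℕ z ℚ.* twoPowNeg (+ suc i ℤ.- + suc (suc j) ℤ.- + 2)) (f (suc (suc j)) *S g z)) M) (≡.sym index)))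
      where
      n = fromℕ (suc (suc j))
      c = fromℕ 2 ℚ.* recip (suc (suc j) !)
      coefficient = fromℕ (i C suc j) ℚ.* fromℕ (suc l) ℚ.* twoPowNeg (+ suc i ℤ.- + suc (suc j) ℤ.- + 2)
      index : suc i ∸ suc (suc j) ≡ suc l
      index = ≡.trans (≡.cong (_∸ j) (≡.sym (ℕₚ.+-suc j l))) (ℕₚ.m+n∸m≡n j (suc l))
      value : halfFactorial i ℚ.* (n ℚ.* c ℚ.* prefactor l) ≡ coefficient
      value = ≡.subst (λ z → halfFactorial z ℚ.* (n ℚ.* c ℚ.* prefactor l) ≡ fromℕ (z C suc j) ℚ.* fromℕ (suc l) ℚ.* twoPowNeg (+ suc z ℤ.- + suc (suc j) ℤ.- + 2))
        (≡.cong suc (ℕₚ.+-suc j l)) (halfFactorial-fg (suc j) l)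

  rhs2-term : ℕ → ℕ → QS
  rhs2-term n ℓ = scaleS (fromℕ ℓ ℚ.* twoPowNeg (+ ℓ ℤ.- + 1) ℚ.* (fromℕ ((n ∸ 1) !) ℚ.* recip ((ℓ ∸ 1) !))) (g ℓ *S Tr (n ∸ ℓ) f)

  recursion₂ : ∀ i → f (suc i) S.≈ rhs2 k f (suc i)
  recursion₂ i = S.trans (S.sym (f-θF i))
    (S.trans
      (S.*-congˡ {x = s} (S.trans (θ-F (suc i) tt) (RA.⊠-conv (RA.θ X) T (suc i))))
    (S.trans (S.sym (SC.conv-*ˡ (suc i) s (λ ℓ m → RA.θ X ℓ S.* T m)))
      (conv-range₂ (suc i) (λ ℓ m → s S.* (RA.θ X ℓ S.* T m)) (rhs2-term (suc i)) (λ m → vanish (θ-0 X) m) (λ m → vanish θX-1 m) term)))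
    where
    s = ιS (halfFactorial i)
    vanish : ∀ {a} → a S.≈ S.0# → ∀ m → s S.* (a S.* T m) S.≈ S.0#
    vanish {a} e m = S.trans (S.*-congˡ {x = s} (*-zero e (T m))) (S.zeroʳ s)
    term : ∀ j m → suc (suc j) ℕ.+ m ≡ suc i → s S.* (RA.θ X (suc (suc j)) S.* T m) S.≈ rhs2-term (suc i) (suc (suc j))
    term j m e = S.trans
        (S.*-congˡ {x = s} (S.trans
          (S.*-cong {x = RA.θ X ℓ} {u = T m} (θX-suc (suc j)) (S.sym {x = Tr m f} (Tr-series m)))
          (SS.solve 4 (λ n p g t → n SS.:* (p SS.:* g) SS.:* t SS.:= n SS.:* (p SS.:* (g SS.:* t))) S.refl (ιS (fromℕ ℓ)) (ιS (prefactor (suc j))) (g ℓ) (Tr m f))))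
        (S.trans (scale-collect coefficient (g ℓ S.* Tr m f) (halfFactorial-g i (suc j)))
          (λ M _ → ≡.cong (λ z → scaleS coefficient (g ℓ *S Tr z f) M) (≡.sym index)))
      where
      ℓ = suc (suc j)
      coefficient = fromℕ ℓ ℚ.* twoPowNeg (+ ℓ ℤ.- + 1) ℚ.* (fromℕ (i !) ℚ.* recip (suc j !))
      index : suc i ∸ ℓ ≡ m
      index = ≡.trans (≡.cong (_∸ ℓ) (≡.sym e)) (ℕₚ.m+n∸m≡n ℓ m)

theorem1p4 : (k : ℕ) → 3 ≤ k → (f : ℕ → QS) → IsFk k f →
    (n : ℕ) → 1 ≤ n → (f n ≈S rhs1 k f n) × (f n ≈S rhs2 k f n)
theorem1p4 (suc zero) (s≤s ())
theorem1p4 (suc (suc r)) _ f isFk (suc i) _ =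
  (λ N → Recursions.recursion₁ r f isFk N i N ℕₚ.≤-refl) , (λ N → Recursions.recursion₂ r f isFk N i N ℕₚ.≤-refl)
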